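{- Let $\Gamma$ be a constraint language on a finite set $D$ containing only binary relations, such that $\Gamma$ has an $(n+1)$-ary near-unanimity polymorphism ($n\ge 2$). If an instance $\mathcal I$ of $\mathrm{CSP}(\Gamma)$ satisfies condition $(\mathrm{IPQ})_n$, then $\mathcal I$ is satisfiable (i.e. some assignment satisfies all its constraints).
   Context: An instance of $\mathrm{CSP}(\Gamma)$ is $\mathcal I=(V,\mathcal C)$ with $V$ a finite set of variables and $\mathcal C$ a finite set of constraints $((x,y),R)$ with $x,y\in V$ and $R\in\Gamma$ binary. A polymorphism of $\Gamma$ is an operation $f:D^{n+1}\to D$ such that for each $R\in\Gamma$ and $(a_i,b_i)\in R$ ($1\le i\le n+1$) we have $(f(a_1,\dots,a_{n+1}),f(b_1,\dots,b_{n+1}))\in R$; it is near-unanimity if $f(y,x,\dots,x)=f(x,y,x,\dots,x)=\dots=f(x,\dots,x,y)=x$ for all $x,y\in D$. A pattern in $\mathcal I$ is a finite directed multigraph $p$ whose vertices are labeled by variables of $\mathcal I$ and whose edges are labeled by constraints of $\mathcal I$, so that an edge labeled $((x,y),R)$ starts at a vertex labeled $x$ and ends at a vertex labeled $y$, together with two distinguished vertices, its beginning and end; if they are labeled $x$ and $y$, $p$ is a pattern from $x$ to $y$. If the end of $p$ and the beginning of $q$ carry the same label, $p+q$ is obtained from the disjoint union of $p$ and $q$ by identifying the end of $p$ with the beginning of $q$, with beginning that of $p$ and end that of $q$; $jp$ denotes $p+\dots+p$ ($j$ copies), and $0p$ is the one-vertex pattern (so $0(p+q)+p=p$). An $n$-tree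 pattern is a pattern whose underlying graph is an orientation of a tree with at most $n$ leaves, whose beginning and end are both leaves. A path of $n$-trees is a pattern of the form $t_1+\dots+t_j$ with each $t_i$ an $n$-tree pattern. A realization of $p$ is a map $r$ from the vertices of $p$ to $D$ such that $(r(u),r(v))\in R$ for every edge $(u,v)$ labeled $((x,y),R)$ (vertices with the same label may receive different values). Given non-empty sets $D^\ell_x\subseteq D$ ($x\in V$, $1\le\ell\le|D|+1$), an $\ell$-realization of $p$ is a realization $r$ with $r(v)\in D^{\ell+1}_x$ for each vertex $v$ labeled $x$; for $A\subseteq D$ and $p$ with beginning $b$ and end $e$, $A+^\ell p=\{r(e): r\text{ an }\ell\text{ -realization of }p,\ r(b)\in A\}$. Condition $(\mathrm{IPQ})_n$: for every $y\in V$ there are non-empty sets $D^1_y\subseteq D^2_y\subseteq\dots\subseteq D^{|D|}_y\subseteq D^{|D|+1}_y=D$ such that for every $x\in V$, every $\ell\le|D|$, every $a\in D^\ell_x$, and every two patterns $p,q$ from $x$ to $x$ which are paths of $n$-trees in $\mathcal I$, there exists an integer $j\ge0$ with $a\in\{a\}+^\ell(j(p+q)+p)$. -}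

module Defs where

open import Data.Nat using (ℕ; zero; suc; _+_; _≤_; _≤?_)
import Data.Fin
open import Data.Fin using (Fin; _↑ˡ_; _↑ʳ_; splitAt; punchOut; punchIn; inject₁; fromℕ)
open import Data.Fin.Properties using (_≟_)
open import Data.Fin.Subset using (Subset; _∈_; _⊆_; Nonempty; ⊤)
open import Data.Nat.ListAction using (sum)
open import Data.List using (List; map; allFin; filter; length)
open import Data.Sum using (_⊎_; inj₁; inj₂; [_,_])
open import Data.Product using (Σ; ∃; _×_; _,_)
open import Data.Bool using (if_then_else_)
open import Relation.Nullary using (Dec; yes; no; does)
open import Relation.Binary.PropositionalEquality using (_≡_)

-- Domain D = Fin d.  A constraint language Γ of binary relations is
-- given as a family of relations indexed by a type ι.

BinRel : ℕ → Set₁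
BinRel d = Fin d → Fin d → Set

IsPolymorphism : ∀ {d ι} (n : ℕ) → (ι → BinRel d) → ((Fin (suc n) → Fin d) → Fin d) → Set
IsPolymorphism {d} {ι} n Γ f =
  (R : ι) (a b : Fin (suc n) → Fin d) → (∀ k → Γ R (a k) (b k)) → Γ R (f a) (f b)

nuArg : ∀ {d n} → Fin d → Fin d → Fin (suc n) → Fin (suc n) → Fin d
nuArg x y i k = if does (k ≟ i) then y else x

IsNearUnanimity : ∀ {d} (n : ℕ) → ((Fin (suc n) → Fin d) → Fin d) → Set
IsNearUnanimity {d} n f = (x y : Fin d) (i : Fin (suc n)) → f (nuArg x y i) ≡ x

-- Instances: variables Fin m, constraints indexed by Fin nc;
-- constraint c is ((cx c , cy c) , crel c).

record Instance (m : ℕ) (ι : Set) : Set where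
  field
    nc   : ℕ
    cx   : Fin nc → Fin m
    cy   : Fin nc → Fin m
    crel : Fin nc → ι
open Instance public

Satisfiable : ∀ {d m ι} → (ι → BinRel d) → Instance m ι → Set
Satisfiable {d} {m} Γ I =
  ∃ λ (s : Fin m → Fin d) → (c : Fin (nc I)) → Γ (crel I c) (s (cx I c)) (s (cy I c))

-- Raw patterns: finite directed multigraphs with vertices Fin (suc nv)
-- labelled by variables, edges Fin ne labelled by constraints (Fin nc),
-- with a beginning and an end vertex.

record RawPattern (m nc : ℕ) : Set where
  field
    nv  : ℕ
    lab : Fin (suc nv) → Fin m
    ne  : ℕ
    src : Fin ne → Fin (suc nv)
    tgt : Fin ne → Fin (suc nv)
    con : Fin ne → Fin nc
    beg : Fin (suc nv)
    end : Fin (suc nv)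
open RawPattern public

IsPattern : ∀ {m ι} (I : Instance m ι) → RawPattern m (nc I) → Set
IsPattern I p = (e : Fin (ne p)) →
  (lab p (src p e) ≡ cx I (con p e)) × (lab p (tgt p e) ≡ cy I (con p e))

-- p + q: disjoint union, identifying end of p with beginning of q
_⊕_ : ∀ {m nc} → RawPattern m nc → RawPattern m nc → RawPattern m nc
_⊕_ {m} {nc} p q = record
  { nv  = nv p + nv q
  ; lab = λ w → [ lab p , (λ k → lab q (punchIn (beg q) k)) ] (splitAt (suc (nv p)) w)
  ; ne  = ne p + ne q
  ; src = λ e → [ (λ e' → ip (src p e')) , (λ e' → iq (src q e')) ] (splitAt (ne p) e)
  ; tgt = λ e → [ (λ e' → ip (tgt p e')) , (λ e' → iq (tgt q e')) ] (splitAt (ne p) e)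
  ; con = λ e → [ con p , con q ] (splitAt (ne p) e)
  ; beg = ip (beg p)
  ; end = iq (end q)
  }
  where
  ip : Fin (suc (nv p)) → Fin (suc (nv p + nv q))
  ip v = v ↑ˡ nv q
  iq : Fin (suc (nv q)) → Fin (suc (nv p + nv q))
  iq v with beg q ≟ v
  ... | yes _  = ip (end p)
  ... | no b≢v = suc (nv p) ↑ʳ punchOut b≢v

iterPQ : ∀ {m nc} → ℕ → RawPattern m nc → RawPattern m nc → RawPattern m nc
iterPQ zero    p q = p
iterPQ (suc j) p q = (p ⊕ q) ⊕ iterPQ j p q

data Reach {m nc} (p : RawPattern m nc) : Fin (suc (nv p)) → Fin (suc (nv p)) → Set where
  here : ∀ {u} → Reach p u u
  fwd  : ∀ {w} (e : Fin (ne p)) → Reach p (tgt p e) w → Reach p (src p e) w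
  bwd  : ∀ {w} (e : Fin (ne p)) → Reach p (src p e) w → Reach p (tgt p e) w

Connected : ∀ {m nc} → RawPattern m nc → Set
Connected p = ∀ u v → Reach p u v

-- a tree: connected, with |E| = |V| - 1  (|V| = suc (nv p))
IsTree : ∀ {m nc} → RawPattern m nc → Set
IsTree p = Connected p × (ne p ≡ nv p)

ind : ∀ {A : Set} → Dec A → ℕ
ind x = if does x then 1 else 0

degree : ∀ {m nc} (p : RawPattern m nc) → Fin (suc (nv p)) → ℕ
degree p v = sum (map (λ e → ind (src p e ≟ v) + ind (tgt p e ≟ v)) (allFin (ne p)))

-- leaf of a tree: degree ≤ 1 (degree 1, or the single vertex of a one-vertex tree)
IsLeaf : ∀ {m nc} (p : RawPattern m nc) → Fin (suc (nv p)) → Set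
IsLeaf p v = degree p v ≤ 1

numLeaves : ∀ {m nc} → RawPattern m nc → ℕ
numLeaves p = length (filter (λ v → degree p v ≤? 1) (allFin (suc (nv p))))

IsNTree : ∀ {m ι} (I : Instance m ι) → ℕ → RawPattern m (nc I) → Set
IsNTree I n t = IsPattern I t × IsTree t × (numLeaves t ≤ n)
                × IsLeaf t (beg t) × IsLeaf t (end t)

data PathOfNTrees {m ι} (I : Instance m ι) (n : ℕ) : RawPattern m (nc I) → Set where
  single : ∀ {t} → IsNTree I n t → PathOfNTrees I n t
  cons   : ∀ {t q} → IsNTree I n t → PathOfNTrees I n q →
           lab t (end t) ≡ lab q (beg q) → PathOfNTrees I n (t ⊕ q)

-- Families D^ℓ_y : index i : Fin (suc d) stands for ℓ = toℕ i + 1,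
-- so D^{|D|+1}_y is index fromℕ d.

Family : ℕ → ℕ → Set
Family m d = Fin m → Fin (suc d) → Subset d

IsRealization : ∀ {d m ι} (Γ : ι → BinRel d) (I : Instance m ι) (p : RawPattern m (nc I)) →
                (Fin (suc (nv p)) → Fin d) → Set
IsRealization Γ I p r = (e : Fin (ne p)) → Γ (crel I (con p e)) (r (src p e)) (r (tgt p e))

-- ℓ-realization, for ℓ = toℕ i + 1 with i : Fin d (so ℓ ≤ |D|); uses D^{ℓ+1}
IsLRealization : ∀ {d m ι} (Γ : ι → BinRel d) (I : Instance m ι) (Ds : Family m d) (i : Fin d)
                 (p : RawPattern m (nc I)) → (Fin (suc (nv p)) → Fin d) → Set
IsLRealization Γ I Ds i p r =
  IsRealization Γ I p r × ((v : Fin (suc (nv p))) → r v ∈ Ds (lab p v) (Data.Fin.suc i))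


InSingletonPlus : ∀ {d m ι} (Γ : ι → BinRel d) (I : Instance m ι) (Ds : Family m d) (i : Fin d)
                  (a : Fin d) (p : RawPattern m (nc I)) (b : Fin d) → Set
InSingletonPlus {d} Γ I Ds i a p b =
  ∃ λ (r : Fin (suc (nv p)) → Fin d) →
    IsLRealization Γ I Ds i p r × (r (beg p) ≡ a) × (r (end p) ≡ b)

IPQ : ∀ {d m ι} (n : ℕ) (Γ : ι → BinRel d) (I : Instance m ι) → Set
IPQ {d} {m} n Γ I = Σ (Family m d) λ Ds →
    ((y : Fin m) (ℓ : Fin (suc d)) → Nonempty (Ds y ℓ))
  × ((y : Fin m) (i : Fin d) → Ds y (inject₁ i) ⊆ Ds y (Data.Fin.suc i))
  × ((y : Fin m) → Ds y (fromℕ d) ≡ ⊤)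
  × ((x : Fin m) (i : Fin d) (a : Fin d) → a ∈ Ds x (inject₁ i) →
     (p q : RawPattern m (nc I)) →
     PathOfNTrees I n p → lab p (beg p) ≡ x → lab p (end p) ≡ x →
     PathOfNTrees I n q → lab q (beg q) ≡ x → lab q (end q) ≡ x →
     ∃ λ (j : ℕ) → InSingletonPlus Γ I Ds i a (iterPQ j p q) a)

{-# OPTIONS --safe #-}

-- The sets D^ℓ_x may be replaced by the subalgebras they generate.  By counting,
-- D^ℓ_x = D^{ℓ+1}_x for some ℓ = ℓ(x), and the variables are assigned in order of ℓ(x).  The
-- invariant is that all trees with at most n leaves, all of them at assigned variables, have an
-- (ℓ-1)-realisation with the assigned values at the leaves.
--
-- At level ℓ consider trees glued from trees with at most n leaves at variables x with
-- ℓ(x) = ℓ.  By near-unanimity it suffices to prescribe the values of n leaves at a time; the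
-- invariant then provides a realisation of the subtree spanned by them, and (IPQ)_n extends it
-- to the rest.  Hence there are non-empty arc-consistent domains A_x that are compatible with
-- the values assigned earlier and absorb D^ℓ_x with respect to f.  Such domains with
-- |A_x| > 1 can be shrunk, until they are singletons and give the next values:
--
-- * Recurrent values that are connected by a walk through D^{ℓ+1} are connected by a walk
--   inside A, by moving one argument of f at a time along the first walk.  With (IPQ)_n this
--   yields: if C + p + q = C in A, then C + m(q + p) ⊆ C + p for large m.
-- * Call C ⊊ A_x k-strong if f maps to C all tuples whose entries from position k on are in C.
--   Singletons are 1-strong.  Let k be maximal, and let C be k-strong and reachable from each of
--   its images C + w ≠ A_x.  By the first point there is a z such that C + w + z ⊆ C whenever
--   C + w ≠ A_x.
-- * Consider a tree with root x and some leaves restricted to C.  If each of these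
--   restrictions alone leaves the root unrestricted, then so do all of them together, since
--   otherwise the set of root values would be (k+1)-strong.  Hence the set of root values is
--   A_x or contained in some C + w ≠ A_x.
-- * Prolonging a tree by z, it follows by induction on the number of restricted leaves that
--   every tree can be realised with all its leaves at x in C.  So restricting A_x to C and
--   enforcing arc-consistency leaves non-empty domains.

module Submission where

open import Defs
open import Data.Nat using (ℕ; zero; suc; _+_; _*_; _∸_; _≤_; _<_; z≤n; s≤s; _≤?_)
import Data.Nat.Properties as ℕ
open import Data.Nat.ListAction using (sum)
open import Data.Nat.Tactic.RingSolver using (solve-∀)
open import Data.Fin using (Fin; zero; suc; toℕ; fromℕ; fromℕ<; inject₁; inject≤; _↑ˡ_; _↑ʳ_; punchOut)
open import Data.Fin.Induction using (<-weakInduction)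
open import Data.Fin.Properties using (_≟_; any?; all?; pigeonhole; toℕ<n; toℕ-fromℕ; toℕ-fromℕ<; toℕ-inject₁; toℕ-injective; suc-injective; inject≤-injective; splitAt-↑ˡ; splitAt-↑ʳ; punchIn-punchOut)
open import Data.Fin.Subset using (Subset; _∈_; ∣_∣; Nonempty) renaming (_⊆_ to _⊆ˢ_)
open import Data.Fin.Subset.Properties using (drop-∷-⊆; ∣p∣≤n; p⊆q⇒∣p∣≤∣q∣; ∣⁅x⁆∣≡1; x∈⁅y⁆⇒x≡y)
open import Data.Bool using (Bool; true; false; if_then_else_; not; T)
import Data.Bool.Properties as Bool
open import Data.List using (List; []; _∷_; map; allFin; filter; length; removeAt; upTo) renaming (_++_ to _++ˡ_; tabulate to tabulateˡ)
open import Data.List.Properties using (map-tabulate; length-removeAt′)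
open import Data.List.Membership.Propositional using () renaming (_∈_ to _∈ˡ_)
open import Data.List.Membership.Propositional.Properties using (∈-upTo⁺; ∈-++⁺ˡ; ∈-++⁺ʳ; ∈-map⁺)
open import Data.List.Membership.DecPropositional ℕ._≟_ using (_∈?_)
open import Data.List.Relation.Unary.Any using (here; there; index)
open import Data.Vec using (Vec; []; _∷_; here; lookup; tabulate)
open import Data.Vec.Properties using (≡-dec; lookup∘tabulate; tabulate-cong)
open import Data.Maybe using (Maybe; nothing; just)
open import Data.Product using (Σ; ∃; _×_; _,_; proj₁; proj₂)
open import Data.Sum as Sum using (_⊎_; inj₁; inj₂; [_,_])
open import Data.Empty using (⊥; ⊥-elim)
open import Data.Unit using (⊤; tt)
open import Relation.Nullary using (Dec; yes; no; does)
open import Relation.Nullary.Decidable using (dec-true; dec-false)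
open import Relation.Unary using (Pred; Decidable)
open import Relation.Binary.Definitions using (tri<; tri≈; tri>)
open import Relation.Binary.PropositionalEquality using (_≡_; _≢_; refl; sym; trans; cong; cong₂; subst; subst₂)
open import Function using (_∘_; id)

-- Normalising the near-unanimity operation

-- Since f is not known to respect pointwise equality, it is replaced by an
-- operation that only sees the table of its argument and passes f the literal
-- tuple nuArg x y i whenever that table agrees with one.

module Normalise {d n : ℕ} (2≤n : 2 ≤ n) (f : (Fin (suc n) → Fin d) → Fin d)
                 (nu : IsNearUnanimity n f) where

  NearlyConst : (Fin (suc n) → Fin d) → Set
  NearlyConst a = ∃ λ x → ∃ λ y → ∃ λ i → ∀ k → a k ≡ nuArg x y i k

  nearlyConst? : ∀ a → Dec (NearlyConst a)
  nearlyConst? a = any? λ x → any? λ y → any? λ i → all? λ k → a k ≟ nuArg x y i k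

  canon : ∀ a → Dec (NearlyConst a) → Fin (suc n) → Fin d
  canon a (yes (x , y , i , _)) = nuArg x y i
  canon a (no _)                = a

  canon≗ : ∀ a D k → canon a D k ≡ a k
  canon≗ a (yes (_ , _ , _ , eq)) k = sym (eq k)
  canon≗ a (no _) k = refl

  table : (Fin (suc n) → Fin d) → Fin (suc n) → Fin d
  table a = lookup (tabulate a)

  h : (Fin (suc n) → Fin d) → Fin d
  h a = f (canon a (nearlyConst? a))

  g : (Fin (suc n) → Fin d) → Fin d
  g a = h (table a)

  g-ext : ∀ a b → (∀ k → a k ≡ b k) → g a ≡ g b
  g-ext a b eq = cong (λ v → h (lookup v)) (tabulate-cong eq)

  nuArg-off : ∀ {x y : Fin d} {i k : Fin (suc n)} → k ≢ i → nuArg x y i k ≡ x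
  nuArg-off {i = i} {k} k≢i with k ≟ i
  ... | yes k≡i = ⊥-elim (k≢i k≡i)
  ... | no _    = refl

  third : ∀ {n} → 2 ≤ n → (i j : Fin (suc n)) → ∃ λ k → k ≢ i × k ≢ j
  third (s≤s (s≤s _)) zero          zero          = suc zero , (λ ()) , (λ ())
  third (s≤s (s≤s _)) zero          (suc zero)    = suc (suc zero) , (λ ()) , (λ ())
  third (s≤s (s≤s _)) zero          (suc (suc j)) = suc zero , (λ ()) , (λ ())
  third (s≤s (s≤s _)) (suc zero)    zero          = suc (suc zero) , (λ ()) , (λ ())
  third (s≤s (s≤s _)) (suc (suc i)) zero          = suc zero , (λ ()) , (λ ())
  third (s≤s (s≤s _)) (suc i)       (suc j)       = zero , (λ ()) , (λ ())

  -- The tuple may be recognised as nearly constant in another way than the given one. Since there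
  -- are at least three coordinates, some coordinate is exceptional for neither, and so the two
  -- majority values coincide.
  h-nu : ∀ a i x → (∀ k → k ≢ i → a k ≡ x) → h a ≡ x
  h-nu a i x eqs with nearlyConst? a
  ... | no ¬p = ⊥-elim (¬p (x , a i , i , eq))
    where
    eq : ∀ k → a k ≡ nuArg x (a i) i k
    eq k with k ≟ i
    ... | yes refl = refl
    ... | no k≢i   = eqs k k≢i
  ... | yes (x′ , y′ , i′ , eq) with third 2≤n i i′
  ...   | k , k≢i , k≢i′ =
    trans (nu x′ y′ i′) (trans (sym (nuArg-off k≢i′)) (trans (sym (eq k)) (eqs k k≢i)))

  g-nu : ∀ a i x → (∀ k → k ≢ i → a k ≡ x) → g a ≡ x
  g-nu a i x eqs = h-nu (table a) i x λ k k≢i → trans (lookup∘tabulate a k) (eqs k k≢i)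

  g-pol : ∀ {ι} {Γ : ι → BinRel d} → IsPolymorphism n Γ f → IsPolymorphism n Γ g
  g-pol {Γ = Γ} pol R a b r = pol R _ _ λ k → subst₂ (Γ R) (eq a k) (eq b k) (r k)
    where
    eq : ∀ a k → a k ≡ canon (table a) (nearlyConst? (table a)) k
    eq a k = sym (trans (canon≗ (table a) (nearlyConst? (table a)) k) (lookup∘tabulate a k))

-- Binary relations

Rel₂ : ℕ → Set₁
Rel₂ d = Fin d → Fin d → Set

module _ {d : ℕ} where

  infixr 6 _⨾_
  _⨾_ : Rel₂ d → Rel₂ d → Rel₂ d
  (P ⨾ Q) a b = ∃ λ c → P a c × Q c b

  infixr 7 _^^_
  _^^_ : Rel₂ d → ℕ → Rel₂ d
  (P ^^ zero)  = _≡_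
  (P ^^ suc k) = P ⨾ P ^^ k

  infix 4 _⊑_
  _⊑_ : Rel₂ d → Rel₂ d → Set
  P ⊑ Q = ∀ a b → P a b → Q a b

  ⨾-mono : ∀ {P P′ Q Q′} → P ⊑ P′ → Q ⊑ Q′ → P ⨾ Q ⊑ P′ ⨾ Q′
  ⨾-mono s t a b (c , p , q) = c , s a c p , t c b q

  ^^-mono : ∀ {P Q} k → P ⊑ Q → P ^^ k ⊑ Q ^^ k
  ^^-mono zero    s a b e = e
  ^^-mono (suc k) s = ⨾-mono s (^^-mono k s)

  ^^-+ : ∀ {P} j {k a b c} → (P ^^ j) a b → (P ^^ k) b c → (P ^^ (j + k)) a c
  ^^-+ zero    refl q = q
  ^^-+ (suc j) (x , p , r) q = x , p , ^^-+ j r q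

  ^^-split : ∀ {P} j {k a c} → (P ^^ (j + k)) a c → (P ^^ j ⨾ P ^^ k) a c
  ^^-split zero    q = _ , refl , q
  ^^-split (suc j) (x , p , r) with ^^-split j r
  ... | b , s , t = b , (x , p , s) , t

  ^^-loop : ∀ {P} {a} k j → (P ^^ k) a a → (P ^^ (j * k)) a a
  ^^-loop k zero    _ = refl
  ^^-loop k (suc j) l = ^^-+ k l (^^-loop k j l)

  ^^-flat : ∀ {P} L j → (P ^^ L) ^^ j ⊑ P ^^ (j * L)
  ^^-flat L zero    a b e = e
  ^^-flat L (suc j) a b (x , p , q) = ^^-+ L p (^^-flat L j x b q)

  shift : ∀ {P Q} k → P ⨾ (Q ⨾ P) ^^ k ⊑ (P ⨾ Q) ^^ k ⨾ P
  shift zero    a b (_ , p , refl) = _ , refl , p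
  shift (suc k) a b (x , p , y , (z , q , p′) , r) with shift k z b (y , p′ , r)
  ... | w , s , t = w , (z , (x , p , q) , s) , t

  close : ∀ {P Q} k {a b c} → (P ⨾ (Q ⨾ P) ^^ k) a b → Q b c → ((P ⨾ Q) ^^ suc k) a c
  close {P} {Q} k {a} {b} {c} w q with shift k a b w
  ... | x , s , p = subst (λ j → ((P ⨾ Q) ^^ j) a c) (ℕ.+-comm k 1) (^^-+ k s (c , (b , p , q) , refl))

  module _ {P : Rel₂ d} where

    vertex : ∀ N {a b} → (P ^^ N) a b → Fin (suc N) → Fin d
    vertex N       {a} w     zero    = a
    vertex (suc N) (_ , _ , r) (suc i) = vertex N r i

    prefix : ∀ N {a b} (w : (P ^^ N) a b) i → (P ^^ toℕ i) a (vertex N w i)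
    prefix N       w           zero    = refl
    prefix (suc N) (x , p , r) (suc i) = x , p , prefix N r i

    Recurrence : Fin d → Fin d → Set
    Recurrence a b = ∃ λ i → ∃ λ k → ∃ λ j → ∃ λ g →
                     (P ^^ i) a g × (P ^^ suc k) g g × (P ^^ j) g b

    revisit : ∀ N {a b} (w : (P ^^ N) a b) i j → toℕ i < toℕ j →
              vertex N w i ≡ vertex N w j → Recurrence a b
    revisit N {a} w zero (suc j) _ eq =
      0 , toℕ j , N , a , refl , subst ((P ^^ suc (toℕ j)) a) (sym eq) (prefix N w (suc j)) , w
    revisit (suc N) (x , p , r) (suc i) (suc j) (s≤s i<j) eq with revisit N r i j i<j eq
    ... | i′ , k , j′ , g , u , v , w = suc i′ , k , j′ , g , (x , p , u) , v , w

    -- A walk of at least `d` steps has more than `d` vertices, so by the pigeonhole principle it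
    -- visits some element twice.
    recurrent : ∀ N {a b} → d ≤ N → (P ^^ N) a b → Recurrence a b
    recurrent N d≤N w with pigeonhole (s≤s d≤N) (vertex N w)
    ... | i , j , i<j , eq = revisit N w i j i<j eq

-- Γ need not be decidable.  Classical reasoning relative to the answer type Ans is
-- sound because the goal, satisfiability, is taken as Ans (Friedman's translation).

module Classical (Ans : Set) where

  ◇ : Set → Set
  ◇ X = (X → Ans) → Ans

  return : ∀ {X} → X → ◇ X
  return x k = k x

  infixl 1 _>>=_
  _>>=_ : ∀ {X Y} → ◇ X → (X → ◇ Y) → ◇ Y
  (m >>= h) k = m λ x → h x k

  exfalso : ∀ {X} → Ans → ◇ X
  exfalso a _ = a

  -- The negative case refutes `X` only into `Ans`; a clash with it later produces the goal through
  -- `exfalso`.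
  em : (X : Set) → ◇ (X ⊎ (X → Ans))
  em X k = k (inj₂ (λ x → k (inj₁ x)))

  -- The modality commutes with this quantifier because the index set is finite.
  all-◇ : ∀ {n} {X : Fin n → Set} → (∀ i → ◇ (X i)) → ◇ (∀ i → X i)
  all-◇ {zero}  h = return λ ()
  all-◇ {suc n} h = do
    x  ← h zero
    xs ← all-◇ (λ i → h (suc i))
    return λ { zero → x ; (suc i) → xs i }

-- Absorption and walks

-- Relations come in pairs P : Bool → Rel₂ d, where P true is a relation and
-- P false a smaller one that absorbs it.

module Absorption {d n : ℕ} (f : (Fin (suc n) → Fin d) → Fin d)
                  (ext : ∀ a b → (∀ k → a k ≡ b k) → f a ≡ f b)
                  (nu : ∀ a i x → (∀ k → k ≢ i → a k ≡ x) → f a ≡ x) (Ans : Set) where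
  open Classical Ans

  -- The value `true` singles out the one coordinate at which absorption admits the larger relation.
  side : Fin (suc n) → Fin (suc n) → Bool
  side i k = does (k ≟ i)

  side-off : ∀ {i k} → k ≢ i → side i k ≡ false
  side-off {i} {k} k≢i with k ≟ i
  ... | yes k≡i = ⊥-elim (k≢i k≡i)
  ... | no _    = refl

  Absorbs : (Bool → Rel₂ d) → Set
  Absorbs P = ∀ i a b → (∀ k → P (side i k) (a k) (b k)) → ◇ (P false (f a) (f b))

  absorbs-⨾ : ∀ {P Q : Bool → Rel₂ d} → Absorbs P → Absorbs Q → Absorbs (λ s → P s ⨾ Q s)
  absorbs-⨾ α β i a b h = do
    u ← α i a (λ k → proj₁ (h k)) (λ k → proj₁ (proj₂ (h k)))
    v ← β i (λ k → proj₁ (h k)) b (λ k → proj₂ (proj₂ (h k)))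
    return (_ , u , v)

  absorbs-^^ : ∀ {P : Bool → Rel₂ d} j → Absorbs P → Absorbs (λ s → P s ^^ j)
  absorbs-^^ zero α i a b h = return (ext a b h)
  absorbs-^^ {P} (suc j) α = absorbs-⨾ {P} {λ s → P s ^^ j} α (absorbs-^^ {P} j α)

  -- Replace e by h one coordinate at a time; only that coordinate leaves P false.
  stagger₁ : ∀ {P : Bool → Rel₂ d} → Absorbs P → ∀ {e h} →
             P false e e → P false h h → P true e h → ◇ ((P false ^^ suc n) e h)
  stagger₁ {P} α {e} {h} pe ph peh = do
      w ← walk (suc n) 0 (ℕ.+-identityʳ (suc n))
      return (subst₂ (P false ^^ suc n) (nu (t 0) zero e λ k _ → t-≥ {0} {k} z≤n)
                     (nu (t (suc n)) zero h λ k _ → t-< (toℕ<n k)) w)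
    where
    t : ℕ → Fin (suc n) → Fin d
    t i k with toℕ k ℕ.<? i
    ... | yes _ = h
    ... | no _  = e
    t-< : ∀ {i k} → toℕ k < i → t i k ≡ h
    t-< {i} {k} k<i with toℕ k ℕ.<? i
    ... | yes _  = refl
    ... | no k≮i = ⊥-elim (k≮i k<i)
    t-≥ : ∀ {i k} → i ≤ toℕ k → t i k ≡ e
    t-≥ {i} {k} i≤k with toℕ k ℕ.<? i
    ... | yes k<i = ⊥-elim (ℕ.<⇒≱ k<i i≤k)
    ... | no _    = refl
    step : ∀ i (i<n : i < suc n) k → P (side (fromℕ< i<n) k) (t i k) (t (suc i) k)
    step i i<n k with k ≟ fromℕ< i<n
    ... | yes refl = subst₂ (P true) (sym (t-≥ (ℕ.≤-reflexive (sym (toℕ-fromℕ< i<n)))))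
                            (sym (t-< (s≤s (ℕ.≤-reflexive (toℕ-fromℕ< i<n))))) peh
    ... | no k≢i with ℕ.<-cmp (toℕ k) i
    ...   | tri< k<i _ _ = subst₂ (P false) (sym (t-< k<i)) (sym (t-< (ℕ.m<n⇒m<1+n k<i))) ph
    ...   | tri≈ _ k≡i _ = ⊥-elim (k≢i (toℕ-injective (trans k≡i (sym (toℕ-fromℕ< i<n)))))
    ...   | tri> _ _ i<k = subst₂ (P false) (sym (t-≥ (ℕ.<⇒≤ i<k))) (sym (t-≥ i<k)) pe
    walk : ∀ r i → r + i ≡ suc n → ◇ ((P false ^^ r) (f (t i)) (f (t (suc n))))
    walk zero    i refl = return refl
    walk (suc r) i eq = do
      p ← α (fromℕ< i<n) (t i) (t (suc i)) (step i i<n)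
      w ← walk r (suc i) (trans (ℕ.+-suc r i) eq)
      return (_ , p , w)
      where
      i<n : i < suc n
      i<n = subst (i <_) eq (s≤s (ℕ.m≤n+m i r))

  -- Steps are grouped into blocks of length `L`, a multiple of both loop lengths, so that the loops
  -- become single steps and `stagger₁` applies. The walk from `e` to `h` is prolonged along the
  -- loop of `h` to the vertex `h′` at which its length is exactly `L`; the rest `v` of that loop
  -- leads back to `h`.
  stagger : ∀ {P : Bool → Rel₂ d} → (P false ⊑ P true) → Absorbs P → ∀ {e h} k k′ N →
            (P false ^^ suc k) e e → (P false ^^ suc k′) h h → (P true ^^ N) e h →
            ◇ (∃ λ M → (P false ^^ M) e h)
  stagger {P} sub α {e} {h} k k′ N pe ph peh with ^^-split {P = P false} (L ∸ N) {N} h-loop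
    where
    K = suc k
    K′ = suc k′
    L = N * (K * K′)
    N≤L : N ≤ L
    N≤L = ℕ.m≤m*n N (K * K′)
    h-loop : (P false ^^ (L ∸ N + N)) h h
    h-loop = subst (λ j → (P false ^^ j) h h)
                   (trans (ℕ.*-assoc N K K′) (sym (ℕ.m∸n+n≡m N≤L))) (^^-loop {P = P false} K′ (N * K) ph)
  ... | h′ , u , v = do
      w ← stagger₁ {λ s → P s ^^ L} (absorbs-^^ {P} L α) e-loop
            (subst (λ j → (P false ^^ j) h′ h′) (ℕ.m+[n∸m]≡n N≤L) (^^-+ {P = P false} N {L ∸ N} v u))
            (subst (λ j → (P true ^^ j) e h′) (ℕ.m+[n∸m]≡n N≤L) (^^-+ {P = P true} N {L ∸ N} peh (^^-mono {P = P false} {Q = P true} (L ∸ N) sub h h′ u)))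
      return (suc n * L + N , ^^-+ {P = P false} (suc n * L) {N} (^^-flat {P = P false} L (suc n) e h′ w) v)
    where
    K = suc k
    K′ = suc k′
    L = N * (K * K′)
    N≤L : N ≤ L
    N≤L = ℕ.m≤m*n N (K * K′)
    e-loop : (P false ^^ L) e e
    e-loop = subst (λ j → (P false ^^ j) e e)
               (trans (ℕ.*-assoc N K′ K) (cong (N *_) (ℕ.*-comm K′ K))) (^^-loop {P = P false} K (N * K′) pe)

  -- By `back` and `stay`, `C` is its own image under the smaller `P ⨾ Q`. The return `pq` is only
  -- assumed in the larger relations; this is what `(IPQ)_n` provides.
  module Rotation {P Q : Bool → Rel₂ d} (P⊑ : P false ⊑ P true) (Q⊑ : Q false ⊑ Q true)
           (αP : Absorbs P) (αQ : Absorbs Q) {C : Fin d → Set}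
           (pq : ∀ c → C c → ◇ (∃ λ j → ((P true ⨾ Q true) ^^ j ⨾ P true) c c))
           (back : ∀ c → C c → ◇ (∃ λ b → C b × (P false ⨾ Q false) b c))
           (stay : ∀ {b c} → C b → (P false ⨾ Q false) b c → ◇ (C c)) where

    S : Bool → Rel₂ d
    S s = P s ⨾ Q s

    R : Bool → Rel₂ d
    R s = Q s ⨾ P s

    S⊑ : S false ⊑ S true
    S⊑ = ⨾-mono P⊑ Q⊑

    stay* : ∀ k {b c} → C b → (S false ^^ k) b c → ◇ (C c)
    stay* zero    cb refl = return cb
    stay* (suc k) cb (x , s , w) = stay cb s >>= λ cx → stay* k cx w

    back* : ∀ k c → C c → ◇ (∃ λ b → C b × (S false ^^ k) b c)
    back* zero    c cc = return (c , cc , refl)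
    back* (suc k) c cc = do
      (b , cb , w)  ← back* k c cc
      (b′ , cb′ , s) ← back b cb
      return (b′ , cb′ , _ , s , w)

    -- g₀ is recurrent under Q P, hence h under P Q, and h is reachable in P true from an
    -- element e of C recurrent under P Q, via the return of c to itself.
    rotate : ∀ N {c g} → d ≤ N → C c → (R false ^^ N) c g →
             ◇ (∃ λ b → C b × P false b g)
    rotate N {c} {g} d≤N cc w with recurrent {P = R false} N d≤N w
    ... | i , k , i′ , g₀ , c→g₀ , g₀→g₀ , g₀→g 
      with ^^-split {P = R false} k {1} (subst (λ j → (R false ^^ j) g₀ g₀) (ℕ.+-comm 1 k) g₀→g₀)
    ...   | y , g₀→y , (_ , (h , y→h , h→g₀) , refl) = do
      (b , cb , b→c) ← back* d c cc
      let (l , k′ , l′ , e , b→e , e→e , e→c) = recurrent {P = S false} d ℕ.≤-refl b→c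
      ce ← stay* l cb b→e
      (j , c→c) ← pq c cc
      let (c′ , u , v) = c→c
          c→h : (S true ^^ (j + suc (i + k))) c h
          c→h = ^^-+ {P = S true} j {suc (i + k)} u
                  (close {P = P true} {Q = Q true} (i + k)
                    (c , v , ^^-mono {P = R false} {Q = R true} (i + k) (⨾-mono Q⊑ P⊑) c y
                               (^^-+ {P = R false} i {k} c→g₀ g₀→y)) (Q⊑ y h y→h))
          h→h : (S false ^^ suc k) h h
          h→h = close {P = P false} {Q = Q false} k (g₀ , h→g₀ , g₀→y) y→h
      (M′ , e→h) ← stagger {S} S⊑ (absorbs-⨾ {P} {Q} αP αQ) k′ k (l′ + (j + suc (i + k))) e→e h→h
                     (^^-+ {P = S true} l′ {j + suc (i + k)} (^^-mono {P = S false} {Q = S true} l′ S⊑ e c e→c) c→h)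
      ch ← stay* M′ ce e→h
      let (z , h→z , z→g) = shift {P = P false} {Q = Q false} i′ h g (g₀ , h→g₀ , g₀→g)
      cz ← stay* i′ ch h→z
      return (z , cz , z→g)

-- Counting and finite sums

count : ∀ {k} → (Fin k → Bool) → ℕ
count {zero}  b = 0
count {suc k} b = (if b zero then 1 else 0) + count (b ∘ suc)

count-mono : ∀ {k} (b b′ : Fin k → Bool) → (∀ i → b i ≡ true → b′ i ≡ true) → count b ≤ count b′
count-mono {zero}  b b′ h = z≤n
count-mono {suc k} b b′ h with b zero in eq | b′ zero in eq′
... | true  | true  = s≤s (count-mono _ _ (h ∘ suc))
... | true  | false with () ← trans (sym eq′) (h zero eq)
... | false | true  = ℕ.m≤n⇒m≤1+n (count-mono _ _ (h ∘ suc))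
... | false | false = count-mono _ _ (h ∘ suc)

count-strict : ∀ {k} (b b′ : Fin k → Bool) → (∀ i → b i ≡ true → b′ i ≡ true) →
               ∀ i → b i ≡ false → b′ i ≡ true → suc (count b) ≤ count b′
count-strict {suc k} b b′ h zero p q rewrite p | q = s≤s (count-mono _ _ (h ∘ suc))
count-strict {suc k} b b′ h (suc i) p q with b zero in eq | b′ zero in eq′
... | true  | true  = s≤s (count-strict _ _ (h ∘ suc) i p q)
... | true  | false with () ← trans (sym eq′) (h zero eq)
... | false | true  = ℕ.m≤n⇒m≤1+n (count-strict _ _ (h ∘ suc) i p q)
... | false | false = count-strict _ _ (h ∘ suc) i p q

sumF : ∀ {k} → (Fin k → ℕ) → ℕ
sumF {zero}  h = 0
sumF {suc k} h = h zero + sumF (h ∘ suc)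

sumF-mono : ∀ {k} (g h : Fin k → ℕ) → (∀ i → g i ≤ h i) → sumF g ≤ sumF h
sumF-mono {zero}  g h le = z≤n
sumF-mono {suc k} g h le = ℕ.+-mono-≤ (le zero) (sumF-mono _ _ (le ∘ suc))

sumF-strict : ∀ {k} (g h : Fin k → ℕ) → (∀ i → g i ≤ h i) → ∀ i → g i < h i → sumF g < sumF h
sumF-strict g h le zero    lt = ℕ.+-mono-<-≤ lt (sumF-mono _ _ (le ∘ suc))
sumF-strict g h le (suc i) lt = ℕ.+-mono-≤-< (le zero) (sumF-strict _ _ (le ∘ suc) i lt)

length-filter : ∀ {A : Set} {P : Pred A _} (P? : Decidable {ℓ = Agda.Primitive.lzero} P) {k} (h : Fin k → A) →
                length (filter P? (tabulateˡ h)) ≡ count (λ i → does (P? (h i)))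
length-filter P? {zero}  h = refl
length-filter P? {suc k} h with does (P? (h zero))
... | true  = cong suc (length-filter P? (h ∘ suc))
... | false = length-filter P? (h ∘ suc)

sum-suc : ∀ {k} (h : Fin (suc k) → ℕ) → sum (map h (allFin (suc k))) ≡ h zero + sum (map (h ∘ suc) (allFin k))
sum-suc {k} h = cong (λ l → h zero + sum l) (trans (map-tabulate suc h) (sym (map-tabulate id (h ∘ suc))))

sum-zero : ∀ {k} (h : Fin k → ℕ) → (∀ i → h i ≡ 0) → sum (map h (allFin k)) ≡ 0
sum-zero {zero}  h z = refl
sum-zero {suc k} h z = trans (sum-suc h) (cong₂ _+_ (z zero) (sum-zero (h ∘ suc) (z ∘ suc)))

-- Trees, their realisations and the patterns they define

module Trees {d m : ℕ} {ι : Set} (Γ : ι → BinRel d) (I : Instance m ι) where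

  Var : Set
  Var = Fin m

  -- A constraint traversed in either direction. The endpoints are tied to it by equations, so that
  -- edges can be matched at arbitrary indices.
  data Edge (x y : Var) : Set where
    fw : ∀ c → x ≡ cx I c → y ≡ cy I c → Edge x y
    bw : ∀ c → x ≡ cy I c → y ≡ cx I c → Edge x y

  rev : ∀ {x y} → Edge x y → Edge y x
  rev (fw c p q) = bw c q p
  rev (bw c p q) = fw c q p

  ⟪_⟫ : ∀ {x y} → Edge x y → Fin d → Fin d → Set
  ⟪ fw c _ _ ⟫ a b = Γ (crel I c) a b
  ⟪ bw c _ _ ⟫ a b = Γ (crel I c) b a

  ⟪rev⟫ : ∀ {x y} (e : Edge x y) {a b} → ⟪ e ⟫ a b → ⟪ rev e ⟫ b a
  ⟪rev⟫ (fw c _ _) r = r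
  ⟪rev⟫ (bw c _ _) r = r

  ⟪rev⁻⟫ : ∀ {x y} (e : Edge x y) {a b} → ⟪ rev e ⟫ b a → ⟪ e ⟫ a b
  ⟪rev⁻⟫ (fw c _ _) r = r
  ⟪rev⁻⟫ (bw c _ _) r = r

  -- `junc` marks a vertex at which several small trees are glued together.
  data Tree (L J : Var → Set) (x : Var) : Set where
    leaf : L x → Tree L J x
    edge : ∀ {y} → Edge x y → Tree L J y → Tree L J x
    join : Tree L J x → Tree L J x → Tree L J x
    junc : J x → Tree L J x → Tree L J x

  -- Leaves of the small tree at the root, the root itself excluded. A junction ends this small tree
  -- and so counts as one leaf.
  lv : ∀ {L J x} → Tree L J x → ℕ
  lv (leaf _)     = 1
  lv (edge _ t)   = lv t
  lv (join t₁ t₂) = lv t₁ + lv t₂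
  lv (junc _ _)   = 1

  lv≥1 : ∀ {L J x} (t : Tree L J x) → 1 ≤ lv t
  lv≥1 (leaf _)     = s≤s z≤n
  lv≥1 (edge _ t)   = lv≥1 t
  lv≥1 (join t₁ t₂) = ℕ.≤-trans (lv≥1 t₁) (ℕ.m≤m+n _ _)
  lv≥1 (junc _ _)   = s≤s z≤n

  -- A tree with two distinguished leaves x and y: the path between them, with
  -- side trees at its inner vertices.
  data Spine (L J : Var → Set) (x y : Var) : Set where
    last : Edge x y → Spine L J x y
    next : ∀ {z} → Edge x z → Maybe (Tree L J z) → Spine L J z y → Spine L J x y

  olv : ∀ {L J x} → Maybe (Tree L J x) → ℕ
  olv nothing  = 0
  olv (just t) = lv t

  sides : ∀ {L J x y} → Spine L J x y → ℕ
  sides (last _)     = 0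
  sides (next _ o s) = olv o + sides s

  Plain : Var → Set
  Plain = Tree (λ _ → ⊤) (λ _ → ⊥)

  PSpine : Var → Var → Set
  PSpine = Spine (λ _ → ⊤) (λ _ → ⊥)

  -- Trees as graphs: grown by attaching one new leaf (vertex zero) at a time.
  mutual
    data Graph : ℕ → Set where
      pt  : Var → Graph 0
      att : ∀ {k} (g : Graph k) (v : Fin (suc k)) {x y} → glab g v ≡ x → Edge x y → Graph (suc k)

    glab : ∀ {k} → Graph k → Fin (suc k) → Var
    glab (pt x) _                      = x
    glab (att g v {x} {y} _ e) zero    = y
    glab (att g v _ e)         (suc u) = glab g u

  gsrc gtgt : ∀ {k} → Graph k → Fin k → Fin (suc k)
  gsrc (att g v _ (fw _ _ _)) zero    = suc v
  gsrc (att g v _ (bw _ _ _)) zero    = zero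
  gsrc (att g v _ _)          (suc e) = suc (gsrc g e)
  gtgt (att g v _ (fw _ _ _)) zero    = zero
  gtgt (att g v _ (bw _ _ _)) zero    = suc v
  gtgt (att g v _ _)          (suc e) = suc (gtgt g e)

  gcon : ∀ {k} → Graph k → Fin k → Fin (nc I)
  gcon (att g v _ (fw c _ _)) zero    = c
  gcon (att g v _ (bw c _ _)) zero    = c
  gcon (att g v _ _)          (suc e) = gcon g e

  raw : ∀ {k} → Graph k → Fin (suc k) → Fin (suc k) → RawPattern m (nc I)
  raw {k} g b e = record { nv = k ; lab = glab g ; ne = k ; src = gsrc g ; tgt = gtgt g
                         ; con = gcon g ; beg = b ; end = e }

  raw-pattern : ∀ {k} (g : Graph k) b e → IsPattern I (raw g b e)
  raw-pattern (att g v refl (fw c p q)) b e zero = p , q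
  raw-pattern (att g v refl (bw c p q)) b e zero = q , p
  raw-pattern (att g v _ (fw c p q)) b e (suc i) = raw-pattern g v v i
  raw-pattern (att g v _ (bw c p q)) b e (suc i) = raw-pattern g v v i

  module _ {m′ nc′} {p : RawPattern m′ nc′} where
    reach-trans : ∀ {u v w} → Reach p u v → Reach p v w → Reach p u w
    reach-trans here      s = s
    reach-trans (fwd e r) s = fwd e (reach-trans r s)
    reach-trans (bwd e r) s = bwd e (reach-trans r s)

    reach-sym : ∀ {u v} → Reach p u v → Reach p v u
    reach-sym here      = here
    reach-sym (fwd e r) = reach-trans (reach-sym r) (bwd e here)
    reach-sym (bwd e r) = reach-trans (reach-sym r) (fwd e here)

  reach-suc : ∀ {k} (g : Graph k) v {x y} (eq : glab g v ≡ x) (c : Edge x y) {b e b′ e′ u w} →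
              Reach (raw g b e) u w → Reach (raw (att g v eq c) b′ e′) (suc u) (suc w)
  reach-suc g v eq c here = here
  reach-suc g v eq c@(fw _ _ _) (fwd i r) = fwd (suc i) (reach-suc g v eq c r)
  reach-suc g v eq c@(bw _ _ _) (fwd i r) = fwd (suc i) (reach-suc g v eq c r)
  reach-suc g v eq c@(fw _ _ _) (bwd i r) = bwd (suc i) (reach-suc g v eq c r)
  reach-suc g v eq c@(bw _ _ _) (bwd i r) = bwd (suc i) (reach-suc g v eq c r)

  reach-new : ∀ {k} (g : Graph k) v {x y} (eq : glab g v ≡ x) (c : Edge x y) {b e b′ e′ w} →
              Reach (raw g b e) v w → Reach (raw (att g v eq c) b′ e′) zero (suc w)
  reach-new g v eq c@(fw _ _ _) r = bwd zero (reach-suc g v eq c r)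
  reach-new g v eq c@(bw _ _ _) r = fwd zero (reach-suc g v eq c r)

  raw-connected : ∀ {k} (g : Graph k) b e → Connected (raw g b e)
  raw-connected (pt x) b e zero zero = here
  raw-connected (att g v eq c) b e zero    zero    = here
  raw-connected (att g v eq c) b e zero    (suc w) = reach-new g v eq c (raw-connected g v v v w)
  raw-connected (att g v eq c) b e (suc u) zero    = reach-sym (reach-new g v eq c (raw-connected g v v v u))
  raw-connected (att g v eq c) b e (suc u) (suc w) = reach-suc g v eq c (raw-connected g v v u w)

  inc : ∀ {k} → Graph k → Fin (suc k) → Fin k → ℕ
  inc g v e = ind (gsrc g e ≟ v) + ind (gtgt g e ≟ v)

  deg : ∀ {k} → Graph k → Fin (suc k) → ℕ
  deg g v = degree (raw g v v) v

  leaves : ∀ {k} → Graph k → ℕ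
  leaves g = count (λ v → does (deg g v ≤? 1))

  numLeaves≡ : ∀ {k} (g : Graph k) b e → numLeaves (raw g b e) ≡ leaves g
  numLeaves≡ g b e = length-filter (λ v → degree (raw g b e) v ≤? 1) id

  deg-new : ∀ {k} (g : Graph k) v {x y} (eq : glab g v ≡ x) (c : Edge x y) → deg (att g v eq c) zero ≡ 1
  deg-new g v eq c@(fw _ _ _) = trans (sum-suc (inc (att g v eq c) zero)) (cong suc (sum-zero (inc (att g v eq c) zero ∘ suc) λ _ → refl))
  deg-new g v eq c@(bw _ _ _) = trans (sum-suc (inc (att g v eq c) zero)) (cong suc (sum-zero (inc (att g v eq c) zero ∘ suc) λ _ → refl))

  deg-old : ∀ {k} (g : Graph k) v {x y} (eq : glab g v ≡ x) (c : Edge x y) u →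
            deg (att g v eq c) (suc u) ≡ ind (v ≟ u) + deg g u
  deg-old g v eq c@(fw _ _ _) u = trans (sum-suc (inc (att g v eq c) (suc u))) (cong (_+ deg g u) (ℕ.+-identityʳ _))
  deg-old g v eq c@(bw _ _ _) u = sum-suc (inc (att g v eq c) (suc u))

  ind-off : ∀ {k} {v u : Fin k} → v ≢ u → ind (v ≟ u) ≡ 0
  ind-off {v = v} {u} v≢u with v ≟ u
  ... | yes v≡u = ⊥-elim (v≢u v≡u)
  ... | no _    = refl

  ind-on : ∀ {k} (v : Fin k) → ind (v ≟ v) ≡ 1
  ind-on v with v ≟ v
  ... | yes _  = refl
  ... | no v≢v = ⊥-elim (v≢v refl)

  does≤ : ∀ a → does (a ≤? 1) ≡ true → a ≤ 1
  does≤ a eq = ℕ.≤ᵇ⇒≤ a 1 (subst T (sym eq) tt)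

  ≤does : ∀ {a} → a ≤ 1 → does (a ≤? 1) ≡ true
  ≤does p = dec-true (_ ≤? 1) p

  module _ {k} (g : Graph k) v {x y} (eq : glab g v ≡ x) (c : Edge x y) where
    private
      g′ = att g v eq c

      leaves-att≡ : leaves g′ ≡ suc (count (λ u → does (deg g′ (suc u) ≤? 1)))
      leaves-att≡ rewrite deg-new g v eq c = refl

      still : ∀ u → does (deg g′ (suc u) ≤? 1) ≡ true → does (deg g u ≤? 1) ≡ true
      still u p = ≤does (ℕ.≤-trans (ℕ.m≤n+m _ (ind (v ≟ u)))
                        (subst (_≤ 1) (deg-old g v eq c u) (does≤ _ p)))

    leaves-att : leaves g′ ≤ suc (leaves g)
    leaves-att rewrite leaves-att≡ = s≤s (count-mono _ _ still)

    -- The vertex `v` was a leaf and becomes an inner vertex, which makes up for the new leaf.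
    leaves-att₁ : deg g v ≡ 1 → leaves g′ ≤ leaves g
    leaves-att₁ p rewrite leaves-att≡ = count-strict _ _ still v lost (≤does (ℕ.≤-reflexive p))
      where
      lost : does (deg g′ (suc v) ≤? 1) ≡ false
      lost rewrite deg-old g v eq c v | ind-on v | p = refl

  -- Conditions on the values at all vertices, at leaves and at junctions. Different restrictions of
  -- one tree are compared by varying this record.
  record Sem (L J : Var → Set) : Set₁ where
    field
      In : Var → Fin d → Set
      Lf : ∀ {x} → L x → Fin d → Set
      Jn : ∀ {x} → J x → Fin d → Set
  open Sem public

  Rz : ∀ {L J x} → Sem L J → Tree L J x → Fin d → Set
  Rz {x = x} S (leaf l)   a = In S x a × Lf S l a
  Rz {x = x} S (edge e t) a = In S x a × ∃ λ b → ⟪ e ⟫ a b × Rz S t b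
  Rz S (join t₁ t₂) a = Rz S t₁ a × Rz S t₂ a
  Rz S (junc j t)   a = Jn S j a × Rz S t a

  Rz-In : ∀ {L J x} {S : Sem L J} (t : Tree L J x) {a} → Rz S t a → In S x a
  Rz-In (leaf l)     r = proj₁ r
  Rz-In (edge e t)   r = proj₁ r
  Rz-In (join t₁ t₂) r = Rz-In t₁ (proj₁ r)
  Rz-In (junc j t)   r = Rz-In t (proj₂ r)

  OR : ∀ {L J x} → Sem L J → Maybe (Tree L J x) → Fin d → Set
  OR {x = x} S nothing a = In S x a
  OR S (just t)        a = Rz S t a

  -- The vertex condition is imposed at the end but not at the beginning, so consecutive spines
  -- check their common vertex once.
  SR : ∀ {L J x y} → Sem L J → Spine L J x y → Fin d → Fin d → Set
  SR {y = y} S (last e) a b = ⟪ e ⟫ a b × In S y b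
  SR S (next e o s)     a b = ∃ λ c → ⟪ e ⟫ a c × OR S o c × SR S s c b

  -- The summand 2 stands for the two ends of a spine, which `sides` omits; thus every spine is a
  -- tree with at most `n` leaves.
  data Word (n : ℕ) (L J K : Var → Set) : Var → Var → Set where
    []   : ∀ {x} → Word n L J K x x
    cons : ∀ {x y z} (s : Spine L J x y) → 2 + sides s ≤ n → K y → Word n L J K y z → Word n L J K x z

  WR : ∀ {n L J K x y} → Sem L J → (Var → Fin d → Set) → Word n L J K x y → Fin d → Fin d → Set
  WR S Jk []             a b = a ≡ b
  WR S Jk (cons {y = y} s _ _ w) a b = ∃ λ c → SR S s a c × Jk y c × WR S Jk w c b

  plain : (Var → Fin d → Set) → Sem (λ _ → ⊤) (λ _ → ⊥)
  plain In = record { In = In ; Lf = λ _ _ → ⊤ ; Jn = λ () }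

  PWord : ℕ → Var → Var → Set
  PWord n = Word n (λ _ → ⊤) (λ _ → ⊥) (λ _ → ⊤)

  module Realise (Dom : Var → Fin d → Set) where

    PR : ∀ {n x y} → PWord n x y → Fin d → Fin d → Set
    PR = WR (plain Dom) (λ _ _ → ⊤)

    Re : ∀ {k} → Graph k → (Fin (suc k) → Fin d) → Set
    Re (pt x) r = Dom x (r zero)
    Re (att g v {y = y} _ e) r = Re g (r ∘ suc) × ⟪ e ⟫ (r (suc v)) (r zero) × Dom y (r zero)

    Re-In : ∀ {k} (g : Graph k) {r} → Re g r → ∀ u → Dom (glab g u) (r u)
    Re-In (pt x) i zero = i
    Re-In (att g v eq e) (_ , _ , i) zero = i
    Re-In (att g v eq e) (re , _) (suc u) = Re-In g re u

    -- Invariants of grafting `t` onto the vertex `v`. At a vertex of degree one a leaf is saved: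
    -- either `v` becomes an inner vertex, or it serves itself as a leaf of `t`. Degrees elsewhere
    -- are kept, so that a distinguished leaf remains one.
    record Grown {k} (g : Graph k) (v : Fin (suc k)) {x} (t : Plain x) : Set where
      field
        {k′}  : ℕ
        graph : Graph k′
        emb   : Fin (suc k) → Fin (suc k′)
        inj   : ∀ {u w} → emb u ≡ emb w → u ≡ w
        labs  : ∀ u → glab graph (emb u) ≡ glab g u
        degs  : ∀ u → u ≢ v → deg graph (emb u) ≡ deg g u
        few   : leaves graph ≤ leaves g + lv t
        few₁  : deg g v ≡ 1 → suc (leaves graph) ≤ leaves g + lv t
        real  : ∀ {r} → Re graph r → Re g (r ∘ emb) × Rz (plain Dom) t (r (emb v))
    open Grown

    graft : ∀ {k} (g : Graph k) v {x} → glab g v ≡ x → (t : Plain x) → Grown g v t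
    graft g v refl (leaf _) = record
      { graph = g ; emb = id ; inj = id ; labs = λ _ → refl ; degs = λ _ _ → refl
      ; few = ℕ.m≤m+n _ _ ; few₁ = λ _ → ℕ.≤-reflexive (ℕ.+-comm 1 _)
      ; real = λ re → re , Re-In g re v , tt }
    graft g v refl (edge e t) = record
      { graph = graph G ; emb = emb G ∘ suc ; inj = suc-injective ∘ inj G
      ; labs = λ u → labs G (suc u)
      ; degs = λ u u≢v → trans (degs G (suc u) (λ ()))
                 (trans (deg-old g v refl e u) (cong (_+ deg g u) (ind-off (u≢v ∘ sym))))
      ; few = ℕ.≤-pred (ℕ.≤-trans G₁ (ℕ.+-monoˡ-≤ (lv t) (leaves-att g v refl e)))
      ; few₁ = λ p → ℕ.≤-trans G₁ (ℕ.+-monoˡ-≤ (lv t) (leaves-att₁ g v refl e p))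
      ; real = λ re → let ((re′ , ab , _) , rz) = real G re in re′ , Re-In g re′ v , _ , ab , rz }
      where
      G = graft (att g v refl e) zero refl t
      G₁ = few₁ G (deg-new g v refl e)
    graft g v eq (join t₁ t₂) = record
      { graph = graph G₂ ; emb = emb G₂ ∘ emb G₁ ; inj = inj G₁ ∘ inj G₂
      ; labs = λ u → trans (labs G₂ _) (labs G₁ u)
      ; degs = λ u u≢v → trans (degs G₂ _ (u≢v ∘ inj G₁)) (degs G₁ u u≢v)
      ; few = ℕ.≤-trans (few G₂) (ℕ.≤-trans (ℕ.+-monoˡ-≤ (lv t₂) (few G₁))
                (ℕ.≤-reflexive (ℕ.+-assoc (leaves g) (lv t₁) (lv t₂))))
      ; few₁ = λ p → ℕ.≤-trans (s≤s (few G₂)) (ℕ.≤-trans (ℕ.+-monoˡ-≤ (lv t₂) (few₁ G₁ p))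
                (ℕ.≤-reflexive (ℕ.+-assoc (leaves g) (lv t₁) (lv t₂))))
      ; real = λ re → let (re₂ , z₂) = real G₂ re ; (re₁ , z₁) = real G₁ re₂ in re₁ , z₁ , z₂ }
      where
      G₁ = graft g v eq t₁
      G₂ = graft (graph G₁) (emb G₁ v) (trans (labs G₁ v) eq) t₂

    record Laid {k} (g : Graph k) (b v : Fin (suc k)) {x y} (s : PSpine x y) (N : ℕ) : Set where
      field
        {k′}   : ℕ
        graph  : Graph k′
        emb    : Fin (suc k) → Fin (suc k′)
        fin    : Fin (suc k′)
        lab-b  : glab graph (emb b) ≡ glab g b
        lab-e  : glab graph fin ≡ y
        deg-b  : deg graph (emb b) ≤ 1
        deg-e  : deg graph fin ≤ 1
        few    : leaves graph ≤ N + sides s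
        real   : ∀ {r} → Re graph r → Re g (r ∘ emb) × SR (plain Dom) s (r (emb v)) (r fin)
    open Laid

    -- The bounds are assumed after one more edge has been attached at `v`. In this form they hold
    -- both for the initial single vertex, where `v` is also the beginning `b`, and for the end of a
    -- longer path.
    lay : ∀ {k} (g : Graph k) b v {x y} (eq : glab g v ≡ x) (s : PSpine x y) N →
          (∀ {z} (e : Edge x z) → leaves (att g v eq e) ≤ N) →
          (∀ {z} (e : Edge x z) → deg (att g v eq e) (suc b) ≤ 1) → Laid g b v s N
    lay g b v eq (last e) N hN hb = record
      { graph = att g v eq e ; emb = suc ; fin = zero ; lab-b = refl ; lab-e = refl
      ; deg-b = hb e ; deg-e = ℕ.≤-reflexive (deg-new g v eq e)
      ; few = ℕ.≤-trans (hN e) (ℕ.m≤m+n _ _) ; real = λ (re , ab , i) → re , ab , i }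
    lay g b v eq (next e nothing s) N hN hb = record
      { graph = graph R ; emb = emb R ∘ suc ; fin = fin R ; lab-b = lab-b R ; lab-e = lab-e R
      ; deg-b = deg-b R ; deg-e = deg-e R ; few = few R ; real = λ re → let ((re₁ , ab , i) , sr) = real R re in re₁ , _ , ab , i , sr }
      where
      g₁ = att g v eq e
      R = lay g₁ (suc b) zero refl s N
            (λ e′ → ℕ.≤-trans (leaves-att₁ g₁ zero refl e′ (deg-new g v eq e)) (hN e))
            (λ e′ → ℕ.≤-trans (ℕ.≤-reflexive (deg-old g₁ zero refl e′ (suc b))) (hb e))
    lay g b v eq (next e (just t) s) N hN hb = record
      { graph = graph R ; emb = emb R ∘ G.emb ∘ suc ; fin = fin R
      ; lab-b = trans (lab-b R) (G.labs (suc b)) ; lab-e = lab-e R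
      ; deg-b = deg-b R ; deg-e = deg-e R
      ; few = ℕ.≤-trans (few R) (ℕ.≤-reflexive (ℕ.+-assoc N (lv t) (sides s)))
      ; real = λ re → let (re₂ , sr) = real R re ; ((re₁ , ab , _) , rz) = G.real re₂
                      in re₁ , _ , ab , rz , sr }
      where
      g₁ = att g v eq e
      module G = Grown (graft g₁ zero refl t)
      z≢b : G.emb zero ≢ G.emb (suc b)
      z≢b p with () ← G.inj p
      R = lay G.graph (G.emb (suc b)) (G.emb zero) (G.labs zero) s (N + lv t)
            (λ e′ → ℕ.≤-trans (leaves-att G.graph _ _ e′)
                      (ℕ.≤-trans (G.few₁ (deg-new g v eq e)) (ℕ.+-monoˡ-≤ (lv t) (hN e))))
            (λ e′ → ℕ.≤-trans (ℕ.≤-reflexive (trans (deg-old G.graph _ _ e′ (G.emb (suc b)))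
                      (cong₂ _+_ (ind-off z≢b) (G.degs (suc b) (λ ()))))) (hb e))

    spineGraph : ∀ {x y} (s : PSpine x y) → Laid (pt x) zero zero s 2
    spineGraph {x} s = lay (pt x) zero zero refl s 2 (λ e → leaves-att (pt x) zero refl e)
      (λ e → ℕ.≤-reflexive (deg-old (pt x) zero refl e zero))

    spineRaw : ∀ {x y} → PSpine x y → RawPattern m (nc I)
    spineRaw s = let S = spineGraph s in raw (graph S) (emb S zero) (fin S)

    raw-nTree : ∀ n {k} (g : Graph k) b e → deg g b ≤ 1 → deg g e ≤ 1 → leaves g ≤ n → IsNTree I n (raw g b e)
    raw-nTree n g b e db de l =
      raw-pattern g b e , (raw-connected g b e , refl) ,
      subst (_≤ n) (sym (numLeaves≡ g b e)) l , db , de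

    Realises : (p : RawPattern m (nc I)) → (Fin (suc (nv p)) → Fin d) → Set
    Realises p r = IsRealization Γ I p r × (∀ v → Dom (lab p v) (r v))

    raw-Re : ∀ {k} (g : Graph k) b e {r} → Realises (raw g b e) r → Re g r
    raw-Re (pt x) b e (_ , i) = i zero
    raw-Re (att g v eq c@(fw _ _ _)) b e (h , i) = raw-Re g v v (h ∘ suc , i ∘ suc) , h zero , i zero
    raw-Re (att g v eq c@(bw _ _ _)) b e (h , i) = raw-Re g v v (h ∘ suc , i ∘ suc) , h zero , i zero

    Runs : RawPattern m (nc I) → Fin d → Fin d → Set
    Runs p a b = ∃ λ r → Realises p r × r (beg p) ≡ a × r (end p) ≡ b

    module _ (p q : RawPattern m (nc I)) where

      inˡ : Fin (suc (nv p)) → Fin (suc (nv p + nv q))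
      inˡ v = v ↑ˡ nv q

      inʳ : Fin (suc (nv q)) → Fin (suc (nv p + nv q))
      inʳ v with beg q ≟ v
      ... | yes _  = inˡ (end p)
      ... | no b≢v = suc (nv p) ↑ʳ punchOut b≢v

      inʳ-beg : inʳ (beg q) ≡ inˡ (end p)
      inʳ-beg with beg q ≟ beg q
      ... | yes _  = refl
      ... | no b≢b = ⊥-elim (b≢b refl)

      end-⊕ : end (p ⊕ q) ≡ inʳ (end q)
      end-⊕ with beg q ≟ end q
      ... | yes _ = refl
      ... | no _  = refl

      lab-inˡ : ∀ v → lab (p ⊕ q) (inˡ v) ≡ lab p v
      lab-inˡ v rewrite splitAt-↑ˡ (suc (nv p)) v (nv q) = refl

      lab-inʳ : lab p (end p) ≡ lab q (beg q) → ∀ v → lab (p ⊕ q) (inʳ v) ≡ lab q v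
      lab-inʳ match v with beg q ≟ v
      ... | yes refl = trans (lab-inˡ (end p)) match
      ... | no b≢v rewrite splitAt-↑ʳ (suc (nv p)) (nv q) (punchOut b≢v) = cong (lab q) (punchIn-punchOut b≢v)

      src-⊕ʳ : ∀ e → src (p ⊕ q) (ne p ↑ʳ e) ≡ inʳ (src q e)
      src-⊕ʳ e rewrite splitAt-↑ʳ (ne p) (ne q) e with beg q ≟ src q e
      ... | yes _ = refl
      ... | no _  = refl

      tgt-⊕ʳ : ∀ e → tgt (p ⊕ q) (ne p ↑ʳ e) ≡ inʳ (tgt q e)
      tgt-⊕ʳ e rewrite splitAt-↑ʳ (ne p) (ne q) e with beg q ≟ tgt q e
      ... | yes _ = refl
      ... | no _  = refl

      con-⊕ʳ : ∀ e → con (p ⊕ q) (ne p ↑ʳ e) ≡ con q e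
      con-⊕ʳ e rewrite splitAt-↑ʳ (ne p) (ne q) e = refl

      split-⊕ : lab p (end p) ≡ lab q (beg q) → ∀ {a b} → Runs (p ⊕ q) a b → ∃ λ c → Runs p a c × Runs q c b
      split-⊕ match (r , (h , i) , refl , refl) =
          r (inˡ (end p))
        , (r ∘ inˡ , (hˡ , λ v → subst (λ x → Dom x (r (inˡ v))) (lab-inˡ v) (i (inˡ v))) , refl , refl)
        , (r ∘ inʳ , (hʳ , λ v → subst (λ x → Dom x (r (inʳ v))) (lab-inʳ match v) (i (inʳ v)))
          , cong r inʳ-beg , cong r (sym end-⊕))
        where
        hˡ : IsRealization Γ I p (r ∘ inˡ)
        hˡ e with h (e ↑ˡ ne q)
        ... | w rewrite splitAt-↑ˡ (ne p) e (ne q) = w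
        hʳ : IsRealization Γ I q (r ∘ inʳ)
        hʳ e = subst₂ (Γ _) (cong r (src-⊕ʳ e)) (cong r (tgt-⊕ʳ e))
                 (subst (λ c → Γ (crel I c) (r (src (p ⊕ q) (ne p ↑ʳ e))) (r (tgt (p ⊕ q) (ne p ↑ʳ e))))
                        (con-⊕ʳ e) (h (ne p ↑ʳ e)))

    -- A pattern may begin and end at the same leaf: here at the root of `edge e t`.
    stemGraph : ∀ {x y} (e : Edge x y) (t : Plain y) → Grown (att (pt x) zero refl e) zero t
    stemGraph {x} e t = graft (att (pt x) zero refl e) zero refl t

    stemRaw : ∀ {x y} → Edge x y → Plain y → RawPattern m (nc I)
    stemRaw e t = let G = stemGraph e t in raw (Grown.graph G) (Grown.emb G (suc zero)) (Grown.emb G (suc zero))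

    stem-nTree : ∀ n {x y} (e : Edge x y) (t : Plain y) → suc (lv t) ≤ n → IsNTree I n (stemRaw e t)
    stem-nTree n {x} e t l = raw-nTree n (Grown.graph G) b b deg-b′ deg-b′
        (ℕ.≤-trans (ℕ.≤-pred (ℕ.≤-trans (Grown.few₁ G (deg-new (pt x) zero refl e))
                                        (ℕ.+-monoˡ-≤ (lv t) (leaves-att (pt x) zero refl e)))) l)
      where
      G = stemGraph e t
      b = Grown.emb G (suc zero)
      deg-b′ : deg (Grown.graph G) b ≤ 1
      deg-b′ = ℕ.≤-reflexive (trans (Grown.degs G (suc zero) (λ ())) (deg-old (pt x) zero refl e zero))

    stem-lab : ∀ {x y} (e : Edge x y) (t : Plain y) → lab (stemRaw e t) (beg (stemRaw e t)) ≡ x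
    stem-lab e t = Grown.labs (stemGraph e t) (suc zero)

    stemRuns : ∀ {x y} (e : Edge x y) (t : Plain y) {a b} → Runs (stemRaw e t) a b → Rz (plain Dom) (edge e t) a
    stemRuns {x} e t (r , rz , refl , _) =
      let G = stemGraph e t
          b = Grown.emb G (suc zero)
          ((i , ab , _) , z) = Grown.real G (raw-Re (Grown.graph G) b b rz)
      in i , _ , ab , z

    -- `(IPQ)_n` with `p` in both roles yields a run along several copies of `p`; to realise a
    -- single tree at a given root value, the first copy is enough.
    first : ∀ p → lab p (end p) ≡ lab p (beg p) → ∀ j {a b} → Runs (iterPQ j p p) a b → ∃ (Runs p a)
    first p eq zero    run = _ , run
    first p eq (suc j) run =
      let (_ , run₁ , _) = split-⊕ (p ⊕ p) (iterPQ j p p) match run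
          (c , run₂ , _) = split-⊕ p p eq run₁
      in c , run₂
      where
      lab-iter : ∀ j → lab (iterPQ j p p) (beg (iterPQ j p p)) ≡ lab p (beg p)
      lab-iter zero    = refl
      lab-iter (suc j) = trans (lab-inˡ (p ⊕ p) (iterPQ j p p) (beg (p ⊕ p))) (lab-inˡ p p (beg p))
      match : lab (p ⊕ p) (end (p ⊕ p)) ≡ lab (iterPQ j p p) (beg (iterPQ j p p))
      match = trans (trans (cong (lab (p ⊕ p)) (end-⊕ p p)) (trans (lab-inʳ p p eq (end p)) eq)) (sym (lab-iter j))

    module _ {n : ℕ} (2≤n : 2 ≤ n) where

      wordRaw : ∀ {x y} → PWord n x y → RawPattern m (nc I)
      wordRaw {x} []         = raw (pt x) zero zero
      wordRaw (cons s _ _ w) = spineRaw s ⊕ wordRaw w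

      lab-beg : ∀ {x y} (w : PWord n x y) → lab (wordRaw w) (beg (wordRaw w)) ≡ x
      spine-match : ∀ {x y z} (s : PSpine x y) (w : PWord n y z) →
                    lab (spineRaw s) (end (spineRaw s)) ≡ lab (wordRaw w) (beg (wordRaw w))
      spine-match s w = trans (lab-e (spineGraph s)) (sym (lab-beg w))
      lab-beg []               = refl
      lab-beg (cons s _ _ w)   = trans (lab-inˡ (spineRaw s) (wordRaw w) _) (lab-b (spineGraph s))

      lab-end : ∀ {x y} (w : PWord n x y) → lab (wordRaw w) (end (wordRaw w)) ≡ y
      lab-end []             = refl
      lab-end (cons s _ _ w) =
        trans (cong (lab (spineRaw s ⊕ wordRaw w)) (end-⊕ (spineRaw s) (wordRaw w)))
              (trans (lab-inʳ (spineRaw s) (wordRaw w) (spine-match s w) _) (lab-end w))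

      wordPath : ∀ {x y} (w : PWord n x y) → PathOfNTrees I n (wordRaw w)
      -- The empty word becomes the one-vertex tree, whose vertex is its only leaf.
      wordPath {x} [] = single (raw-nTree n (pt x) zero zero z≤n z≤n (ℕ.≤-trans (s≤s z≤n) 2≤n))
      wordPath (cons s l _ w) =
        cons (raw-nTree n (graph S) _ _ (deg-b S) (deg-e S) (ℕ.≤-trans (few S) l)) (wordPath w) (spine-match s w)
        where S = spineGraph s

      wordRuns : ∀ {x y} (w : PWord n x y) {a b} → Runs (wordRaw w) a b → PR w a b
      wordRuns [] (r , _ , p , q) = trans (sym p) q
      wordRuns (cons s l k w) run with split-⊕ (spineRaw s) (wordRaw w) (spine-match s w) run
      ... | c , (r , rz , p , q) , run′ =
        c , subst₂ (SR (plain Dom) s) p q (proj₂ (real (spineGraph s) (raw-Re (graph (spineGraph s)) (emb (spineGraph s) zero) (fin (spineGraph s)) rz))) , tt , wordRuns w run′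

      iterRuns : ∀ {x} (p q : PWord n x x) j {a b} → Runs (iterPQ j (wordRaw p) (wordRaw q)) a b →
                 ((PR p ⨾ PR q) ^^ j ⨾ PR p) a b
      iterRuns p q = go
        where
        P = wordRaw p
        Q = wordRaw q
        lab-beg-⊕ : ∀ R → lab (P ⊕ R) (beg (P ⊕ R)) ≡ lab P (beg P)
        lab-beg-⊕ R = lab-inˡ P R (beg P)
        lab-iter : ∀ j → lab (iterPQ j P Q) (beg (iterPQ j P Q)) ≡ lab P (beg P)
        lab-iter zero    = refl
        lab-iter (suc j) = trans (lab-inˡ (P ⊕ Q) (iterPQ j P Q) (beg (P ⊕ Q))) (lab-beg-⊕ Q)
        match₁ : lab P (end P) ≡ lab Q (beg Q)
        match₁ = trans (lab-end p) (sym (lab-beg q))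
        match₂ : ∀ j → lab (P ⊕ Q) (end (P ⊕ Q)) ≡ lab (iterPQ j P Q) (beg (iterPQ j P Q))
        match₂ j = trans (trans (cong (lab (P ⊕ Q)) (end-⊕ P Q)) (trans (lab-inʳ P Q match₁ _) (lab-end q)))
                         (trans (sym (lab-beg p)) (sym (lab-iter j)))
        go : ∀ j {a b} → Runs (iterPQ j P Q) a b → ((PR p ⨾ PR q) ^^ j ⨾ PR p) a b
        go zero    run = _ , refl , wordRuns p run
        go (suc j) run with split-⊕ (P ⊕ Q) (iterPQ j P Q) (match₂ j) run
        ... | c , run₁ , run₂ with split-⊕ P Q match₁ run₁ | go j run₂
        ...   | c′ , rp , rq | c″ , u , v = c″ , (c , (c′ , wordRuns p rp , wordRuns q rq) , u) , v

-- Reversal, composition and polymorphisms on trees and words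

module TreeLogic {d m : ℕ} {ι : Set} (Γ : ι → BinRel d) (I : Instance m ι) (Ans : Set) where
  open Trees Γ I public
  open Classical Ans public

  module _ {L J : Var → Set} where

    append : ∀ {x z y} → Spine L J x z → Maybe (Tree L J z) → Spine L J z y → Spine L J x y
    append (last e)      o s′ = next e o s′
    append (next e o₁ s) o s′ = next e o₁ (append s o s′)

    revS : ∀ {x y} → Spine L J x y → Spine L J y x
    revS (last e)     = last (rev e)
    revS (next e o s) = append (revS s) o (last (rev e))

    sides-append : ∀ {x z y} (s : Spine L J x z) o (s′ : Spine L J z y) →
                   sides (append s o s′) ≡ sides s + (olv o + sides s′)
    sides-append (last e)      o s′ = refl
    sides-append (next e o₁ s) o s′ =
      trans (cong (olv o₁ +_) (sides-append s o s′)) (sym (ℕ.+-assoc (olv o₁) (sides s) _))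

    sides-rev : ∀ {x y} (s : Spine L J x y) → sides (revS s) ≡ sides s
    sides-rev (last e)     = refl
    sides-rev (next e o s) = trans (sides-append (revS s) o (last (rev e)))
      (trans (cong₂ _+_ (sides-rev s) (ℕ.+-identityʳ (olv o))) (ℕ.+-comm (sides s) (olv o)))

    module _ (S : Sem L J) where

      OR-In : ∀ {x} (o : Maybe (Tree L J x)) {a} → OR S o a → In S x a
      OR-In nothing  r = r
      OR-In (just t) r = Rz-In t r

      SR-In : ∀ {x y} (s : Spine L J x y) {a b} → SR S s a b → In S y b
      SR-In (last e)     (_ , i) = i
      SR-In (next e o s) (_ , _ , _ , r) = SR-In s r

      SR-append⁻ : ∀ {x z y} (s : Spine L J x z) o (s′ : Spine L J z y) {a b} →
                   SR S (append s o s′) a b → ∃ λ c → SR S s a c × OR S o c × SR S s′ c b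
      SR-append⁻ (last e)      o s′ (c , ac , r , u) = c , (ac , OR-In o r) , r , u
      SR-append⁻ (next e o₁ s) o s′ (_ , p , q , v) =
        let (c , v′ , r , u) = SR-append⁻ s o s′ v in c , (_ , p , q , v′) , r , u

      -- The reversed spine checks its own end `x` and not `y`, so the condition at `y` has to be
      -- supplied.
      SR-rev⁻ : ∀ {x y} (s : Spine L J x y) {a b} → In S y b → SR S (revS s) b a → SR S s a b
      SR-rev⁻ (last e)     i (ba , _) = ⟪rev⁻⟫ e ba , i
      SR-rev⁻ (next e o s) i u =
        let (c , v , r , ca , _) = SR-append⁻ (revS s) o (last (rev e)) u
        in c , ⟪rev⁻⟫ e ca , r , SR-rev⁻ s i v

  module _ {n : ℕ} {L J K : Var → Set} where

    infixr 5 _++_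
    _++_ : ∀ {x y z} → Word n L J K x y → Word n L J K y z → Word n L J K x z
    []           ++ w′ = w′
    cons s l k w ++ w′ = cons s l k (w ++ w′)

    pow : ∀ {x} → Word n L J K x x → ℕ → Word n L J K x x
    pow w zero    = []
    pow w (suc j) = w ++ pow w j

    revW : ∀ {x y} → K x → Word n L J K x y → Word n L J K y x
    revW kx []             = []
    revW kx (cons s l k w) = revW k w ++ cons (revS s) (subst (λ j → 2 + j ≤ n) (sym (sides-rev s)) l) kx []

    module _ (S : Sem L J) (Jk : Var → Fin d → Set) where

      WR-++ : ∀ {x y z} (w : Word n L J K x y) (w′ : Word n L J K y z) → WR S Jk w ⨾ WR S Jk w′ ⊑ WR S Jk (w ++ w′)
      WR-++ []             w′ a b (_ , refl , v) = v
      WR-++ (cons s l k w) w′ a b (c , (c′ , p , q , u) , v) = c′ , p , q , WR-++ w w′ c′ b (c , u , v)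

      WR-++⁻ : ∀ {x y z} (w : Word n L J K x y) (w′ : Word n L J K y z) → WR S Jk (w ++ w′) ⊑ WR S Jk w ⨾ WR S Jk w′
      WR-++⁻ []             w′ a b v = a , refl , v
      WR-++⁻ (cons s l k w) w′ a b (c′ , p , q , r) =
        let (c , u , v) = WR-++⁻ w w′ c′ b r in c , (c′ , p , q , u) , v

      WR-pow : ∀ {x} (w : Word n L J K x x) j → WR S Jk w ^^ j ⊑ WR S Jk (pow w j)
      WR-pow w zero    a b e = e
      WR-pow w (suc j) a b (c , u , v) = WR-++ w (pow w j) a b (c , u , WR-pow w j c b v)

      WR-pow⁻ : ∀ {x} (w : Word n L J K x x) j → WR S Jk (pow w j) ⊑ WR S Jk w ^^ j
      WR-pow⁻ w zero    a b e = e
      WR-pow⁻ w (suc j) a b r = let (c , u , v) = WR-++⁻ w (pow w j) a b r in c , u , WR-pow⁻ w j c b v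

      WR-end : ∀ {x y} (w : Word n L J K x y) {a b} → In S x a → Jk x a → WR S Jk w a b → In S y b × Jk y b
      WR-end []             i j refl = i , j
      WR-end (cons s l k w) i j (c , p , q , u) = WR-end w (SR-In S s p) q u

      WR-rev⁻ : ∀ {x y} (kx : K x) (w : Word n L J K x y) {a b} → In S y b → Jk y b →
                WR S Jk (revW kx w) b a → WR S Jk w a b
      WR-rev⁻ kx []             i j refl = refl
      WR-rev⁻ kx (cons s l k w) i j r =
        let (c , u , _ , p , _ , eq) = WR-++⁻ (revW k w) _ _ _ r
            (i′ , j′) = WR-end (revW k w) i j u
        in c , SR-rev⁻ S s i′ (subst (SR S (revS s) c) eq p) , j′ , WR-rev⁻ k w i j u

  module _ {L J : Var → Set} {S S′ : Sem L J} (fIn : ∀ {x a} → In S x a → In S′ x a)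
           (fLf : ∀ {x} (l : L x) {a} → Lf S l a → Lf S′ l a) (fJn : ∀ {x} (j : J x) {a} → Jn S j a → Jn S′ j a) where

    Rz-map : ∀ {x} (t : Tree L J x) {a} → Rz S t a → Rz S′ t a
    Rz-map (leaf l)     (i , r) = fIn i , fLf l r
    Rz-map (edge e t)   (i , b , ab , r) = fIn i , b , ab , Rz-map t r
    Rz-map (join t₁ t₂) (r₁ , r₂) = Rz-map t₁ r₁ , Rz-map t₂ r₂
    Rz-map (junc j t)   (i , r) = fJn j i , Rz-map t r

    OR-map : ∀ {x} (o : Maybe (Tree L J x)) {a} → OR S o a → OR S′ o a
    OR-map nothing  r = fIn r
    OR-map (just t) r = Rz-map t r

    SR-map : ∀ {x y} (s : Spine L J x y) {a b} → SR S s a b → SR S′ s a b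
    SR-map (last e)     (ab , i) = ab , fIn i
    SR-map (next e o s) (c , ac , r , u) = c , ac , OR-map o r , SR-map s u

    WR-map : ∀ {n K} {Jk Jk′ : Var → Fin d → Set} → (∀ {x a} → Jk x a → Jk′ x a) →
             ∀ {x y} (w : Word n L J K x y) {a b} → WR S Jk w a b → WR S′ Jk′ w a b
    WR-map fJk []             e = e
    WR-map fJk (cons s _ _ w) (c , p , q , u) = c , SR-map s p , fJk q , WR-map fJk w u

  module _ {N : ℕ} (op : (Fin N → Fin d) → Fin d)
           (pres : ∀ c a b → (∀ k → Γ (crel I c) (a k) (b k)) → Γ (crel I c) (op a) (op b)) where

    ⟪⟫-op : ∀ {x y} (e : Edge x y) {a b} → (∀ k → ⟪ e ⟫ (a k) (b k)) → ⟪ e ⟫ (op a) (op b)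
    ⟪⟫-op (fw c _ _) h = pres c _ _ h
    ⟪⟫-op (bw c _ _) h = pres c _ _ h

    module _ {L J : Var → Set} where

      -- Each argument of the operation may obey its own restrictions `Ss k`. This covers
      -- absorption, where one argument is unrestricted, as well as arguments that each ignore a
      -- different leaf.
      record Closed (Ss : Fin N → Sem L J) (S : Sem L J) : Set where
        field
          In-c : ∀ x a → (∀ k → In (Ss k) x (a k)) → ◇ (In S x (op a))
          Lf-c : ∀ {x} (l : L x) a → (∀ k → In (Ss k) x (a k)) → (∀ k → Lf (Ss k) l (a k)) → ◇ (Lf S l (op a))
          Jn-c : ∀ {x} (j : J x) a → (∀ k → In (Ss k) x (a k)) → (∀ k → Jn (Ss k) j (a k)) → ◇ (Jn S j (op a))
      open Closed

      module _ {Ss : Fin N → Sem L J} {S : Sem L J} (cl : Closed Ss S) where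

        Rz-op : ∀ {x} (t : Tree L J x) a → (∀ k → Rz (Ss k) t (a k)) → ◇ (Rz S t (op a))
        Rz-op (leaf l) a h = do
          i ← In-c cl _ a (proj₁ ∘ h)
          l′ ← Lf-c cl l a (proj₁ ∘ h) (proj₂ ∘ h)
          return (i , l′)
        Rz-op (edge e t) a h = do
          i ← In-c cl _ a (proj₁ ∘ h)
          r ← Rz-op t (λ k → proj₁ (proj₂ (h k))) (λ k → proj₂ (proj₂ (proj₂ (h k))))
          return (i , _ , ⟪⟫-op e (λ k → proj₁ (proj₂ (proj₂ (h k)))) , r)
        Rz-op (join t₁ t₂) a h = do
          r₁ ← Rz-op t₁ a (proj₁ ∘ h)
          r₂ ← Rz-op t₂ a (proj₂ ∘ h)
          return (r₁ , r₂)
        Rz-op (junc j t) a h = do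
          i ← Jn-c cl j a (λ k → Rz-In t (proj₂ (h k))) (proj₁ ∘ h)
          r ← Rz-op t a (proj₂ ∘ h)
          return (i , r)

        OR-op : ∀ {x} (o : Maybe (Tree L J x)) a → (∀ k → OR (Ss k) o (a k)) → ◇ (OR S o (op a))
        OR-op nothing  a h = In-c cl _ a h
        OR-op (just t) a h = Rz-op t a h

        SR-op : ∀ {x y} (s : Spine L J x y) a b → (∀ k → SR (Ss k) s (a k) (b k)) → ◇ (SR S s (op a) (op b))
        SR-op (last e) a b h = do
          i ← In-c cl _ b (proj₂ ∘ h)
          return (⟪⟫-op e (proj₁ ∘ h) , i)
        SR-op (next e o s) a b h = do
          r ← OR-op o _ (λ k → proj₁ (proj₂ (proj₂ (h k))))
          u ← SR-op s _ b (λ k → proj₂ (proj₂ (proj₂ (h k))))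
          return (_ , ⟪⟫-op e (λ k → proj₁ (proj₂ (h k))) , r , u)

        module _ (ext : ∀ a b → (∀ k → a k ≡ b k) → op a ≡ op b) {n : ℕ} {K : Var → Set}
                 {Jks : Fin N → Var → Fin d → Set} {Jk : Var → Fin d → Set}
                 (Jk-c : ∀ {x} → K x → ∀ a → (∀ i → In (Ss i) x (a i)) → (∀ i → Jks i x (a i)) → ◇ (Jk x (op a))) where

          WR-op : ∀ {x y} (w : Word n L J K x y) a b → (∀ k → WR (Ss k) (Jks k) w (a k) (b k)) →
                  ◇ (WR S Jk w (op a) (op b))
          WR-op []             a b h = return (ext a b h)
          WR-op (cons s _ k w) a b h = do
            r ← SR-op s a _ (λ i → proj₁ (proj₂ (h i)))
            j ← Jk-c k _ (λ i → SR-In (Ss i) s (proj₁ (proj₂ (h i)))) (λ i → proj₁ (proj₂ (proj₂ (h i))))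
            u ← WR-op w _ b (λ i → proj₂ (proj₂ (proj₂ (h i))))
            return (_ , r , j , u)

  -- The subalgebra generated by `D₀`. Induction on this type carries properties of the generators
  -- over to generated elements.
  data Sg {n : ℕ} (f : (Fin (suc n) → Fin d) → Fin d) (D₀ : Fin d → Set) : Fin d → Set where
    gen : ∀ {a} → D₀ a → Sg f D₀ a
    app : ∀ a → (∀ k → Sg f D₀ (a k)) → Sg f D₀ (f a)

  Sg-mono : ∀ {n f} {D₀ D₁ : Fin d → Set} → (∀ {a} → D₀ a → D₁ a) → ∀ {a} → Sg {n} f D₀ a → Sg f D₁ a
  Sg-mono h (gen x)    = gen (h x)
  Sg-mono h (app a xs) = app a (λ k → Sg-mono h (xs k))

  -- Together with its root, `edge e t` has `suc (lv t)` leaves. `Extending` and `Returning` are the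
  -- two consequences of `(IPQ)_n` on which each level rests.
  Extending : ℕ → (Dl Du : Var → Fin d → Set) → Set
  Extending n Dl Du = ∀ {x y a} (e : Edge x y) (t : Plain y) → suc (lv t) ≤ n → Dl x a → ◇ (Rz (plain Du) (edge e t) a)

  Returning : ℕ → (Dl Du : Var → Fin d → Set) → Set
  Returning n Dl Du = ∀ {x a} → Dl x a → ∀ (p q : PWord n x x) →
    ◇ (∃ λ j → ((Realise.PR Du p ⨾ Realise.PR Du q) ^^ j ⨾ Realise.PR Du p) a a)

  Alt : Rel₂ d → Rel₂ d → Rel₂ d → Set
  Alt P Q A = ∃ λ j → A ⊑ (P ⨾ Q) ^^ j ⨾ P

  -- Substituting alternating words for the letters of an alternating word gives an alternating
  -- word: `A` followed by `B` contributes `i + suc k` rounds of `P ⨾ Q`, and `A` and `B` begin and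
  -- end with the right letters.
  alt-iter : ∀ {P Q A B} → Alt P Q A → Alt Q P B → ∀ j → Alt P Q ((A ⨾ B) ^^ j ⨾ A)
  alt-iter α β zero = proj₁ α , λ { a b (_ , refl , u) → proj₂ α a b u }
  alt-iter {P} {Q} {A} {B} (i , α) (k , β) (suc j) =
    let (l , γ) = alt-iter (i , α) (k , β) j in
    i + suc (k + l) , λ { a b (z , (y , (x , u , v) , w) , u′) →
      let (p , s , t) = α a x u
          (q , s′ , t′) = β x y v
          (r , s″ , t″) = γ y b (z , w , u′)
      in r , ^^-+ {P = P ⨾ Q} i {suc (k + l)} s
               (^^-+ {P = P ⨾ Q} (suc k) {l} (close {P = P} {Q = Q} k (x , t , s′) t′) s″) , t″ }

  module Iterate {n : ℕ} (f : (Fin (suc n) → Fin d) → Fin d)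
           (ext : ∀ a b → (∀ k → a k ≡ b k) → f a ≡ f b)
           (pres : ∀ c a b → (∀ k → Γ (crel I c) (a k) (b k)) → Γ (crel I c) (f a) (f b))
           (D₀ D₁ : Var → Fin d → Set)
           (base : ∀ {x a} → D₀ x a → ∀ (p q : PWord n x x) →
                   ∃ λ j → ((Realise.PR D₁ p ⨾ Realise.PR D₁ q) ^^ j ⨾ Realise.PR D₁ p) a a) where

    Dom : Var → Fin d → Set
    Dom x = Sg f (D₁ x)

    open Realise Dom using (PR)

    Returns : Var → Fin d → Set
    Returns x a = ∀ (p q : PWord n x x) → ◇ (∃ λ j → ((PR p ⨾ PR q) ^^ j ⨾ PR p) a a)

    gen-PR : ∀ {x y} (p : PWord n x y) → Realise.PR D₁ p ⊑ PR p
    gen-PR p a b = WR-map gen (λ _ _ → tt) (λ ()) (λ _ → tt) p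

    f-PR : ∀ {x y} (p : PWord n x y) a b → (∀ k → PR p (a k) (b k)) → ◇ (PR p (f a) (f b))
    f-PR p = WR-op f pres
      (record { In-c = λ _ a h → return (app a h) ; Lf-c = λ _ _ _ _ → return tt ; Jn-c = λ () })
      ext (λ _ _ _ _ → return tt) p

    iterate : ∀ {x} → PWord n x x → PWord n x x → ℕ → PWord n x x
    iterate p q j = pow (p ++ q) j ++ p

    iterate⁺ : ∀ {x} (p q : PWord n x x) j → (PR p ⨾ PR q) ^^ j ⨾ PR p ⊑ PR (iterate p q j)
    iterate⁺ p q j a b (c , u , v) = WR-++ _ _ (pow (p ++ q) j) p a b
      (c , WR-pow _ _ (p ++ q) j a c (^^-mono j (WR-++ _ _ p q) a c u) , v)

    iterate⁻ : ∀ {x} (p q : PWord n x x) j → PR (iterate p q j) ⊑ (PR p ⨾ PR q) ^^ j ⨾ PR p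
    iterate⁻ p q j a b r = let (c , u , v) = WR-++⁻ _ _ (pow (p ++ q) j) p a b r in
      c , ^^-mono j (WR-++⁻ _ _ p q) a c (WR-pow⁻ _ _ (p ++ q) j a c u) , v

    loop-iterate : ∀ {x} (p q : PWord n x x) j {a} → PR p a a → PR q a a → PR (iterate p q j) a a
    loop-iterate p q j {a} u v = iterate⁺ p q j a a (a , loops j , u)
      where
      loops : ∀ j → ((PR p ⨾ PR q) ^^ j) a a
      loops zero    = refl
      loops (suc j) = a , (a , u , v) , loops j

    alt-iterate : ∀ {x} {P Q} (p q : PWord n x x) j → Alt P Q (PR p) → Alt Q P (PR q) → Alt P Q (PR (iterate p q j))
    alt-iterate p q j α β = let (i , γ) = alt-iter α β j in i , λ a b r → γ a b (iterate⁻ p q j a b r)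

    -- Elements that return along p′ and q′ return along all alternating words in p′ and q′,
    -- so the two words can be iterated to accommodate one more element at a time.
    simultaneous : ∀ {x} N (c : Fin N → Fin d) → (∀ k → Returns x (c k)) → ∀ (p q : PWord n x x) →
      ◇ (∃ λ (p′ : PWord n x x) → ∃ λ (q′ : PWord n x x) → Alt (PR p) (PR q) (PR p′) × Alt (PR q) (PR p) (PR q′) ×
         (∀ k → PR p′ (c k) (c k) × PR q′ (c k) (c k)))
    simultaneous zero c h p q = return (p , q , (0 , λ a b r → a , refl , r) , (0 , λ a b r → a , refl , r) , λ ())
    simultaneous (suc N) c h p q = do
      (p₁ , q₁ , α , β , loops) ← simultaneous N (c ∘ suc) (h ∘ suc) p q
      (j , r) ← h zero p₁ q₁
      let p₂ = iterate p₁ q₁ j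
      (i , s) ← h zero q₁ p₂
      let α₂ = alt-iterate p₁ q₁ j α β
      return (p₂ , iterate q₁ p₂ i , α₂ , alt-iterate q₁ p₂ i β α₂ ,
        λ { zero → iterate⁺ p₁ q₁ j _ _ r , iterate⁺ q₁ p₂ i _ _ s
          ; (suc k) → let l = loop-iterate p₁ q₁ j (proj₁ (loops k)) (proj₂ (loops k)) in
                      l , loop-iterate q₁ p₂ i (proj₂ (loops k)) l })

    -- Induction on generation. All arguments of `f` return along one common word `p′` alternating
    -- in `p` and `q`; applying `f` to these closed walks closes the walk at the generated element.
    returns : Returning n (λ x → Sg f (D₀ x)) Dom
    returns {a = a} (gen h) p q =
      let (j , r) = base h p q in
      return (j , ⨾-mono (^^-mono j (⨾-mono (gen-PR p) (gen-PR q))) (gen-PR p) a a r)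
    returns (app a hs) p q = do
      (p′ , q′ , (j , α) , _ , loops) ← simultaneous _ a (λ k → returns (hs k)) p q
      r ← f-PR p′ a a (λ k → proj₁ (loops k))
      return (j , α _ _ r)

-- Arithmetic identities and lists of tags

arith₁ : ∀ a b c → a + b + c + 1 ≡ suc (c + (a + b))
arith₁ = solve-∀

arith₂ : ∀ a → suc a ≡ a + 0 + 0 + 1
arith₂ = solve-∀

arith₃ : ∀ a b c → a + b + c + 1 ≡ a + 0 + (b + c) + 1
arith₃ = solve-∀

arith₄ : ∀ c → 2 + c ≡ 1 + 0 + c + 1
arith₄ = solve-∀

arith₅ : ∀ a b c → b + (a + c) ≡ a + b + c
arith₅ = solve-∀

mem : List ℕ → ℕ → Bool
mem js τ = does (τ ∈? js)

cnt : (ℕ → Bool) → ℕ → ℕ → ℕ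
cnt K o zero    = 0
cnt K o (suc k) = (if K o then 1 else 0) + cnt K (suc o) k

cnt-+ : ∀ K o k l → cnt K o (k + l) ≡ cnt K o k + cnt K (o + k) l
cnt-+ K o zero    l = cong (λ j → cnt K j l) (sym (ℕ.+-identityʳ o))
cnt-+ K o (suc k) l = trans (cong (δ +_) (trans (cnt-+ K (suc o) k l) (cong (λ j → cnt K (suc o) k + cnt K j l) (sym (ℕ.+-suc o k)))))
                            (sym (ℕ.+-assoc δ (cnt K (suc o) k) _))
  where δ = if K o then 1 else 0

mem-skip : ∀ j js {τ} → τ ≢ j → mem (j ∷ js) τ ≡ mem js τ
mem-skip j js {τ} τ≢j = go (τ ∈? js)
  where
  go : Dec (τ ∈ˡ js) → mem (j ∷ js) τ ≡ mem js τ
  go (yes p) = trans (dec-true (τ ∈? (j ∷ js)) (there p)) (sym (dec-true (τ ∈? js) p))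
  go (no ¬p) = trans (dec-false (τ ∈? (j ∷ js)) λ { (here eq) → τ≢j eq ; (there p) → ¬p p })
                     (sym (dec-false (τ ∈? js) ¬p))

cnt-past : ∀ j js o k → j < o → cnt (mem (j ∷ js)) o k ≡ cnt (mem js) o k
cnt-past j js o zero    j<o = refl
cnt-past j js o (suc k) j<o rewrite mem-skip j js (λ eq → ℕ.<⇒≢ j<o (sym eq)) =
  cong ((if mem js o then 1 else 0) +_) (cnt-past j js (suc o) k (ℕ.m<n⇒m<1+n j<o))

-- The tag `j` occurs at most once in the interval, so one more list entry adds at most one; a
-- repeated entry adds nothing.
cnt-step : ∀ j js o k → cnt (mem (j ∷ js)) o k ≤ suc (cnt (mem js) o k)
cnt-step j js o zero = z≤n
cnt-step j js o (suc k) with o ℕ.≟ j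
... | yes refl rewrite dec-true (o ∈? (o ∷ js)) (here refl) | cnt-past o js (suc o) k ℕ.≤-refl =
      s≤s (ℕ.m≤n+m _ (if mem js o then 1 else 0))
... | no o≢j rewrite mem-skip j js o≢j =
      ℕ.≤-trans (ℕ.+-monoʳ-≤ (if mem js o then 1 else 0) (cnt-step j js (suc o) k)) (ℕ.≤-reflexive (ℕ.+-suc _ _))

cnt≤length : ∀ js o k → cnt (mem js) o k ≤ length js
cnt≤length [] o zero = z≤n
cnt≤length [] o (suc k) = cnt≤length [] (suc o) k
cnt≤length (j ∷ js) o k = ℕ.≤-trans (cnt-step j js o k) (s≤s (cnt≤length js o k))

∈-removeAt : ∀ {τ : ℕ} (js : List ℕ) (p : τ ∈ˡ js) i → index p ≢ i → τ ∈ˡ removeAt js i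
∈-removeAt (j ∷ js) (here px)  zero    ne = ⊥-elim (ne refl)
∈-removeAt (j ∷ js) (there p)  zero    ne = p
∈-removeAt (j ∷ js) (here px)  (suc i) ne = here px
∈-removeAt (j ∷ js) (there p)  (suc i) ne = there (∈-removeAt js p i (ne ∘ cong suc))

mem-true : ∀ {js : List ℕ} {τ} → τ ∈ˡ js → mem js τ ≡ true
mem-true {js} {τ} p = dec-true (τ ∈? js) p

mem-∈ : ∀ {js : List ℕ} {τ} → mem js τ ≡ true → τ ∈ˡ js
mem-∈ {js} {τ} eq with τ ∈? js
... | yes p = p

-- One level of the induction

-- `P` consists of the variables assigned earlier, with values `s`, and `V` of those assigned at
-- this level. Trees are realised from values in `Dl` with values in `Du`; at `V` the two agree.
module Level {d m n : ℕ} {ι : Set} (Γ : ι → BinRel d) (I : Instance m ι) (Ans : Set)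
  (f : (Fin (suc n) → Fin d) → Fin d)
  (ext : ∀ a b → (∀ k → a k ≡ b k) → f a ≡ f b)
  (nu : ∀ a i x → (∀ k → k ≢ i → a k ≡ x) → f a ≡ x)
  (pres : ∀ c a b → (∀ k → Γ (crel I c) (a k) (b k)) → Γ (crel I c) (f a) (f b))
  (P V : Fin m → Set) (Dl Du : Fin m → Fin d → Set)
  (Dl⊆Du : ∀ {x a} → Dl x a → Du x a)
  (Du⊆Dl : ∀ {x a} → V x → Du x a → Dl x a)
  (Du-f : ∀ {x} a → (∀ k → Du x (a k)) → Du x (f a))
  (extends : TreeLogic.Extending Γ I Ans n Dl Du) (returns : TreeLogic.Returning Γ I Ans n Dl Du)
  (s : Fin m → Fin d) where

  open TreeLogic Γ I Ans
  open Absorption f ext nu Ans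

  -- Leaves carry a tag, which selects the leaves subject to an extra demand.
  L : Var → Set
  L x = (P x ⊎ V x) × ℕ

  CT : Var → Set
  CT = Tree L V

  -- A tree glued from small trees, each with at most n leaves; for okJ the root is a junction.
  mutual
    ok : ∀ {x} → CT x → Set
    ok (leaf _)     = ⊤
    ok (edge _ t)   = ok t
    ok (join t₁ t₂) = ok t₁ × ok t₂
    ok (junc _ t)   = okJ t

    okJ : ∀ {x} → CT x → Set
    okJ (leaf _)     = ⊤
    okJ (edge _ t)   = ok t × suc (lv t) ≤ n
    okJ (join t₁ t₂) = okJ t₁ × okJ t₂
    okJ (junc _ t)   = okJ t

  ok⇒okJ : ∀ {x} (t : CT x) → ok t → suc (lv t) ≤ n → okJ t
  ok⇒okJ (leaf _)     o l = tt
  ok⇒okJ (edge _ t)   o l = o , l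
  ok⇒okJ (join t₁ t₂) (o₁ , o₂) l =
    ok⇒okJ t₁ o₁ (ℕ.≤-trans (s≤s (ℕ.m≤m+n _ _)) l) , ok⇒okJ t₂ o₂ (ℕ.≤-trans (s≤s (ℕ.m≤n+m _ _)) l)
  ok⇒okJ (junc _ t)   o l = o

  cut : ∀ {x} → CT x → Plain x
  cut (leaf _)     = leaf tt
  cut (edge e t)   = edge e (cut t)
  cut (join t₁ t₂) = join (cut t₁) (cut t₂)
  cut (junc _ _)   = leaf tt

  lv-cut : ∀ {x} (t : CT x) → lv (cut t) ≡ lv t
  lv-cut (leaf _)     = refl
  lv-cut (edge _ t)   = lv-cut t
  lv-cut (join t₁ t₂) = cong₂ _+_ (lv-cut t₁) (lv-cut t₂)
  lv-cut (junc _ _)   = refl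

  record Free (S : Sem L V) : Set where
    field
      In-f : ∀ {x a} → Du x a → In S x a
      Lf-f : ∀ {x} (l : L x) a → Lf S l a
      Jn-f : ∀ {x} (j : V x) a → Jn S j a
  open Free

  module _ {S : Sem L V} (φ : Free S) where
    -- The small tree at the root is realised by `extends`. A value found at a junction lies in
    -- `Du`, hence in `Dl` because junctions sit at `V`, and the small trees beyond can be realised
    -- from there.
    extend : ∀ {x} (t : CT x) → okJ t → ∀ {a} → Dl x a → ◇ (Rz S t a)
    fill : ∀ {x} (t : CT x) → ok t → ∀ {a} → Rz (plain Du) (cut t) a → ◇ (Rz S t a)
    extend (leaf l) o i = return (In-f φ (Dl⊆Du i) , Lf-f φ l _)
    extend (edge e t) (o , l) i = do
      (_ , b , ab , r) ← extends e (cut t) (subst (λ j → suc j ≤ n) (sym (lv-cut t)) l) i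
      r′ ← fill t o r
      return (In-f φ (Dl⊆Du i) , b , ab , r′)
    extend (join t₁ t₂) (o₁ , o₂) i = do
      r₁ ← extend t₁ o₁ i
      r₂ ← extend t₂ o₂ i
      return (r₁ , r₂)
    extend (junc v t) o i = do
      r ← extend t o i
      return (Jn-f φ v _ , r)
    fill (leaf l) o (i , _) = return (In-f φ i , Lf-f φ l _)
    fill (edge e t) o (i , b , ab , r) = do
      r′ ← fill t o r
      return (In-f φ i , b , ab , r′)
    fill (join t₁ t₂) (o₁ , o₂) (r₁ , r₂) = do
      r₁′ ← fill t₁ o₁ r₁
      r₂′ ← fill t₂ o₂ r₂
      return (r₁′ , r₂′)
    fill (junc v t) o (i , _) = do
      r ← extend t o (Du⊆Dl v i)
      return (Jn-f φ v _ , r)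

  Domains : Set
  Domains = Var → Fin d → Bool

  -- σ = false: every leaf in its prescribed set; σ = true: no restriction.
  base : Domains → Bool → Sem L V
  base A σ = record
    { In = Du
    ; Lf = λ { {x} (inj₁ _ , _) a → σ ≡ false → a ≡ s x ; {x} (inj₂ _ , _) a → σ ≡ false → A x a ≡ true }
    ; Jn = λ {x} _ a → σ ≡ false → A x a ≡ true }

  Absorbing : (x : Var) → (Fin d → Bool) → Set
  Absorbing x C = ∀ i a → (∀ k → side i k ≡ false → C (a k) ≡ true) → (∀ k → Du x (a k)) → ◇ (C (f a) ≡ true)

  -- Arc-consistent domains that absorb the full ones
  record AAS (A : Domains) : Set where
    field
      nonempty  : ∀ {x} → V x → ◇ (∃ λ a → A x a ≡ true)
      inside    : ∀ {x a} → V x → A x a ≡ true → ◇ (Du x a)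
      absorbing : ∀ {x} → V x → Absorbing x (A x)
      arc       : ∀ {x} → V x → ∀ (t : CT x) → okJ t → ∀ {a} → A x a ≡ true → ◇ (Rz (base A false) t a)

  -- Near-unanimity says precisely that singletons absorb.
  s-absorbing : ∀ {x} i a → (∀ k → side i k ≡ false → a k ≡ s x) → f a ≡ s x
  s-absorbing i a h = nu a i _ λ k k≢i → h k (side-off k≢i)

  -- The largest arc-consistent domains in which all trees are realisable.  For every x a
  -- single tree `best` refutes all values outside; plugging it in at the junctions and
  -- leaves of t keeps those inside.
  module Closure (𝒮 : Bool → Sem L V) (τ : ℕ) (free : Free (𝒮 true))
    (closed : ∀ i → Closed f pres (λ k → 𝒮 (side i k)) (𝒮 false))
    (In-Du : ∀ {x a} → In (𝒮 false) x a → Du x a)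
    (fixed : ∀ {x} (p : P x) {a} → Lf (𝒮 false) (inj₁ p , τ) a → a ≡ s x)
    (real : ∀ {x} → V x → ∀ (t : CT x) → okJ t → ◇ (∃ λ a → Rz (𝒮 false) t a)) where

    Refuted : Var → Fin d → Set
    Refuted x a = Σ (V x) λ _ → Σ (CT x) λ t → okJ t × (Rz (𝒮 false) t a → Ans)

    module _ (dec : ∀ x a → Refuted x a ⊎ (Refuted x a → Ans)) where

      A : Domains
      A x a = [ (λ _ → false) , (λ _ → true) ] (dec x a)

      A-true : ∀ {x a} → V x → ∀ t → okJ t → A x a ≡ true → ◇ (Rz (𝒮 false) t a)
      A-true {x} {a} v t o eq with dec x a
      A-true v t o eq | inj₂ nr = λ k → nr (v , t , o , k)

      test : ∀ {x a} → V x → Refuted x a ⊎ (Refuted x a → Ans) → CT x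
      test v (inj₁ (_ , t , _)) = t
      test v (inj₂ _)           = leaf (inj₂ v , 0)

      tests : ∀ {x} → V x → ∀ {N} → (Fin N → Fin d) → CT x
      tests v {zero}  g = leaf (inj₂ v , 0)
      tests {x} v {suc N} g = join (test v (dec x (g zero))) (tests v (g ∘ suc))

      tests-ok : ∀ {x} (v : V x) {N} (g : Fin N → Fin d) → okJ (tests v g)
      tests-ok v {zero}  g = tt
      tests-ok {x} v {suc N} g with dec x (g zero)
      ... | inj₁ (_ , _ , o , _) = o , tests-ok v (g ∘ suc)
      ... | inj₂ _               = tt , tests-ok v (g ∘ suc)

      tests-out : ∀ {x} (v : V x) {N} (g : Fin N → Fin d) {b} → Rz (𝒮 false) (tests v g) b →
                  ∀ i → Rz (𝒮 false) (test v (dec x (g i))) b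
      tests-out v g r zero    = proj₁ r
      tests-out v g r (suc i) = tests-out v (g ∘ suc) (proj₂ r) i

      best : ∀ {x} → V x → CT x
      best v = tests v id

      best-A : ∀ {x} (v : V x) {b} → Rz (𝒮 false) (best v) b → ◇ (A x b ≡ true)
      best-A {x} v {b} r with dec x b | tests-out v id r b
      ... | inj₁ (_ , _ , _ , nr) | r′ = exfalso (nr r′)
      ... | inj₂ _ | _ = return refl

      plug : ∀ {x} → CT x → CT x
      -- Leaves at assigned variables receive the tag `τ`, at which `fixed` enforces the assigned
      -- value.
      plug (leaf (inj₁ p , _)) = leaf (inj₁ p , τ)
      plug (leaf (inj₂ v , _)) = junc v (best v)
      plug (edge e t)   = edge e (plug t)
      plug (join t₁ t₂) = join (plug t₁) (plug t₂)
      plug (junc v t)   = junc v (join (plug t) (best v))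

      lv-plug : ∀ {x} (t : CT x) → lv (plug t) ≡ lv t
      lv-plug (leaf (inj₁ _ , _)) = refl
      lv-plug (leaf (inj₂ _ , _)) = refl
      lv-plug (edge e t)   = lv-plug t
      lv-plug (join t₁ t₂) = cong₂ _+_ (lv-plug t₁) (lv-plug t₂)
      lv-plug (junc v t)   = refl

      ok-plug : ∀ {x} (t : CT x) → ok t → ok (plug t)
      okJ-plug : ∀ {x} (t : CT x) → okJ t → okJ (plug t)
      ok-plug (leaf (inj₁ _ , _)) o = tt
      ok-plug (leaf (inj₂ v , _)) o = tests-ok v id
      ok-plug (edge e t)   o = ok-plug t o
      ok-plug (join t₁ t₂) (o₁ , o₂) = ok-plug t₁ o₁ , ok-plug t₂ o₂
      ok-plug (junc v t)   o = okJ-plug t o , tests-ok v id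
      okJ-plug (leaf (inj₁ _ , _)) o = tt
      okJ-plug (leaf (inj₂ v , _)) o = tests-ok v id
      okJ-plug (edge e t)   (o , l) = ok-plug t o , subst (λ j → suc j ≤ n) (sym (lv-plug t)) l
      okJ-plug (join t₁ t₂) (o₁ , o₂) = okJ-plug t₁ o₁ , okJ-plug t₂ o₂
      okJ-plug (junc v t)   o = okJ-plug t o , tests-ok v id

      unplug : ∀ {x} (t : CT x) {a} → Rz (𝒮 false) (plug t) a → ◇ (Rz (base A false) t a)
      unplug (leaf (inj₁ p , _)) (i , l) = return (In-Du i , λ _ → fixed p l)
      unplug (leaf (inj₂ v , _)) (_ , r) = do
        b ← best-A v r
        return (In-Du (Rz-In (best v) r) , λ _ → b)
      unplug (edge e t) (i , b , ab , r) = do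
        r′ ← unplug t r
        return (In-Du i , b , ab , r′)
      unplug (join t₁ t₂) (r₁ , r₂) = do
        r₁′ ← unplug t₁ r₁
        r₂′ ← unplug t₂ r₂
        return (r₁′ , r₂′)
      unplug (junc v t) (_ , r , r′) = do
        b ← best-A v r′
        r″ ← unplug t r
        return ((λ _ → b) , r″)

      -- A tree refuting `f a` would be realisable: at coordinate `i` it is realised without
      -- restrictions by `extend`, at the others because their values are not refuted, and `f`
      -- combines these realisations.
      A-absorbing : ∀ {x} → V x → Absorbing x (A x)
      A-absorbing {x} v i a h du with dec x (f a)
      ... | inj₂ _ = return refl
      ... | inj₁ (_ , t , o , nr) = do
          rs ← all-◇ coord
          r ← Rz-op f pres (closed i) t a rs
          exfalso (nr r)
        where
        coord : ∀ k → ◇ (Rz (𝒮 (side i k)) t (a k))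
        coord k with side i k in eq
        ... | true  = extend free t o (Du⊆Dl v (du k))
        ... | false = A-true v t o (h k eq)

      aas : AAS A
      aas = record
        { nonempty = λ {x} v → do
            (a , r) ← real v (best v) (tests-ok v id)
            b ← best-A v r
            return (a , b)
        ; inside = λ v eq → do
            r ← A-true v (leaf (inj₂ v , 0)) tt eq
            return (In-Du (proj₁ r))
        ; absorbing = A-absorbing
        ; arc = λ v t o eq → A-true v (plug t) (okJ-plug t o) eq >>= unplug t }

    closure : ◇ (∃ λ A → AAS A × (∀ x a → V x → ∀ (t : CT x) → okJ t → A x a ≡ true → ◇ (Rz (𝒮 false) t a)))
    closure = do
      dec ← all-◇ (λ x → all-◇ (λ a → em (Refuted x a)))
      return (A dec , aas dec , λ x a → A-true dec)

  -- Moving the root of a tree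

  -- A tree t with root x, together with the rest c of a larger tree at x
  data Pair {x} (t c : CT x) : Set where
    inner : ok t → ok c → lv t + lv c ≤ n → Pair t c
    junct : V x → okJ t → okJ c → Pair t c

  pair-okJ : ∀ {x} {t c : CT x} → Pair t c → okJ t × okJ c
  pair-okJ {t = t} {c} (inner o o′ l) =
      ok⇒okJ t o (ℕ.≤-trans (ℕ.≤-trans (ℕ.≤-reflexive (ℕ.+-comm 1 _)) (ℕ.+-monoʳ-≤ (lv t) (lv≥1 c))) l)
    , ok⇒okJ c o′ (ℕ.≤-trans (ℕ.+-monoˡ-≤ (lv c) (lv≥1 t)) l)
  pair-okJ (junct v o o′) = o , o′

  -- When the root moves across `e`, the rest `c` hangs from the new root. A junction left behind is
  -- recorded by `junc`, so that it still separates small trees.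
  downE : ∀ {x y} (e : Edge x y) {t : CT y} {c : CT x} → Pair (edge e t) c → CT y
  downE e {c = c} (inner _ _ _) = edge (rev e) c
  downE e {c = c} (junct v _ _) = edge (rev e) (junc v c)

  pair-downE : ∀ {x y} (e : Edge x y) {t : CT y} {c : CT x} (π : Pair (edge e t) c) → Pair t (downE e π)
  pair-downE e (inner o o′ l)     = inner o o′ l
  pair-downE e {t} (junct v (o , l) o′) = inner o o′ (subst (_≤ n) (ℕ.+-comm 1 (lv t)) l)

  upE : ∀ {x y} (e : Edge x y) {t : CT y} {c : CT x} (π : Pair (edge e t) c) {S : Sem L V} {b} →
        Rz S t b → Rz S (downE e π) b → ∃ λ a → Rz S (edge e t) a × Rz S c a
  upE e {c = c} (inner _ _ _) r (_ , a , ba , r′) = a , (Rz-In c r′ , _ , ⟪rev⁻⟫ e ba , r) , r′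
  upE e {c = c} (junct v _ _) r (_ , a , ba , _ , r′) = a , (Rz-In c r′ , _ , ⟪rev⁻⟫ e ba , r) , r′

  pair-joinˡ : ∀ {x} {t₁ t₂ c : CT x} → Pair (join t₁ t₂) c → Pair t₁ (join t₂ c)
  pair-joinˡ {t₁ = t₁} {t₂} {c} (inner (o₁ , o₂) o l) = inner o₁ (o₂ , o) (subst (_≤ n) (ℕ.+-assoc (lv t₁) (lv t₂) (lv c)) l)
  pair-joinˡ (junct v (o₁ , o₂) o) = junct v o₁ (o₂ , o)

  pair-swap : ∀ {x} {t₁ t₂ c : CT x} → Pair (join t₁ t₂) c → Pair (join t₂ t₁) c
  pair-swap {t₁ = t₁} {t₂} {c} (inner (o₁ , o₂) o l) = inner (o₂ , o₁) o (subst (λ j → j + lv c ≤ n) (ℕ.+-comm (lv t₁) (lv t₂)) l)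
  pair-swap (junct v (o₁ , o₂) o) = junct v (o₂ , o₁) o

  pair-junc : ∀ {x} {v : V x} {t c : CT x} → Pair (junc v t) c → Pair t (junc v c)
  pair-junc {v = v} π = let (o , o′) = pair-okJ π in junct v o o′

  -- Realising all prescribed leaves, by a Helly-type argument

  PTree : Var → Set
  PTree = Tree P (λ _ → ⊥)

  prescribed : Sem P (λ _ → ⊥)
  prescribed = record { In = Dl ; Lf = λ {x} _ a → a ≡ s x ; Jn = λ () }

  module Prescribe (Dl-inhabited : ∀ x → ∃ (Dl x))
    (Hleaf : ∀ {x} → P x → Dl x (s x))
    (Hjoin : ∀ {x} (r₁ r₂ : PTree x) → lv r₁ + lv r₂ ≤ n → ◇ (∃ λ a → Rz prescribed r₁ a × Rz prescribed r₂ a)) where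

    γ : (ℕ → Bool) → Bool → Sem L V
    γ K σ = record
      { In = Du
      ; Lf = λ { {x} (inj₁ _ , τ) a → σ ≡ false → K τ ≡ true → a ≡ s x ; (inj₂ _ , _) a → ⊤ }
      ; Jn = λ _ _ → ⊤ }

    γ-free : ∀ K → Free (γ K true)
    γ-free K = record { In-f = id ; Lf-f = λ { (inj₁ _ , _) a () ; (inj₂ _ , _) a → tt } ; Jn-f = λ _ _ → tt }

    -- The subtree spanned by the root and the leaves with tags in `K` at assigned variables, if
    -- there are any. Junctions are forgotten, as the result is to be used as a single small tree.
    prune : (ℕ → Bool) → ∀ {x} → CT x → Maybe (PTree x)
    prune K (leaf (inj₁ p , τ)) with K τ
    ... | true  = just (leaf p)
    ... | false = nothing
    prune K (leaf (inj₂ _ , _)) = nothing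
    prune K (edge e t) with prune K t
    ... | just r  = just (edge e r)
    ... | nothing = nothing
    prune K (join t₁ t₂) with prune K t₁ | prune K t₂
    ... | just r₁ | just r₂ = just (join r₁ r₂)
    ... | just r₁ | nothing = just r₁
    ... | nothing | o       = o
    prune K (junc _ t) = prune K t

    module _ (K : ℕ → Bool) where

      unmarked : ∀ {x} (t : CT x) → prune K t ≡ nothing → ∀ {a} → Rz (γ K true) t a → Rz (γ K false) t a
      unmarked (leaf (inj₁ p , τ)) eq (i , _) with K τ
      ... | false = i , λ _ ()
      unmarked (leaf (inj₂ _ , _)) eq (i , l) = i , l
      unmarked (edge e t) eq (i , b , ab , r) with prune K t in eq′
      ... | nothing = i , b , ab , unmarked t eq′ r
      unmarked (join t₁ t₂) eq (r₁ , r₂) with prune K t₁ in eq₁ | prune K t₂ in eq₂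
      unmarked (join t₁ t₂) eq (r₁ , r₂) | nothing | nothing = unmarked t₁ eq₁ r₁ , unmarked t₂ eq₂ r₂
      unmarked (join t₁ t₂) () (r₁ , r₂) | nothing | just _
      unmarked (join t₁ t₂) () (r₁ , r₂) | just _ | nothing
      unmarked (join t₁ t₂) () (r₁ , r₂) | just _ | just _
      unmarked (junc _ t) eq (j , r) = j , unmarked t eq r

      rest : ∀ {x} (t : CT x) → okJ t → prune K t ≡ nothing → ∀ {a} → Dl x a → ◇ (Rz (γ K false) t a)
      rest t o eq i = do
        r ← extend (γ-free K) t o i
        return (unmarked t eq r)

      lift : ∀ {x} (t : CT x) → okJ t → ∀ {r} → prune K t ≡ just r → ∀ {a} → Rz prescribed r a → ◇ (Rz (γ K false) t a)
      lift (leaf (inj₁ p , τ)) o eq h with K τ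
      lift (leaf (inj₁ p , τ)) o refl (i , q) | true = return (Dl⊆Du i , λ _ _ → q)
      lift (edge e t) (o , l) eq h with prune K t in eq′
      lift (edge e t) (o , l) refl (i , b , ab , h) | just r = do
        r′ ← lift t (ok⇒okJ t o l) eq′ h
        return (Dl⊆Du i , b , ab , r′)
      lift (join t₁ t₂) (o₁ , o₂) eq h with prune K t₁ in eq₁ | prune K t₂ in eq₂
      lift (join t₁ t₂) (o₁ , o₂) refl (h₁ , h₂) | just r₁ | just r₂ = do
        r₁′ ← lift t₁ o₁ eq₁ h₁
        r₂′ ← lift t₂ o₂ eq₂ h₂
        return (r₁′ , r₂′)
      lift (join t₁ t₂) (o₁ , o₂) refl h | just r₁ | nothing = do
        r₁′ ← lift t₁ o₁ eq₁ h
        r₂′ ← rest t₂ o₂ eq₂ (Rz-In r₁ h)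
        return (r₁′ , r₂′)
      lift (join t₁ t₂) (o₁ , o₂) {r} refl h | nothing | just _ = do
        r₁′ ← rest t₁ o₁ eq₁ (Rz-In r h)
        r₂′ ← lift t₂ o₂ eq₂ h
        return (r₁′ , r₂′)
      lift (junc v t) o eq h = do
        r′ ← lift t o eq h
        return (tt , r′)

      prune-downE : ∀ {x y} (e : Edge x y) {t : CT y} {c : CT x} (π : Pair (edge e t) c) →
                    prune K c ≡ nothing → prune K (downE e π) ≡ nothing
      prune-downE e (inner _ _ _) eq rewrite eq = refl
      prune-downE e (junct _ _ _) eq rewrite eq = refl

      prune-join : ∀ {x} (t c : CT x) → prune K t ≡ nothing → prune K c ≡ nothing → prune K (join t c) ≡ nothing
      prune-join t c eq eq′ rewrite eq | eq′ = refl

      -- Move the root to a vertex where the demanded leaves branch: the subtree they span is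
      -- realised in Dl, and everything else extends from there into Du.
      realise : ∀ {x} (t c : CT x) → Pair t c → prune K c ≡ nothing → ∀ {r} → prune K t ≡ just r → lv r ≤ n →
                ◇ (∃ λ a → Rz (γ K false) t a × Rz (γ K false) c a)
      realise (leaf (inj₁ p , τ)) c π eqc eq l = do
        r ← rest c (proj₂ (pair-okJ π)) eqc (Hleaf p)
        return (_ , (Dl⊆Du (Hleaf p) , λ _ _ → refl) , r)
      realise (edge e t) c π eqc eq l with prune K t in eq′
      realise (edge e t) c π eqc refl l | just r = do
        (b , r₁ , r₂) ← realise t (downE e π) (pair-downE e π) (prune-downE e π eqc) eq′ l
        return (upE e π {S = γ K false} r₁ r₂)
      realise (join t₁ t₂) c π eqc eq l with prune K t₁ in eq₁ | prune K t₂ in eq₂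
      realise (join t₁ t₂) c π eqc refl l | just r₁ | just r₂ = do
        let ((o₁ , o₂) , o) = pair-okJ π
        (a , h₁ , h₂) ← Hjoin r₁ r₂ l
        r₁′ ← lift t₁ o₁ eq₁ h₁
        r₂′ ← lift t₂ o₂ eq₂ h₂
        r ← rest c o eqc (Rz-In r₁ h₁)
        return (a , (r₁′ , r₂′) , r)
      realise (join t₁ t₂) c π eqc refl l | just r₁ | nothing = do
        (a , h₁ , h₂ , h) ← realise t₁ (join t₂ c) (pair-joinˡ π) (prune-join t₂ c eq₂ eqc) eq₁ l
        return (a , (h₁ , h₂) , h)
      realise (join t₁ t₂) c π eqc refl l | nothing | just r₂ = do
        (a , h₂ , h₁ , h) ← realise t₂ (join t₁ c) (pair-joinˡ (pair-swap π)) (prune-join t₁ c eq₁ eqc) eq₂ l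
        return (a , (h₁ , h₂) , h)
      realise (junc v t) c π eqc eq l = do
        (a , h , j , h′) ← realise t (junc v c) (pair-junc π) eqc eq l
        return (a , (tt , h) , h′)

      realise-few : ∀ {x} → V x → ∀ (t : CT x) → okJ t → (∀ {r} → prune K t ≡ just r → lv r ≤ n) → ◇ (∃ λ a → Rz (γ K false) t a)
      realise-few {x} v t o l with prune K t in eq
      ... | nothing = do
        r ← rest t o eq (proj₂ (Dl-inhabited x))
        return (_ , r)
      ... | just _ = do
        (a , r , _) ← realise t (leaf (inj₂ v , 0)) (junct v o tt) refl eq (l refl)
        return (a , r)

    -- In contrast to `lv`, leaves beyond junctions are counted, so that `label` can give every leaf
    -- its own tag.
    size : ∀ {x} → CT x → ℕ
    size (leaf _)     = 1
    size (edge _ t)   = size t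
    size (join t₁ t₂) = size t₁ + size t₂
    size (junc _ t)   = size t

    label : ℕ → ∀ {x} → CT x → CT x
    label o (leaf (k , _)) = leaf (k , o)
    label o (edge e t)     = edge e (label o t)
    label o (join t₁ t₂)   = join (label o t₁) (label (o + size t₁) t₂)
    label o (junc v t)     = junc v (label o t)

    lv-label : ∀ o {x} (t : CT x) → lv (label o t) ≡ lv t
    lv-label o (leaf _)     = refl
    lv-label o (edge e t)   = lv-label o t
    lv-label o (join t₁ t₂) = cong₂ _+_ (lv-label o t₁) (lv-label _ t₂)
    lv-label o (junc v t)   = refl

    ok-label : ∀ o {x} (t : CT x) → ok t → ok (label o t)
    okJ-label : ∀ o {x} (t : CT x) → okJ t → okJ (label o t)
    ok-label o (leaf _)     p = tt
    ok-label o (edge e t)   p = ok-label o t p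
    ok-label o (join t₁ t₂) (p , q) = ok-label o t₁ p , ok-label _ t₂ q
    ok-label o (junc v t)   p = okJ-label o t p
    okJ-label o (leaf _)     p = tt
    okJ-label o (edge e t)   (p , l) = ok-label o t p , subst (λ j → suc j ≤ n) (sym (lv-label o t)) l
    okJ-label o (join t₁ t₂) (p , q) = okJ-label o t₁ p , okJ-label _ t₂ q
    okJ-label o (junc v t)   p = okJ-label o t p

    all-tags : ℕ → Bool
    all-tags _ = true

    unlabel : ∀ K o {x} (t : CT x) → (∀ τ → o ≤ τ → τ < o + size t → K τ ≡ true) → ∀ {a} →
              Rz (γ K false) (label o t) a → Rz (γ all-tags false) t a
    unlabel K o (leaf (inj₁ p , _)) h (i , l) = i , λ q _ → l q (h o ℕ.≤-refl (ℕ.m<m+n o (s≤s z≤n)))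
    unlabel K o (leaf (inj₂ v , _)) h (i , l) = i , l
    unlabel K o (edge e t) h (i , b , ab , r) = i , b , ab , unlabel K o t h r
    unlabel K o (join t₁ t₂) h (r₁ , r₂) =
        unlabel K o t₁ (λ τ p q → h τ p (ℕ.<-≤-trans q (ℕ.+-monoʳ-≤ o (ℕ.m≤m+n _ _)))) r₁
      , unlabel K (o + size t₁) t₂ (λ τ p q → h τ (ℕ.≤-trans (ℕ.m≤m+n o _) p)
                                     (subst (τ <_) (ℕ.+-assoc o (size t₁) (size t₂)) q)) r₂
    unlabel K o (junc v t) h (j , r) = j , unlabel K o t h r

    prune-cnt : ∀ K o {x} (t : CT x) {r} → prune K (label o t) ≡ just r → lv r ≤ cnt K o (size t)
    prune-cnt K o (leaf (inj₁ p , _)) eq with K o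
    prune-cnt K o (leaf (inj₁ p , _)) refl | true = s≤s z≤n
    prune-cnt K o (edge e t) eq with prune K (label o t) in eq′
    prune-cnt K o (edge e t) refl | just r = prune-cnt K o t eq′
    prune-cnt K o (join t₁ t₂) eq rewrite cnt-+ K o (size t₁) (size t₂)
      with prune K (label o t₁) in eq₁ | prune K (label (o + size t₁) t₂) in eq₂
    prune-cnt K o (join t₁ t₂) refl | just r₁ | just r₂ = ℕ.+-mono-≤ (prune-cnt K o t₁ eq₁) (prune-cnt K _ t₂ eq₂)
    prune-cnt K o (join t₁ t₂) refl | just r₁ | nothing = ℕ.≤-trans (prune-cnt K o t₁ eq₁) (ℕ.m≤m+n _ _)
    prune-cnt K o (join t₁ t₂) refl | nothing | just r₂ = ℕ.≤-trans (prune-cnt K _ t₂ eq₂) (ℕ.m≤n+m _ _)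
    prune-cnt K o (junc v t) eq = prune-cnt K o t eq

    -- The arguments of `f` omit entries of `js` at distinct positions. A tag in `js` is therefore
    -- missing for at most one of them, and near-unanimity restores the prescribed value.
    drop-closed : ∀ js (pos : Fin (suc n) → Fin (length js)) → (∀ {i j} → pos i ≡ pos j → i ≡ j) →
                  Closed f pres (λ i → γ (mem (removeAt js (pos i))) false) (γ (mem js) false)
    drop-closed js pos inj = record
      { In-c = λ _ a h → return (Du-f a h)
      ; Lf-c = λ { (inj₁ _ , τ) a _ h → return (λ _ q → agree τ a h (mem-∈ q)) ; (inj₂ _ , _) a _ _ → return tt }
      ; Jn-c = λ _ _ _ _ → return tt }
      where
      agree : ∀ {x} τ a → (∀ k → false ≡ false → mem (removeAt js (pos k)) τ ≡ true → a k ≡ s x) → τ ∈ˡ js → f a ≡ s x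
      agree τ a h p with any? (λ i → pos i ≟ index p)
      ... | yes (i , eq) = nu a i _ λ k k≢i → h k refl (mem-true (∈-removeAt js p (pos k) λ eq′ → k≢i (inj (trans (sym eq′) (sym eq)))))
      ... | no none = nu a zero _ λ k _ → h k refl (mem-true (∈-removeAt js p (pos k) λ eq′ → none (k , sym eq′)))

    -- If more than `n` tags are demanded, each of the first `n + 1` entries is omitted in turn and
    -- `f` combines the realisations so obtained; otherwise the demanded leaves span a small tree.
    -- `N` bounds the length for the recursion.
    helly : ∀ {x} → V x → ∀ (t : CT x) → okJ t → ∀ N js → length js ≤ N → ◇ (∃ λ a → Rz (γ (mem js) false) (label 0 t) a)
    helly v t o N js l with length js ≤? n
    ... | yes few = realise-few (mem js) v (label 0 t) (okJ-label 0 t o)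
                      λ eq → ℕ.≤-trans (prune-cnt (mem js) 0 t eq) (ℕ.≤-trans (cnt≤length js 0 (size t)) few)
    helly v t o zero js l | no many = ⊥-elim (many (ℕ.≤-trans l z≤n))
    helly v t o (suc N) js l | no many = do
        rs ← all-◇ (λ i → helly v t o N (removeAt js (pos i)) (shorter (pos i)))
        r ← Rz-op f pres (drop-closed js pos (inject≤-injective n<js n<js _ _)) (label 0 t) (proj₁ ∘ rs) (proj₂ ∘ rs)
        return (_ , r)
      where
      n<js : suc n ≤ length js
      n<js = ℕ.≰⇒> many
      pos : Fin (suc n) → Fin (length js)
      pos i = inject≤ i n<js
      shorter : ∀ i → length (removeAt js i) ≤ N
      shorter i = ℕ.≤-pred (subst (_≤ suc N) (length-removeAt′ js i) l)

    γ-closed : ∀ i → Closed f pres (λ k → γ all-tags (side i k)) (γ all-tags false)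
    γ-closed i = record
      { In-c = λ _ a h → return (Du-f a h)
      ; Lf-c = λ { (inj₁ _ , τ) a _ h → return (λ _ q → s-absorbing i a λ k e → h k e q) ; (inj₂ _ , _) a _ _ → return tt }
      ; Jn-c = λ _ _ _ _ → return tt }

    γ-real : ∀ {x} → V x → ∀ (t : CT x) → okJ t → ◇ (∃ λ a → Rz (γ all-tags false) t a)
    γ-real v t o = do
      (a , r) ← helly v t o _ (upTo (size t)) ℕ.≤-refl
      return (a , unlabel (mem (upTo (size t))) 0 t (λ τ _ q → mem-true (∈-upTo⁺ q)) r)

    initial : ◇ (∃ AAS)
    initial = do
      (A , aas , _) ← Closure.closure (γ all-tags) 0 (γ-free all-tags) γ-closed id (λ p l → l refl refl) γ-real
      return (A , aas)

  -- Words with side trees glued at junctions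

  okO : ∀ {x} → Maybe (CT x) → Set
  okO nothing  = ⊤
  okO (just t) = ok t

  okS : ∀ {x y} → Spine L V x y → Set
  okS (last _)     = ⊤
  okS (next _ o s) = okO o × okS s

  EWord : Var → Var → Set
  EWord = Word n L V V

  okW : ∀ {x y} → EWord x y → Set
  okW []             = ⊤
  okW (cons s _ _ w) = okS s × okW w

  okS-append : ∀ {x z y} (s : Spine L V x z) o (s′ : Spine L V z y) → okS s → okO o → okS s′ → okS (append s o s′)
  okS-append (last e)      o s′ p q r = q , r
  okS-append (next e o₁ s) o s′ (p , p′) q r = p , okS-append s o s′ p′ q r

  okS-rev : ∀ {x y} (s : Spine L V x y) → okS s → okS (revS s)
  okS-rev (last e)     p = tt
  okS-rev (next e o s) (p , q) = okS-append (revS s) o (last (rev e)) (okS-rev s q) p tt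

  okW-++ : ∀ {x y z} (w : EWord x y) (w′ : EWord y z) → okW w → okW w′ → okW (w ++ w′)
  okW-++ []             w′ p q = q
  okW-++ (cons s _ _ w) w′ (p , p′) q = p , okW-++ w w′ p′ q

  okW-pow : ∀ {x} (w : EWord x x) j → okW w → okW (pow w j)
  okW-pow w zero    p = tt
  okW-pow w (suc j) p = okW-++ w (pow w j) p (okW-pow w j p)

  okW-rev : ∀ {x y} (v : V x) (w : EWord x y) → okW w → okW (revW v w)
  okW-rev v []             p = tt
  okW-rev v (cons s l k w) (p , q) = okW-++ (revW k w) _ (okW-rev k w q) (okS-rev s p , tt)

  cutO : ∀ {x} → Maybe (CT x) → Maybe (Plain x)
  cutO nothing  = nothing
  cutO (just t) = just (cut t)

  cutS : ∀ {x y} → Spine L V x y → PSpine x y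
  cutS (last e)     = last e
  cutS (next e o s) = next e (cutO o) (cutS s)

  sides-cut : ∀ {x y} (s : Spine L V x y) → sides (cutS s) ≡ sides s
  sides-cut (last e)            = refl
  sides-cut (next e nothing s)  = sides-cut s
  sides-cut (next e (just t) s) = cong₂ _+_ (lv-cut t) (sides-cut s)

  cutW : ∀ {x y} → EWord x y → PWord n x y
  cutW []             = []
  cutW (cons s l _ w) = cons (cutS s) (subst (λ j → 2 + j ≤ n) (sym (sides-cut s)) l) tt (cutW w)

  hang : ∀ {x y} → Spine L V x y → CT y → CT x
  hang (last e)            t = edge e t
  hang (next e nothing s)  t = edge e (hang s t)
  hang (next e (just u) s) t = edge e (join u (hang s t))

  lv-hang : ∀ {x y} (s : Spine L V x y) (t : CT y) → lv (hang s t) ≡ sides s + lv t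
  lv-hang (last e)            t = refl
  lv-hang (next e nothing s)  t = lv-hang s t
  lv-hang (next e (just u) s) t = trans (cong (lv u +_) (lv-hang s t)) (sym (ℕ.+-assoc (lv u) (sides s) (lv t)))

  ok-hang : ∀ {x y} (s : Spine L V x y) (t : CT y) → okS s → ok t → ok (hang s t)
  ok-hang (last e)            t p q = q
  ok-hang (next e nothing s)  t (_ , p) q = ok-hang s t p q
  ok-hang (next e (just u) s) t (o , p) q = o , ok-hang s t p q

  okJ-hang : ∀ {x y} (s : Spine L V x y) (t : CT y) → okS s → ok t → suc (sides s + lv t) ≤ n → okJ (hang s t)
  okJ-hang s t p q l = ok⇒okJ (hang s t) (ok-hang s t p q) (subst (λ j → suc j ≤ n) (sym (lv-hang s t)) l)

  unhang : ∀ {S : Sem L V} {x y} (s : Spine L V x y) (t : CT y) {a} → Rz S (hang s t) a → ∃ λ b → SR S s a b × Rz S t b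
  unhang (last e)            t (_ , b , ab , r) = b , (ab , Rz-In t r) , r
  unhang (next e nothing s)  t (_ , c , ac , r) =
    let (b , u , r′) = unhang s t r in b , (c , ac , Rz-In (hang s t) r , u) , r′
  unhang (next e (just o) s) t (_ , c , ac , ro , r) =
    let (b , u , r′) = unhang s t r in b , (c , ac , ro , u) , r′

  -- Walks through arc-consistent domains

  module Walks (A : Domains) (aas : AAS A) where
    open AAS aas

    J : Bool → Var → Fin d → Set
    J σ x a = σ ≡ false → A x a ≡ true

    -- With `false`, junctions take values in `A` and leaves obey their restrictions; with `true`,
    -- only `Du` is demanded. The former relation absorbs the latter.
    R : Bool → ∀ {x y} → EWord x y → Rel₂ d
    R σ = WR (base A σ) (J σ)

    G : Bool → Var → Fin d → Set
    G σ x a = J σ x a × Du x a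

    A⇒G : ∀ {x a} → V x → A x a ≡ true → ◇ (G false x a)
    A⇒G v p = inside v p >>= λ i → return ((λ _ → p) , i)

    base-free : Free (base A true)
    base-free = record { In-f = id ; Lf-f = λ { (inj₁ _ , _) a () ; (inj₂ _ , _) a () } ; Jn-f = λ _ a () }

    base-closed : ∀ i → Closed f pres (λ k → base A (side i k)) (base A false)
    base-closed i = record
      { In-c = λ _ a h → return (Du-f a h)
      ; Lf-c = λ { (inj₁ _ , _) a _ h → return (λ _ → s-absorbing i a h)
                 ; (inj₂ v , _) a du h → absorbing v i a h du >>= λ r → return (λ _ → r) }
      ; Jn-c = λ v a du h → absorbing v i a h du >>= λ r → return (λ _ → r) }

    R⊑ : ∀ {x y} (w : EWord x y) → R false w ⊑ R true w
    R⊑ w a b = WR-map id (λ { (inj₁ _ , _) _ () ; (inj₂ _ , _) _ () }) (λ _ _ ()) (λ _ ()) w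

    R-absorbs : ∀ {x y} (w : EWord x y) → Absorbs (λ σ → R σ w)
    R-absorbs w i = WR-op f pres (base-closed i) ext {Jks = λ k → J (side i k)} {Jk = J false}
      (λ v a du h → absorbing v i a h du >>= λ r → return (λ _ → r)) w

    R-preserved : ∀ {x y} (w : EWord x y) a b → (∀ k → R false w (a k) (b k)) → ◇ (R false w (f a) (f b))
    R-preserved w a b h = R-absorbs w zero a b (λ k → mixed (side zero k) (h k))
      where
      mixed : ∀ σ {a b} → R false w a b → R σ w a b
      mixed true  r = R⊑ w _ _ r
      mixed false r = r

    arcs : ∀ σ {x} → V x → ∀ (t : CT x) → okJ t → ∀ {a} → G σ x a → ◇ (Rz (base A σ) t a)
    arcs true  v t o (_ , i) = extend base-free t o (Du⊆Dl v i)
    arcs false v t o (p , _) = arc v t o (p refl)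

    forth : ∀ σ {x y} → V x → ∀ (w : EWord x y) → okW w → ∀ {a} → G σ x a → ◇ (∃ λ b → R σ w a b × G σ y b)
    forth σ v []             _ g = return (_ , refl , g)
    forth σ v (cons s l k w) (p , q) g = do
      r ← arcs σ v (hang s (leaf (inj₂ k , 0))) (okJ-hang s _ p tt (subst (λ j → suc j ≤ n) (ℕ.+-comm 1 (sides s)) l)) g
      let (c , u , i , j) = unhang s _ r
      (b , w′ , g′) ← forth σ k w q (j , i)
      return (b , (c , u , j , w′) , g′)

    back : ∀ σ {x y} → V x → V y → ∀ (w : EWord x y) → okW w → ∀ {b} → G σ y b → ◇ (∃ λ a → R σ w a b × G σ x a)
    back σ v v′ w o (j , i) = do
      (a , r , g) ← forth σ v′ (revW v w) (okW-rev v w o) (j , i)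
      return (a , WR-rev⁻ (base A σ) (J σ) v w i j r , g)

    fill-O : ∀ {x} (o : Maybe (CT x)) → okO o → ∀ {a} → OR (plain Du) (cutO o) a → ◇ (OR (base A true) o a)
    fill-O nothing  _ i = return i
    fill-O (just t) p r = fill base-free t p r

    fill-S : ∀ {x y} (s : Spine L V x y) → okS s → ∀ {a b} → SR (plain Du) (cutS s) a b → ◇ (SR (base A true) s a b)
    fill-S (last e)     _ r = return r
    fill-S (next e o s) (p , q) (c , ac , r , u) = do
      r′ ← fill-O o p r
      u′ ← fill-S s q u
      return (c , ac , r′ , u′)

    fill-W : ∀ {x y} (w : EWord x y) → okW w → ∀ {a b} → Realise.PR Du (cutW w) a b → ◇ (R true w a b)
    fill-W []             _ e = return e
    fill-W (cons s _ _ w) (p , q) (c , r , _ , u) = do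
      r′ ← fill-S s p r
      u′ ← fill-W w q u
      return (c , r′ , (λ ()) , u′)

    -- Cutting at the junctions leaves words of plain small trees, to which `returns` applies. What
    -- was cut off is then filled in again within `Du`.
    returns-R : ∀ {x} → V x → ∀ (p q : EWord x x) → okW p → okW q → ∀ {a} → A x a ≡ true →
                ◇ (∃ λ j → ((R true p ⨾ R true q) ^^ j ⨾ R true p) a a)
    returns-R v p q op oq h = do
        i ← inside v h
        (j , c , u , w) ← returns (Du⊆Dl v i) (cutW p) (cutW q)
        u′ ← loops j u
        w′ ← fill-W p op w
        return (j , c , u′ , w′)
      where
      loops : ∀ j {a b} → ((Realise.PR Du (cutW p) ⨾ Realise.PR Du (cutW q)) ^^ j) a b → ◇ (((R true p ⨾ R true q) ^^ j) a b)
      loops zero    e = return e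
      loops (suc j) (c , (c′ , r , r′) , u) = do
        r₁ ← fill-W p op r
        r₂ ← fill-W q oq r′
        u₁ ← loops j u
        return (c , (c′ , r₁ , r₂) , u₁)

    infix 4 _⊆_ _≈_
    _⊆_ _≈_ : (Fin d → Set) → (Fin d → Set) → Set
    C ⊆ C′ = ∀ a → C a → ◇ (C′ a)
    C ≈ C′ = (C ⊆ C′) × (C′ ⊆ C)

    ⊆-trans : ∀ {C C′ C″} → C ⊆ C′ → C′ ⊆ C″ → C ⊆ C″
    ⊆-trans p q a c = p a c >>= q a

    ≈-sym : ∀ {C C′} → C ≈ C′ → C′ ≈ C
    ≈-sym (p , q) = q , p

    ≈-trans : ∀ {C C′ C″} → C ≈ C′ → C′ ≈ C″ → C ≈ C″
    ≈-trans (p , q) (p′ , q′) = ⊆-trans p p′ , ⊆-trans q′ q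

    BSet : Set
    BSet = Vec Bool d

    _∋_ : BSet → Fin d → Set
    C ∋ a = lookup C a ≡ true

    -- Predicates become bit vectors, of which there are finitely many; `climb` and `pusher` can
    -- thus run through a list of all subsets.
    represent : (Q : Fin d → Set) → ◇ (∃ λ (C : BSet) → Q ≈ (C ∋_))
    represent Q = do
        dec ← all-◇ (λ a → em (Q a))
        return (tabulate (bit ∘ dec) , (λ a → from dec a) , (λ a → to dec a))
      where
      bit : ∀ {X : Set} → X ⊎ (X → Ans) → Bool
      bit (inj₁ _) = true
      bit (inj₂ _) = false
      from : ∀ dec a → Q a → ◇ (tabulate (bit ∘ dec) ∋ a)
      from dec a q rewrite lookup∘tabulate (bit ∘ dec) a with dec a
      ... | inj₁ _  = return refl
      ... | inj₂ nq = exfalso (nq q)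
      to : ∀ dec a → tabulate (bit ∘ dec) ∋ a → ◇ (Q a)
      to dec a eq rewrite lookup∘tabulate (bit ∘ dec) a with dec a
      ... | inj₁ q = return q

    allVecs : ∀ k → List (Vec Bool k)
    allVecs zero    = [] ∷ []
    allVecs (suc k) = map (true ∷_) (allVecs k) ++ˡ map (false ∷_) (allVecs k)

    ∈-allVecs : ∀ {k} (C : Vec Bool k) → C ∈ˡ allVecs k
    ∈-allVecs []          = here refl
    ∈-allVecs (true ∷ C)  = ∈-++⁺ˡ (∈-map⁺ (true ∷_) (∈-allVecs C))
    ∈-allVecs (false ∷ C) = ∈-++⁺ʳ (map (true ∷_) (allVecs _)) (∈-map⁺ (false ∷_) (∈-allVecs C))

    -- Images and strong subsets of a domain

    module Shrink {x₀ : Var} (v₀ : V x₀) where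

      A₀ : Fin d → Set
      A₀ a = A x₀ a ≡ true

      Loop : Set
      Loop = Σ (EWord x₀ x₀) okW

      ε : Loop
      ε = [] , tt

      infixr 5 _·_
      _·_ : Loop → Loop → Loop
      (w , o) · (w′ , o′) = w ++ w′ , okW-++ w w′ o o′

      power : Loop → ℕ → Loop
      power (w , o) j = pow w j , okW-pow w j o

      ⟦_⟧ : Loop → Rel₂ d
      ⟦ w ⟧ = R false (proj₁ w)

      Img : (Fin d → Set) → Loop → Fin d → Set
      Img C w b = ∃ λ a → C a × ⟦ w ⟧ a b

      Img-⊆ : ∀ {C C′} w → C ⊆ C′ → Img C w ⊆ Img C′ w
      Img-⊆ w p b (a , c , r) = p a c >>= λ c′ → return (a , c′ , r)

      Img-≈ : ∀ {C C′} w → C ≈ C′ → Img C w ≈ Img C′ w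
      Img-≈ w (p , q) = Img-⊆ w p , Img-⊆ w q

      Img-· : ∀ {C} w w′ → Img (Img C w) w′ ≈ Img C (w · w′)
      Img-· (w , _) (w′ , _) =
          (λ { b (c , (a , ca , r) , r′) → return (a , ca , WR-++ _ _ w w′ a b (c , r , r′)) })
        , (λ { b (a , ca , r) → let (c , u , v) = WR-++⁻ _ _ w w′ a b r in return (c , (a , ca , u) , v) })

      Img-ε : ∀ {C} → Img C ε ≈ C
      Img-ε = (λ { b (a , c , refl) → return c }) , (λ b c → return (b , c , refl))

      Img-A : ∀ {C} w → C ⊆ A₀ → Img C w ⊆ A₀
      Img-A (w , _) p b (a , c , r) = do
        h ← p a c
        (j , i) ← A⇒G v₀ h
        return (proj₂ (WR-end (base A false) (J false) w i j r) refl)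

      Img-power : ∀ {C} w j → Img C w ≈ C → Img C (power w j) ≈ C
      Img-power w zero    p = Img-ε
      Img-power w (suc j) p = ≈-trans (≈-sym (Img-· w (power w j))) (≈-trans (Img-≈ (power w j) p) (Img-power w j p))

      predecessor : ∀ w {b} → A₀ b → ◇ (∃ λ a → A₀ a × ⟦ w ⟧ a b)
      predecessor (w , o) h = do
        g ← A⇒G v₀ h
        (a , r , (j , _)) ← back false v₀ v₀ w o g
        return (a , j refl , r)

      -- `suc d` rounds are at least `d`, as the pigeonhole argument requires, and a first round can
      -- be split off.
      rotate : ∀ C p q → C ⊆ A₀ → Img C (p · q) ≈ C → Img C (power (q · p) (suc d)) ⊆ Img C p
      rotate C p@(w , o) q@(w′ , o′) C⊆A (stay , come) b (a , c , r) =
          C⊆A a c >>= λ ha →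
          Rotation.rotate {λ σ → R σ w} {λ σ → R σ w′} (R⊑ w) (R⊑ w′) (R-absorbs w) (R-absorbs w′) {λ a → C a × A₀ a}
            (λ { c (_ , h) → returns-R v₀ w w′ o o′ h })
            (λ { c (cc , _) → do
                 (b , cb , u) ← come c cc
                 hb ← C⊆A b cb
                 return (b , (cb , hb) , WR-++⁻ _ _ w w′ b c u) })
            (λ { {b} {c} (cb , _) u → do
                 cc ← stay c (b , cb , WR-++ _ _ w w′ b c u)
                 hc ← C⊆A c cc
                 return (cc , hc) })
            (suc d) (ℕ.n≤1+n d) (c , ha) (^^-mono (suc d) (WR-++⁻ _ _ w′ w) a b (WR-pow⁻ _ _ (w′ ++ w) (suc d) a b r))
          >>= λ { (e , (ce , _) , u) → return (e , ce , u) }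

      -- The k-strong sets. They are moreover required to absorb `Du`, so that restricting leaves to
      -- such a set is compatible with absorption.
      record SS (k : ℕ) (C : BSet) : Set where
        field
          sub    : (C ∋_) ⊆ A₀
          some   : ∃ (C ∋_)
          proper : ∃ λ a → A₀ a × (C ∋ a → Ans)
          absb   : Absorbing x₀ (lookup C)
          strong : ∀ a → (∀ j → A₀ (a j)) → (∀ j → k ≤ toℕ j → C ∋ a j) → ◇ (C ∋ f a)
      open SS

      sing : Fin d → BSet
      sing a = tabulate (λ c → does (c ≟ a))

      sing-∋ : ∀ {a c} → sing a ∋ c → c ≡ a
      sing-∋ {a} {c} eq with c ≟ a | trans (sym (lookup∘tabulate (λ c → does (c ≟ a)) c)) eq
      ... | yes p | _ = p

      ∋-sing : ∀ {a c} → c ≡ a → sing a ∋ c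
      ∋-sing {a} {c} eq = trans (lookup∘tabulate (λ c → does (c ≟ a)) c) (dec-true (c ≟ a) eq)

      sing-SS : ∀ {a b} → A₀ a → A₀ b → a ≢ b → SS 1 (sing a)
      sing-SS {a} {b} ha hb a≢b = record
        { sub = λ _ p → return (subst A₀ (sym (sing-∋ p)) ha)
        ; some = a , ∋-sing refl
        ; proper = b , hb , λ p → ⊥-elim (a≢b (sym (sing-∋ p)))
        ; absb = λ i c h _ → return (∋-sing (nu c i a λ k k≢i → sing-∋ (h k (side-off k≢i))))
        ; strong = λ c _ h → return (∋-sing (nu c zero a λ { zero ne → ⊥-elim (ne refl) ; (suc k) _ → sing-∋ (h (suc k) (s≤s z≤n)) })) }

      -- The search stops before `suc n`: there no entry is restricted any more, and a constant
      -- tuple outside `C` would be mapped into `C`, contrary to idempotence.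
      strongest : ∀ r k → r + k ≡ suc n → ∀ C → SS k C →
                  ◇ (∃ λ k → ∃ λ C → SS k C × k < suc n × (∀ C′ → SS (suc k) C′ → Ans))
      strongest zero k refl C ss =
        let (a , ha , out) = proper ss in
        strong ss (λ _ → a) (λ _ → ha) (λ j l → ⊥-elim (ℕ.<⇒≱ (toℕ<n j) l)) >>= λ p →
        exfalso (out (subst (C ∋_) (nu (λ _ → a) zero a λ _ _ → refl) p))
      strongest (suc r) k eq C ss = em (∃ (SS (suc k))) >>= λ
        { (inj₁ (C′ , ss′)) → strongest r (suc k) (trans (ℕ.+-suc r k) eq) C′ ss′
        ; (inj₂ none) → return (k , C , ss , subst (k <_) eq (s≤s (ℕ.m≤n+m k r)) , λ C′ ss′ → none (C′ , ss′)) }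

      Proper : (Fin d → Set) → Set
      Proper C = ∃ λ a → A₀ a × (C a → Ans)

      -- The entries of a tuple are traced back along `w`: into `C` where they lie in the image,
      -- otherwise merely into the domain or `Du`. There `f` gives an element of `C`, and `f`
      -- preserves the walks.
      image-SS : ∀ {k C} → SS k C → ∀ w {C′} → Img (C ∋_) w ≈ (C′ ∋_) → Proper (Img (C ∋_) w) → ◇ (SS k C′)
      image-SS {k} {C} ss (w , o) {C′} (from , to) (a , ha , out) = do
          let (c , cc) = some ss
          hc ← sub ss c cc
          g ← A⇒G v₀ hc
          (b , r , _) ← forth false v₀ w o g
          b∈ ← from b (c , cc , r)
          return record
            { sub = λ a p → to a p >>= Img-A (w , o) (sub ss) a
            ; some = b , b∈
            ; proper = a , ha , λ p → to a p out
            ; absb = absb′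
            ; strong = strong′ }
        where
        absb′ : Absorbing x₀ (lookup C′)
        absb′ i b h du = do
            rs ← all-◇ coord
            r ← R-absorbs w i (proj₁ ∘ rs) b (λ k → proj₁ (proj₂ (rs k)))
            c ← absb ss i (proj₁ ∘ rs) (λ k → proj₁ (proj₂ (proj₂ (rs k)))) (λ k → proj₂ (proj₂ (proj₂ (rs k))))
            from _ (_ , c , r)
          where
          coord : ∀ k → ◇ (∃ λ c → R (side i k) w c (b k) × (side i k ≡ false → C ∋ c) × Du x₀ c)
          coord k with side i k in eq
          ... | true = do
            (c , r , (_ , i)) ← back true v₀ v₀ w o ((λ ()) , du k)
            return (c , r , (λ ()) , i)
          ... | false = do
            (c , cc , r) ← to _ (h k eq)
            hc ← sub ss c cc
            i ← inside v₀ hc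
            return (c , r , (λ _ → cc) , i)
        strong′ : ∀ b → (∀ j → A₀ (b j)) → (∀ j → k ≤ toℕ j → C′ ∋ b j) → ◇ (C′ ∋ f b)
        strong′ b hb h = do
            rs ← all-◇ coord
            r ← R-preserved w (proj₁ ∘ rs) b (λ j → proj₁ (proj₂ (rs j)))
            c ← strong ss (proj₁ ∘ rs) (λ j → proj₁ (proj₂ (proj₂ (rs j)))) (λ j → proj₂ (proj₂ (proj₂ (rs j))))
            from _ (_ , c , r)
          where
          coord : ∀ j → ◇ (∃ λ c → R false w c (b j) × A₀ c × (k ≤ toℕ j → C ∋ c))
          coord j with k ≤? toℕ j
          ... | yes l = do
            (c , cc , r) ← to _ (h j l)
            hc ← sub ss c cc
            return (c , r , hc , λ _ → cc)
          ... | no ¬l = do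
            (c , hc , r) ← predecessor (w , o) (hb j)
            return (c , r , hc , λ l → ⊥-elim (¬l l))

      Step : ℕ → BSet → BSet → Set
      Step k C C′ = SS k C′ × ∃ λ w → Img (C ∋_) w ≈ (C′ ∋_)

      step-trans : ∀ {k} C C′ C″ → Step k C C′ → Step k C′ C″ → Step k C C″
      step-trans C C′ C″ (_ , w , e) (ss , w′ , e′) =
        ss , w · w′ , ≈-trans (≈-sym (Img-· w w′)) (≈-trans (Img-≈ w′ e) e′)

      -- The result is a sink with respect to the listed sets. If `D` is reachable from the sink
      -- found for the tail, the search is repeated from `D`; its result is then reachable from `D`
      -- by construction.
      climb : ∀ {k} (l : List BSet) C → SS k C →
              ◇ (∃ λ C′ → Step k C C′ × (∀ C″ → C″ ∈ˡ l → Step k C′ C″ → ◇ (Step k C″ C′)))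
      climb []       C ss = return (C , (ss , ε , Img-ε) , λ _ ())
      climb {k} (D ∷ l) C ss = do
        (C′ , st , max) ← climb l C ss
        em (Step k C′ D) >>= λ
          { (inj₂ none) → return (C′ , st , λ { _ (here refl) st′ → exfalso (none st′) ; C″ (there p) → max C″ p })
          ; (inj₁ st′) → do
              (C″ , st″ , max″) ← climb l D (proj₁ st′)
              return (C″ , step-trans C C′ C″ st (step-trans C′ D C″ st′ st″) ,
                      λ { _ (here refl) _ → return st″ ; E (there p) → max″ E p }) }

      -- Pushing all proper images into the strong set

      module Sink (k : ℕ) (C₀ : BSet) (ss : SS k C₀) (k<n : k < suc n)
                  (maximal : ∀ C → SS (suc k) C → Ans)
                  (sink : ∀ C → Step k C₀ C → ◇ (Step k C C₀)) where

        C : Fin d → Set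
        C = C₀ ∋_

        Return : Loop → Loop → Set
        Return w w′ = Img C (w · w′) ≈ C

        comeBack : ∀ w → Proper (Img C w) → ◇ (∃ (Return w))
        comeBack w pr = do
          (C′ , rep) ← represent (Img C w)
          ss′ ← image-SS ss w {C′} rep pr
          (_ , w′ , e) ← sink C′ (ss′ , w , rep)
          return (w′ , ≈-trans (≈-sym (Img-· w w′)) (≈-trans (Img-≈ w′ rep) e))

        ¬Proper⇒top : ∀ {Q} → (Proper Q → Ans) → A₀ ⊆ Q
        ¬Proper⇒top none a ha out = none (a , ha , out)

        compose : ∀ w w′ {a b c} → ⟦ w ⟧ a b → ⟦ w′ ⟧ b c → ⟦ w · w′ ⟧ a c
        compose (w , _) (w′ , _) r r′ = WR-++ _ _ w w′ _ _ (_ , r , r′)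

        -- Otherwise `rotate`, applied to Img C w, would push all of A₀ into C.
        z-proper : ∀ w z → Proper (Img C w) → Img C z ≈ C → ◇ (Proper (Img C (w · z)))
        z-proper w z pr ez = em (Proper (Img C (w · z))) >>= λ
          { (inj₁ p) → return p
          ; (inj₂ none) → do
              (w′ , e) ← comeBack w pr
              let top : A₀ ⊆ Img C (w · z)
                  top = ¬Proper⇒top none
                  loop : Img (Img C w) (w′ · z · w) ≈ Img C w
                  loop = ≈-trans (≈-sym (Img-· w′ (z · w)))
                           (≈-trans (Img-≈ (z · w) (≈-trans (Img-· w w′) e))
                             (≈-trans (≈-sym (Img-· z w)) (Img-≈ w ez)))
                  rot : Img (Img C w) (power ((z · w) · w′) (suc d)) ⊆ Img (Img C w) w′
                  rot = rotate (Img C w) w′ (z · w) (Img-A w (sub ss)) loop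
                  (b , hb , out) = proper ss
              (c₃ , h₃ , r₃) ← predecessor (power ((z · w) · w′) d) hb
              (c₂ , h₂ , r₂) ← predecessor w′ h₃
              (c₁ , h₁ , r₁) ← predecessor w h₂
              (y , cy , r₀) ← top c₁ h₁ >>= proj₂ (Img-· w z) c₁
              let r = compose ((z · w) · w′) (power ((z · w) · w′) d)
                        (compose (z · w) w′ (compose z w r₀ r₁) r₂) r₃
              cb ← rot b (y , cy , r) >>= proj₁ (Img-· w w′) b >>= proj₁ e b
              exfalso (out cb) }

        Pushes : Loop → BSet → Set
        Pushes z D = ∀ w → Img C w ≈ (D ∋_) → Proper (Img C w) → Img C (w · z) ⊆ C

        -- The sets `D` are treated one at a time. If `D` is the image `C + w`, then `z` is
        -- prolonged by a power `u` of `w + z + w′`, where `C + w + z + w′ = C`. By `rotate`, `u`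
        -- pushes `C + w + z` into `C`; since `C + u = C`, sets already pushed into `C` stay there.
        pusher : ∀ (l : List BSet) → ◇ (∃ λ z → Img C z ≈ C × (∀ D → D ∈ˡ l → Pushes z D))
        pusher [] = return (ε , Img-ε , λ _ ())
        pusher (D ∷ l) = do
            (z , ez , h) ← pusher l
            em (∃ λ w → Img C w ≈ (D ∋_) × Proper (Img C w)) >>= λ
              { (inj₂ none) → return (z , ez ,
                  λ { _ (here refl) w e pr _ _ → exfalso (none (w , e , pr)) ; D′ (there p) → h D′ p })
              ; (inj₁ (w , e , pr)) → do
                  pr₂ ← z-proper w z pr ez
                  (w′ , e′) ← comeBack (w · z) pr₂
                  return (extended z ez h w e w′ e′) }
          where
          extended : ∀ z → Img C z ≈ C → (∀ D → D ∈ˡ l → Pushes z D) →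
                     ∀ w → Img C w ≈ (D ∋_) → ∀ w′ → Return (w · z) w′ →
                     ∃ λ z → Img C z ≈ C × (∀ D′ → D′ ∈ˡ D ∷ l → Pushes z D′)
          extended z ez h w e w′ e′ =
              z · u
            , ≈-trans (≈-sym (Img-· z u)) (≈-trans (Img-≈ u ez) eu)
            , λ { _ (here refl) w₁ e₁ _ → ⊆-trans (proj₂ (Img-· w₁ (z · u)))
                    (⊆-trans (Img-⊆ (z · u) (⊆-trans (proj₁ e₁) (proj₂ e)))
                      (⊆-trans (proj₂ (Img-· z u)) (⊆-trans (Img-⊆ u (proj₁ (Img-· w z))) push)))
                ; D′ (there p) w₁ e₁ pr₁ → ⊆-trans (proj₂ (Img-· w₁ (z · u)))
                    (⊆-trans (proj₂ (Img-· z u)) (⊆-trans (Img-⊆ u (proj₁ (Img-· w₁ z)))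
                      (⊆-trans (Img-⊆ u (h D′ p w₁ e₁ pr₁)) (proj₁ eu)))) }
            where
            u : Loop
            u = power ((w · z) · w′) (suc d)
            eu : Img C u ≈ C
            eu = Img-power ((w · z) · w′) (suc d) e′
            push : Img (Img C (w · z)) u ⊆ C
            push = ⊆-trans (rotate (Img C (w · z)) w′ (w · z) (Img-A (w · z) (sub ss))
                              (≈-trans (≈-sym (Img-· w′ (w · z)))
                                       (Img-≈ (w · z) (≈-trans (Img-· (w · z) w′) e′))))
                           (⊆-trans (proj₁ (Img-· (w · z) w′)) (proj₁ e′))

        push-all : ◇ (∃ λ z → Img C z ≈ C × (∀ w → Proper (Img C w) → Img C (w · z) ⊆ C))
        push-all = do
          (z , ez , h) ← pusher (allVecs d)
          return (z , ez , λ w pr b r → represent (Img C w) >>= λ { (D , e) → h D (∈-allVecs D) w e pr b r })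

        -- Trees with leaves restricted to the strong set

        -- Tag 1 is reserved for leaves to be restricted to `C₀`; auxiliary leaves carry tag 0 and
        -- stay unmarked.
        Mark : Var → ℕ → Set
        Mark x τ = τ ≡ 1 × x ≡ x₀

        mark? : ∀ x τ → Dec (Mark x τ)
        mark? x τ with τ ℕ.≟ 1 | x ≟ x₀
        ... | yes p | yes q = yes (p , q)
        ... | no ¬p | _     = no (¬p ∘ proj₁)
        ... | _     | no ¬q = no (¬q ∘ proj₂)

        -- β = true: marked leaves take values in C₀.
        N : Bool → Bool → Sem L V
        N β σ = record
          { In = Du
          ; Lf = λ { {x} (inj₁ _ , _) a → σ ≡ false → a ≡ s x
                   ; {x} (inj₂ _ , τ) a → σ ≡ false → A x a ≡ true × (β ≡ true → Mark x τ → C₀ ∋ a) }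
          ; Jn = λ {x} _ a → J σ x a }

        N⇒base : ∀ {β x} (t : CT x) {a} → Rz (N β false) t a → Rz (base A false) t a
        N⇒base = Rz-map id (λ { (inj₁ _ , _) h → h ; (inj₂ _ , _) h p → proj₁ (h p) }) (λ _ → id)

        base⇒N : ∀ {x} (t : CT x) {a} → Rz (base A false) t a → Rz (N false false) t a
        base⇒N = Rz-map id (λ { (inj₁ _ , _) h → h ; (inj₂ _ , _) h p → h p , λ () }) (λ _ → id)

        free⇒N : ∀ {β σ x} (t : CT x) {a} → σ ≡ true → Rz (base A σ) t a → Rz (N β σ) t a
        free⇒N t refl = Rz-map id (λ { (inj₁ _ , _) _ () ; (inj₂ _ , _) _ () }) (λ _ → id) t

        N-free : ∀ β → Free (N β true)
        N-free β = record { In-f = id ; Lf-f = λ { (inj₁ _ , _) a () ; (inj₂ _ , _) a () } ; Jn-f = λ _ a () }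

        N-closed : ∀ i → Closed f pres (λ k → N true (side i k)) (N true false)
        N-closed i = record
          { In-c = λ _ a h → return (Du-f a h)
          ; Lf-c = λ { (inj₁ _ , _) a _ h → return (λ _ → s-absorbing i a h)
                     ; {x} (inj₂ v , τ) a du h → do
                         r ← absorbing v i a (λ k e → proj₁ (h k e)) du
                         c ← marked i a du (λ k e → proj₂ (h k e) refl) (mark? x τ)
                         return (λ _ → r , λ _ → c) }
          ; Jn-c = λ v a du h → absorbing v i a h du >>= λ r → return (λ _ → r) }
          where
          marked : ∀ {x τ} i a → (∀ k → Du x (a k)) → (∀ k → side i k ≡ false → Mark x τ → C₀ ∋ a k) →
                   Dec (Mark x τ) → ◇ (Mark x τ → C₀ ∋ f a)
          marked i a du h (no ¬m) = return (λ m → ⊥-elim (¬m m))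
          marked i a du h (yes m@(refl , refl)) = do
            c ← absb ss i a (λ k e → h k e m) du
            return (λ _ → c)

        -- The rest of a tree, seen from x: a path to the root x₀.  `inP` starts inside a small
        -- tree, with a pending side tree at x and a spine to the next junction.
        data Ctx (x : Var) : Set where
          atJ : V x → EWord x x₀ → Ctx x
          inP : ∀ {y} → Maybe (CT x) → Spine L V x y → V y → EWord y x₀ → Ctx x

        CR : Bool → ∀ {x} → Ctx x → Rel₂ d
        CR σ {x} (atJ v w)         b a = J σ x b × R σ w b a
        CR σ {x} (inP {y} o p v w) b a = OR (base A σ) o b × ∃ λ c → SR (base A σ) p b c × J σ y c × R σ w c a

        -- The summand 1 counts the junction at the end of the spine, so the sum is the number of
        -- leaves of the small tree through `x`.
        Fits : ∀ {x} → CT x → Ctx x → Set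
        Fits t (atJ v w)     = okJ t × okW w
        Fits t (inP o p v w) = ok t × okO o × okS p × okW w × lv t + olv o + sides p + 1 ≤ n

        -- Values at the end of the context for which the whole tree is realisable
        Set-of : ∀ {x} → CT x → Ctx x → Fin d → Set
        Set-of t κ a = ∃ λ b → Rz (N true false) t b × CR false κ b a

        count₂ : ∀ a b {x y} (p : Spine L V x y) → a + b + sides p + 1 ≤ n → suc (sides (revS p) + (a + b)) ≤ n
        count₂ a b p l rewrite sides-rev p = subst (_≤ n) (arith₁ a b (sides p)) l

        count₁ : ∀ {x y} (t : CT x) (p : Spine L V x y) → lv t + 0 + sides p + 1 ≤ n → suc (sides (revS p) + lv t) ≤ n
        count₁ t p l = subst (λ j → suc (sides (revS p) + j) ≤ n) (ℕ.+-identityʳ (lv t)) (count₂ (lv t) 0 p l)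

        -- The context is read from its far end: the word is walked backwards to its first junction,
        -- and arc-consistency there applies to the small tree rooted at that junction.
        ctx-arcs : ∀ σ {x} (t : CT x) (κ : Ctx x) → Fits t κ → ∀ {a} → G σ x₀ a →
                   ◇ (∃ λ b → Rz (base A σ) t b × CR σ κ b a)
        ctx-arcs σ t (atJ v w) (ot , ow) g = do
          (b , r , g′) ← back σ v v₀ w ow g
          rt ← arcs σ v t ot g′
          return (b , rt , proj₁ g′ , r)
        ctx-arcs σ t (inP nothing p v w) (ot , _ , op , ow , l) g = do
          (c , r , g′) ← back σ v v₀ w ow g
          rt ← arcs σ v (hang (revS p) t) (okJ-hang (revS p) t (okS-rev p op) ot (count₁ t p l)) g′
          let (b , u , rt′) = unhang (revS p) t rt
          return (b , rt′ , Rz-In t rt′ , c , SR-rev⁻ (base A σ) p (proj₂ g′) u , proj₁ g′ , r)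
        ctx-arcs σ t (inP (just o) p v w) (ot , oo , op , ow , l) g = do
          (c , r , g′) ← back σ v v₀ w ow g
          rt ← arcs σ v (hang (revS p) (join t o)) (okJ-hang (revS p) (join t o) (okS-rev p op) (ot , oo) (count₂ (lv t) (lv o) p l)) g′
          let (b , u , rt′ , ro) = unhang (revS p) (join t o) rt
          return (b , rt′ , ro , c , SR-rev⁻ (base A σ) p (proj₂ g′) u , proj₁ g′ , r)

        CR-end : ∀ {x} (κ : Ctx x) {b a} → Du x b → CR false κ b a → A₀ a
        CR-end (atJ v w) i (j , r) = proj₂ (WR-end (base A false) (J false) w i j r) refl
        CR-end (inP o p v w) i (_ , c , u , j , r) = proj₂ (WR-end (base A false) (J false) w (SR-In (base A false) p u) j r) refl

        CR-absorbs : ∀ {x} (κ : Ctx x) i a b → (∀ k → Du x (a k)) → (∀ k → CR (side i k) κ (a k) (b k)) → ◇ (CR false κ (f a) (f b))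
        CR-absorbs (atJ v w) i a b du h = do
          j ← absorbing v i a (proj₁ ∘ h) du
          r ← R-absorbs w i a b (proj₂ ∘ h)
          return ((λ _ → j) , r)
        CR-absorbs (inP o p v w) i a b du h = do
          ro ← OR-op f pres (base-closed i) o a (proj₁ ∘ h)
          u ← SR-op f pres (base-closed i) p a c (λ k → proj₁ (proj₂ (proj₂ (h k))))
          j ← absorbing v i c (λ k → proj₁ (proj₂ (proj₂ (proj₂ (h k)))))
                (λ k → SR-In (base A (side i k)) p (proj₁ (proj₂ (proj₂ (h k)))))
          r ← R-absorbs w i c b (λ k → proj₂ (proj₂ (proj₂ (proj₂ (h k)))))
          return (ro , f c , u , (λ _ → j) , r)
          where
          c : Fin (suc n) → Fin d
          c k = proj₁ (proj₂ (h k))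

        CR-loosen : ∀ σ {x} (κ : Ctx x) {b a} → CR false κ b a → CR σ κ b a
        CR-loosen false κ r = r
        CR-loosen true (atJ v w) (_ , r) = (λ ()) , R⊑ w _ _ r
        CR-loosen true (inP o p v w) (ro , c , u , _ , r) =
          OR-map id (λ { (inj₁ _ , _) _ () ; (inj₂ _ , _) _ () }) (λ _ _ ()) o ro , c ,
          SR-map id (λ { (inj₁ _ , _) _ () ; (inj₂ _ , _) _ () }) (λ _ _ ()) p u , (λ ()) , R⊑ w _ _ r

        data Extent (Q : Fin d → Set) : Set where
          top   : A₀ ⊆ Q → Extent Q
          small : ∀ w → Proper (Img C w) → Q ⊆ Img C w → Extent Q

        extent-map : ∀ {Q Q′} → Q ⊆ Q′ → (A₀ ⊆ Q′ → A₀ ⊆ Q) → Extent Q′ → Extent Q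
        extent-map p q (top t)        = top (q t)
        extent-map p q (small w pr h) = small w pr (⊆-trans p h)

        enterE : ∀ {x y} → Edge x y → Ctx x → Ctx y
        enterE e (atJ v w)     = inP nothing (last (rev e)) v w
        enterE e (inP o p v w) = inP nothing (next (rev e) o p) v w

        fits-enterE : ∀ {x y} (e : Edge x y) (t : CT y) κ → Fits (edge e t) κ → Fits t (enterE e κ)
        fits-enterE e t (atJ v w) ((ot , l) , ow) = ot , tt , tt , ow , subst (_≤ n) (arith₂ (lv t)) l
        fits-enterE e t (inP o p v w) (ot , oo , op , ow , l) =
          ot , tt , (oo , op) , ow , subst (_≤ n) (arith₃ (lv t) (olv o) (sides p)) l

        enterE-CR : ∀ {x y} (e : Edge x y) (t : CT y) κ {a} → Set-of (edge e t) κ a → Set-of t (enterE e κ) a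
        enterE-CR e t (atJ v w) (b , (i , c , bc , r) , j , r′) =
          c , r , Rz-In t r , b , (⟪rev⟫ e bc , i) , j , r′
        enterE-CR e t (inP o p v w) (b , (i , c , bc , r) , ro , u) =
          c , r , Rz-In t r , proj₁ u , (b , ⟪rev⟫ e bc , ro , proj₁ (proj₂ u)) , proj₂ (proj₂ u)

        exitE-CR : ∀ {x y} (e : Edge x y) (t : CT y) κ {a} → Set-of t (enterE e κ) a → Set-of (edge e t) κ a
        exitE-CR e t (atJ v w) (c , r , _ , b , (cb , i) , j , r′) = b , (i , c , ⟪rev⁻⟫ e cb , r) , j , r′
        exitE-CR e t (inP o p v w) (c , r , _ , c′ , (b , cb , ro , u) , j , r′) =
          b , (OR-In (base A false) o ro , c , ⟪rev⁻⟫ e cb , r) , ro , c′ , u , j , r′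

        -- The pending side tree is forgotten. The bound survives because `t` has at least one leaf,
        -- which pays for the end of the spine at `x`.
        word-of : ∀ {x} (κ : Ctx x) (t : CT x) → Fits t κ → EWord x x₀
        word-of (atJ v w)     t _ = w
        word-of (inP o p v w) t (_ , _ , _ , _ , l) = cons p (ℕ.≤-trans (ℕ.≤-reflexive (arith₄ (sides p))) (ℕ.≤-trans bound l)) v w
          where
          bound : 1 + 0 + sides p + 1 ≤ lv t + olv o + sides p + 1
          bound = ℕ.+-monoˡ-≤ 1 (ℕ.+-monoˡ-≤ (sides p) (ℕ.+-mono-≤ (lv≥1 t) z≤n))

        word-of-ok : ∀ {x} (κ : Ctx x) (t : CT x) (φ : Fits t κ) → okW (word-of κ t φ)
        word-of-ok (atJ v w)     t (_ , ow) = ow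
        word-of-ok (inP o p v w) t (_ , _ , op , ow , _) = op , ow

        CR⇒word : ∀ {x} (κ : Ctx x) (t : CT x) (φ : Fits t κ) {b a} → CR false κ b a → R false (word-of κ t φ) b a
        CR⇒word (atJ v w)     t _ (_ , r) = r
        CR⇒word (inP o p v w) t _ (_ , r) = r

        -- The pending side tree at a junction can always be realised.
        word⇒CR : ∀ {x} → V x → ∀ (κ : Ctx x) (t : CT x) (φ : Fits t κ) {b a} → A x b ≡ true →
                  R false (word-of κ t φ) b a → ◇ (CR false κ b a)
        word⇒CR v (atJ _ w)            t _ h r = return ((λ _ → h) , r)
        word⇒CR v (inP nothing p _ w)  t _ h r = inside v h >>= λ i → return (i , r)
        word⇒CR v (inP (just o) p _ w) t (ot , oo , op , ow , l) h r = do
          ro ← arc v o (ok⇒okJ o oo (ℕ.≤-trans lemma l)) h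
          return (ro , r)
          where
          lemma : suc (lv o) ≤ lv t + lv o + sides p + 1
          lemma = ℕ.≤-trans (ℕ.+-monoˡ-≤ (lv o) (lv≥1 t)) (ℕ.≤-trans (ℕ.m≤m+n _ (sides p)) (ℕ.m≤m+n _ 1))

        besides : ∀ {x} → CT x → Ctx x → Ctx x
        besides u (atJ v w)            = atJ v w
        besides u (inP nothing p v w)  = inP (just u) p v w
        besides u (inP (just o) p v w) = inP (just (join u o)) p v w

        fits-besides : ∀ {x} (t u : CT x) κ → Fits (join t u) κ → Fits t (besides u κ)
        fits-besides t u (atJ v w) ((ot , ou) , ow) = ot , ow
        fits-besides t u (inP nothing p v w) ((ot , ou) , _ , op , ow , l) =
          ot , ou , op , ow , subst (λ j → j + sides p + 1 ≤ n) (ℕ.+-identityʳ (lv t + lv u)) l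
        fits-besides t u (inP (just o) p v w) ((ot , ou) , oo , op , ow , l) =
          ot , (ou , oo) , op , ow , subst (λ j → j + sides p + 1 ≤ n) (ℕ.+-assoc (lv t) (lv u) (lv o)) l

        fits-swap : ∀ {x} (t u : CT x) κ → Fits (join t u) κ → Fits (join u t) κ
        fits-swap t u (atJ v w) ((ot , ou) , ow) = (ou , ot) , ow
        fits-swap t u (inP o p v w) ((ot , ou) , oo , op , ow , l) =
          (ou , ot) , oo , op , ow , subst (λ j → j + olv o + sides p + 1 ≤ n) (ℕ.+-comm (lv t) (lv u)) l

        besides-CR : ∀ {x} (u : CT x) κ {b a} → Rz (base A false) u b → CR false κ b a → CR false (besides u κ) b a
        besides-CR u (atJ v w)            r c = c
        besides-CR u (inP nothing p v w)  r (_ , c) = r , c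
        besides-CR u (inP (just o) p v w) r (ro , c) = (r , ro) , c

        besides-CR⁻ : ∀ {x} (t u : CT x) κ → Fits (join t u) κ → ∀ {b a} → CR false (besides u κ) b a →
                      ◇ (Rz (base A false) u b × CR false κ b a)
        besides-CR⁻ t u (atJ v w) ((_ , ou) , _) (j , r) = arc v u ou (j refl) >>= λ ru → return (ru , j , r)
        besides-CR⁻ t u (inP nothing p v w)  _ (ru , c) = return (ru , Rz-In u ru , c)
        besides-CR⁻ t u (inP (just o) p v w) _ ((ru , ro) , c) = return (ru , ro , c)

        -- Both halves of a tree leave the root unrestricted.  If the whole tree does not,
        -- its set of root values is (k+1)-strong: entries below k are realised without the
        -- marks of t₁, entry k without the marks of t₂.
        module Join {x} (t₁ t₂ : CT x) (κ : Ctx x) (φ : Fits (join t₁ t₂) κ)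
          (top₁ : A₀ ⊆ (λ a → ∃ λ b → Rz (N true false) t₁ b × Rz (N false false) t₂ b × CR false κ b a))
          (top₂ : A₀ ⊆ (λ a → ∃ λ b → Rz (N false false) t₁ b × Rz (N true false) t₂ b × CR false κ b a)) where

          Q : Fin d → Set
          Q = Set-of (join t₁ t₂) κ

          early late : Fin (suc n) → Bool
          early j = does (k ≤? toℕ j)
          late  j = not (does (toℕ j ℕ.≟ k))

          -- Marks are missing only at positions below `k`, which is what k-strength permits. For
          -- the other restrictions every argument is in the smaller set.
          closed₁ : Closed f pres (λ j → N (early j) false) (N true false)
          closed₁ = record
            { In-c = λ _ a h → return (Du-f a h)
            ; Lf-c = λ { (inj₁ _ , _) a _ h → return (λ _ → nu a zero _ λ j _ → h j refl)
                       ; {x} (inj₂ v , τ) a du h → do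
                           r ← absorbing v zero a (λ j _ → proj₁ (h j refl)) du
                           c ← marked a (λ j → proj₁ (h j refl)) (λ j → proj₂ (h j refl)) (mark? x τ)
                           return (λ _ → r , λ _ → c) }
            ; Jn-c = λ v a du h → absorbing v zero a (λ j _ → h j refl) du >>= λ r → return (λ _ → r) }
            where
            marked : ∀ {x τ} a → (∀ j → A x (a j) ≡ true) → (∀ j → early j ≡ true → Mark x τ → C₀ ∋ a j) →
                     Dec (Mark x τ) → ◇ (Mark x τ → C₀ ∋ f a)
            marked a ha h (no ¬m) = return (λ m → ⊥-elim (¬m m))
            marked a ha h (yes m@(refl , refl)) =
              strong ss a ha (λ j l → h j (dec-true (k ≤? toℕ j) l) m) >>= λ c → return (λ _ → c)

          at-k : Fin (suc n)
          at-k = fromℕ< k<n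

          -- Marks are missing at the single position `k`, so it is enough that `C₀` absorbs.
          closed₂ : Closed f pres (λ j → N (late j) false) (N true false)
          closed₂ = record
            { In-c = λ _ a h → return (Du-f a h)
            ; Lf-c = λ { (inj₁ _ , _) a _ h → return (λ _ → nu a zero _ λ j _ → h j refl)
                       ; {x} (inj₂ v , τ) a du h → do
                           r ← absorbing v zero a (λ j _ → proj₁ (h j refl)) du
                           c ← marked a du (λ j → proj₂ (h j refl)) (mark? x τ)
                           return (λ _ → r , λ _ → c) }
            ; Jn-c = λ v a du h → absorbing v zero a (λ j _ → h j refl) du >>= λ r → return (λ _ → r) }
            where
            off : ∀ j → side at-k j ≡ false → late j ≡ true
            off j eq = cong not (dec-false (toℕ j ℕ.≟ k) λ e → false≢true
                         (trans (sym eq) (dec-true (j ≟ at-k) (toℕ-injective (trans e (sym (toℕ-fromℕ< k<n)))))))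
              where
              false≢true : false ≢ true
              false≢true ()
            marked : ∀ {x τ} a → (∀ j → Du x (a j)) → (∀ j → late j ≡ true → Mark x τ → C₀ ∋ a j) →
                     Dec (Mark x τ) → ◇ (Mark x τ → C₀ ∋ f a)
            marked a du h (no ¬m) = return (λ m → ⊥-elim (¬m m))
            marked a du h (yes m@(refl , refl)) =
              absb ss at-k a (λ j eq → h j (off j eq) m) du >>= λ c → return (λ _ → c)

          Q⊆A : Q ⊆ A₀
          Q⊆A a (b , r , c) = return (CR-end κ (Rz-In (join t₁ t₂) r) c)

          stronger : ∀ {D} → Q ≈ (D ∋_) → ∃ Q → Proper Q → ◇ (SS (suc k) D)
          stronger {D} (from , to) (a , q) (a′ , ha′ , out) = do
              a∈ ← from a q
              return record
                { sub = ⊆-trans to Q⊆A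
                ; some = a , a∈
                ; proper = a′ , ha′ , λ p → to a′ p out
                ; absb = absb′
                ; strong = strong′ }
            where
            absb′ : Absorbing x₀ (lookup D)
            absb′ i a h du = do
                rs ← all-◇ coord
                r ← Rz-op f pres (N-closed i) (join t₁ t₂) (proj₁ ∘ rs) (λ j → proj₁ (proj₂ (rs j)))
                c ← CR-absorbs κ i (proj₁ ∘ rs) a (λ j → Rz-In (join t₁ t₂) (proj₁ (proj₂ (rs j)))) (λ j → proj₂ (proj₂ (rs j)))
                from _ (_ , r , c)
              where
              coord : ∀ j → ◇ (∃ λ b → Rz (N true (side i j)) (join t₁ t₂) b × CR (side i j) κ b (a j))
              coord j with side i j in eq
              ... | true = do
                (b , r , c) ← ctx-arcs true (join t₁ t₂) κ φ ((λ ()) , du j)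
                return (b , free⇒N (join t₁ t₂) refl r , c)
              ... | false = to _ (h j eq)
            strong′ : ∀ a → (∀ j → A₀ (a j)) → (∀ j → suc k ≤ toℕ j → D ∋ a j) → ◇ (D ∋ f a)
            strong′ a ha h = do
                rs ← all-◇ coord
                r₁ ← Rz-op f pres closed₁ t₁ (proj₁ ∘ rs) (λ j → proj₁ (proj₂ (rs j)))
                r₂ ← Rz-op f pres closed₂ t₂ (proj₁ ∘ rs) (λ j → proj₁ (proj₂ (proj₂ (rs j))))
                c ← CR-absorbs κ zero (proj₁ ∘ rs) a (λ j → Rz-In t₁ (proj₁ (proj₂ (rs j))))
                      (λ j → CR-loosen (side zero j) κ (proj₂ (proj₂ (proj₂ (rs j)))))
                from _ (_ , (r₁ , r₂) , c)
              where
              coord : ∀ j → ◇ (∃ λ b → Rz (N (early j) false) t₁ b × Rz (N (late j) false) t₂ b × CR false κ b (a j))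
              coord j with ℕ.<-cmp (toℕ j) k
              ... | tri< j<k j≢k _ rewrite dec-false (k ≤? toℕ j) (ℕ.<⇒≱ j<k) | dec-false (toℕ j ℕ.≟ k) j≢k = top₂ _ (ha j)
              ... | tri≈ _ j≡k _ rewrite dec-true (k ≤? toℕ j) (ℕ.≤-reflexive (sym j≡k)) | dec-true (toℕ j ℕ.≟ k) j≡k = top₁ _ (ha j)
              ... | tri> _ j≢k k<j rewrite dec-true (k ≤? toℕ j) (ℕ.<⇒≤ k<j) | dec-false (toℕ j ℕ.≟ k) j≢k = do
                (b , (r₁ , r₂) , c) ← to _ (h j k<j)
                return (b , r₁ , r₂ , c)

          full : ∃ Q → A₀ ⊆ Q
          full ne = ¬Proper⇒top λ pr → represent Q λ { (D , e) → stronger e ne pr (maximal D) }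

        -- Recursion on `t`, moving everything else into the context. A marked leaf yields the image
        -- of `C` along the word of its context, an unmarked one no restriction. At a `join` one
        -- small half makes the whole small; two full halves are the case of `Join`.
        extent : ∀ {x} (t : CT x) (κ : Ctx x) → Fits t κ → ∃ (Set-of t κ) → ◇ (Extent (Set-of t κ))
        extent (leaf (inj₁ p , τ)) κ φ _ = return (top λ a ha → do
          g ← A⇒G v₀ ha
          (b , r , c) ← ctx-arcs false (leaf (inj₁ p , τ)) κ φ g
          return (b , r , c))
        extent {x} t@(leaf (inj₂ v , τ)) κ φ _ with mark? x τ
        ... | no ¬m = return (top λ a ha → do
          g ← A⇒G v₀ ha
          (b , (i , h) , c) ← ctx-arcs false t κ φ g
          return (b , (i , λ e → h e , λ _ m → ⊥-elim (¬m m)) , c))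
        ... | yes m@(refl , refl) = em (Proper (Img C w)) >>= λ
          { (inj₁ pr) → return (small w pr λ { a (b , (i , h) , c) →
              return (b , proj₂ (h refl) refl m , CR⇒word κ t φ c) })
          ; (inj₂ none) → return (top λ a ha → do
              (b , cb , r) ← ¬Proper⇒top none a ha
              hb ← sub ss b cb
              i ← inside v hb
              c ← word⇒CR v κ t φ hb r
              return (b , (i , λ _ → hb , λ _ _ → cb) , c)) }
          where
          w : Loop
          w = word-of κ t φ , word-of-ok κ t φ
        extent (edge e t) κ φ (a , q) = do
          r ← extent t (enterE e κ) (fits-enterE e t κ φ) (a , enterE-CR e t κ q)
          return (extent-map (λ a q → return (enterE-CR e t κ q)) (λ h a ha → h a ha >>= λ q → return (exitE-CR e t κ q)) r)
        -- At the junction the context collapses to its word. A pending side tree is realised anew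
        -- by `word⇒CR`, as the value at the junction lies in the domain.
        extent t′@(junc v t) κ φ (a , b , (j , r) , c) = do
            e ← extent t κ′ φ′ (a , b , r , j , CR⇒word κ t′ φ c)
            return (extent-map (λ { a (b , (j , r) , c) → return (b , r , j , CR⇒word κ t′ φ c) })
                               (λ h a ha → h a ha >>= λ { (b , r , j , w) →
                                  word⇒CR v κ t′ φ (j refl) w >>= λ c → return (b , (j , r) , c) }) e)
          where
          κ′ = atJ v (word-of κ t′ φ)
          inner-ok : ∀ κ → Fits t′ κ → okJ t
          inner-ok (atJ _ _) (o , _) = o
          inner-ok (inP _ _ _ _) (o , _) = o
          φ′ : Fits t κ′
          φ′ = inner-ok κ φ , word-of-ok κ t′ φ
        extent (join t₁ t₂) κ φ (a , q) = do
            e₁ ← extent t₁ (besides t₂ κ) (fits-besides t₁ t₂ κ φ) (a , left q)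
            e₂ ← extent t₂ (besides t₁ κ) (fits-besides t₂ t₁ κ φ′) (a , right q)
            return (both e₁ e₂)
          where
          φ′ = fits-swap t₁ t₂ κ φ
          left : ∀ {a} → Set-of (join t₁ t₂) κ a → Set-of t₁ (besides t₂ κ) a
          left (b , (r₁ , r₂) , c) = b , r₁ , besides-CR t₂ κ (N⇒base t₂ r₂) c
          right : ∀ {a} → Set-of (join t₁ t₂) κ a → Set-of t₂ (besides t₁ κ) a
          right (b , (r₁ , r₂) , c) = b , r₂ , besides-CR t₁ κ (N⇒base t₁ r₁) c
          both : Extent (Set-of t₁ (besides t₂ κ)) → Extent (Set-of t₂ (besides t₁ κ)) → Extent (Set-of (join t₁ t₂) κ)
          both (small w pr h) _ = small w pr λ a q → h a (left q)
          both (top _) (small w pr h) = small w pr λ a q → h a (right q)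
          both (top h₁) (top h₂) = top (Join.full t₁ t₂ κ φ
            (λ a ha → h₁ a ha >>= λ { (b , r₁ , c) → besides-CR⁻ t₁ t₂ κ φ c >>= λ { (r₂ , c′) → return (b , r₁ , base⇒N t₂ r₂ , c′) } })
            (λ a ha → h₂ a ha >>= λ { (b , r₂ , c) → besides-CR⁻ t₂ t₁ κ φ′ c >>= λ { (r₁ , c′) → return (b , base⇒N t₁ r₁ , r₂ , c′) } })
            (a , q))

        # : ∀ {x} → CT x → ℕ
        # (leaf (inj₁ _ , _)) = 0
        # {x} (leaf (inj₂ _ , τ)) = if does (mark? x τ) then 1 else 0
        # (edge _ t)   = # t
        # (join t₁ t₂) = # t₁ + # t₂
        # (junc _ t)   = # t

        #-mark : ∀ {x τ} (v : V x) → Mark x τ → # (leaf (inj₂ v , τ)) ≡ 1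
        #-mark {x} {τ} v m = cong (λ b → if b then 1 else 0) (dec-true (mark? x τ) m)

        unmarked-N : ∀ {x} (t : CT x) → # t ≡ 0 → ∀ {a} → Rz (base A false) t a → Rz (N true false) t a
        unmarked-N (leaf (inj₁ _ , _)) eq (i , h) = i , h
        unmarked-N {x} (leaf (inj₂ _ , τ)) eq (i , h) with mark? x τ
        ... | no ¬m = i , λ e → h e , λ _ m → ⊥-elim (¬m m)
        unmarked-N (edge e t) eq (i , b , ab , r) = i , b , ab , unmarked-N t eq r
        unmarked-N (join t₁ t₂) eq (r₁ , r₂) =
          unmarked-N t₁ (ℕ.m+n≡0⇒m≡0 (# t₁) eq) r₁ , unmarked-N t₂ (ℕ.m+n≡0⇒n≡0 (# t₁) eq) r₂
        unmarked-N (junc _ t) eq (j , r) = j , unmarked-N t eq r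

        #-downE : ∀ {x y} (e : Edge x y) {t : CT y} {c : CT x} (π : Pair (edge e t) c) → # (downE e π) ≡ # c
        #-downE e (inner _ _ _) = refl
        #-downE e (junct _ _ _) = refl

        record Rerooted {x} (t c : CT x) : Set where
          field
            tree  : CT x₀
            fine  : okJ tree
            fewer : suc (# tree) ≡ # t + # c
            back⁻ : ∀ {b} → A₀ b → C₀ ∋ b → Rz (N true false) tree b →
                    ∃ λ a → Rz (N true false) t a × Rz (N true false) c a
        open Rerooted

        -- The root moves to a marked leaf, which is then deleted: a root value in `C₀` takes over
        -- its role, and one mark fewer remains.
        reroot : ∀ {x} (t c : CT x) → Pair t c → 1 ≤ # t → Rerooted t c
        reroot {x} (leaf (inj₂ v , τ)) c π l with mark? x τ
        ... | yes m@(refl , refl) = record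
          { tree = c ; fine = proj₂ (pair-okJ π) ; fewer = cong (_+ # c) (sym (#-mark v m))
          ; back⁻ = λ h cb r → _ , (Rz-In c r , λ _ → h , λ _ _ → cb) , r }
        reroot (edge e t) c π l = record
            { tree = tree R′ ; fine = fine R′ ; fewer = trans (fewer R′) (cong (# t +_) (#-downE e π))
            ; back⁻ = λ h cb r → let (_ , r₁ , r₂) = back⁻ R′ h cb r in upE e π {S = N true false} r₁ r₂ }
          where R′ = reroot t (downE e π) (pair-downE e π) l
        reroot (join t₁ t₂) c π l with 1 ≤? # t₁
        ... | yes l₁ = record
            { tree = tree R′ ; fine = fine R′ ; fewer = trans (fewer R′) (sym (ℕ.+-assoc (# t₁) (# t₂) (# c)))
            ; back⁻ = λ h cb r → let (a , r₁ , r₂ , r₃) = back⁻ R′ h cb r in a , (r₁ , r₂) , r₃ }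
          where R′ = reroot t₁ (join t₂ c) (pair-joinˡ π) l₁
        ... | no ¬l = record
            { tree = tree R′ ; fine = fine R′
            ; fewer = trans (fewer R′) (arith₅ (# t₁) (# t₂) (# c))
            ; back⁻ = λ h cb r → let (a , r₂ , r₁ , r₃) = back⁻ R′ h cb r in a , (r₁ , r₂) , r₃ }
          where R′ = reroot t₂ (join t₁ c) (pair-joinˡ (pair-swap π)) (subst (λ j → 1 ≤ j + # t₂) (ℕ.n<1⇒n≡0 (ℕ.≰⇒> ¬l)) l)
        reroot (junc v t) c π l = record
            { tree = tree R′ ; fine = fine R′ ; fewer = fewer R′
            ; back⁻ = λ h cb r → let (a , r₁ , j , r₂) = back⁻ R′ h cb r in a , (j , r₁) , r₂ }
          where R′ = reroot t (junc v c) (pair-junc π) l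

        module _ (z : Loop) (Cz : Img C z ≈ C) (push : ∀ w → Proper (Img C w) → Img C (w · z) ⊆ C) where

          -- The root set of t, prolonged by the reverse of z, is full or inside a proper image of C;
          -- both are pushed into C by z.
          hit : ∀ (t : CT x₀) → okJ t → (∃ λ b → A₀ b × Rz (N true false) t b) → ◇ (∃ λ b → C₀ ∋ b × Rz (N true false) t b)
          hit t o (b₀ , h₀ , r₀) = do
              g ← A⇒G v₀ h₀
              (a₀ , u , _) ← forth false v₀ z⁻ oz g
              e ← extent t κ (o , oz) (a₀ , b₀ , r₀ , (λ _ → h₀) , u)
              conclude g u e
            where
            z⁻ = revW v₀ (proj₁ z)
            oz = okW-rev v₀ (proj₁ z) (proj₂ z)
            κ = atJ v₀ z⁻
            unrev : ∀ {a b} → G false x₀ b → R false z⁻ b a → ⟦ z ⟧ a b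
            unrev (j , i) = WR-rev⁻ (base A false) (J false) v₀ (proj₁ z) i j
            conclude : ∀ {a₀} → G false x₀ b₀ → R false z⁻ b₀ a₀ → Extent (Set-of t κ) → ◇ (∃ λ b → C₀ ∋ b × Rz (N true false) t b)
            conclude g u (top full) = do
              let (c , cc) = some ss
              hc ← sub ss c cc
              (b , r , j , w) ← full c hc
              cb ← proj₁ Cz b (c , cc , unrev (j , Rz-In t r) w)
              return (b , cb , r)
            conclude g u (small w pr into) = do
              q ← into _ (b₀ , r₀ , (λ _ → h₀) , u)
              m ← proj₁ (Img-· w z) b₀ (_ , q , unrev g u)
              cb ← push w pr b₀ m
              return (b₀ , cb , r₀)

          -- Induction on the number of marks. One marked leaf is made the root, the remaining tree
          -- is realised by induction, and `hit` moves its root value into `C₀`.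
          N-real : ∀ k {x} → V x → ∀ (t : CT x) → okJ t → # t ≤ k → ◇ (∃ λ a → Rz (N true false) t a)
          N-real k v t o l with # t ℕ.≟ 0
          ... | yes eq = do
            (a , h) ← nonempty v
            r ← arc v t o h
            return (a , unmarked-N t eq r)
          N-real zero v t o l | no ne = ⊥-elim (ne (ℕ.n≤0⇒n≡0 l))
          N-real (suc k) v t o l | no ne = do
              -- The junction placed on top forces the root value into the domain of `x₀`, as `hit`
              -- requires.
              (b₀ , j , r₀) ← N-real k v₀ (junc v₀ (tree R′)) (fine R′) (ℕ.≤-pred (subst (_≤ suc k) (sym count≡) l))
              (b , cb , r) ← hit (tree R′) (fine R′) (b₀ , j refl , r₀)
              h ← sub ss b cb
              return (let (a , r₁ , _) = back⁻ R′ h cb r in a , r₁)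
            where
            R′ : Rerooted t (leaf (inj₂ v , 0))
            R′ = reroot t (leaf (inj₂ v , 0)) (junct v o tt) (ℕ.n≢0⇒n>0 ne)
            count≡ : suc (# (tree R′)) ≡ # t
            count≡ = trans (fewer R′) (ℕ.+-identityʳ (# t))

          smaller : ◇ (∃ λ A′ → AAS A′ × (∀ x a → V x → A′ x a ≡ true → ◇ (A x a ≡ true)) × (∃ λ a → A₀ a × (A′ x₀ a ≡ true → Ans)))
          smaller = do
            (A′ , aas′ , h) ← Closure.closure (N true) 0 (N-free true) N-closed id (λ p l → l refl) (λ v t o → N-real _ v t o ℕ.≤-refl)
            let (a , ha , out) = proper ss
            return (A′ , aas′
                   , (λ x a v e → h x a v (leaf (inj₂ v , 0)) tt e >>= λ { (_ , l) → return (proj₁ (l refl)) })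
                   -- The tree consisting of one marked leaf excludes the value `a`, which is not in
                   -- `C₀`.
                   , a , ha , λ e → h x₀ a v₀ (leaf (inj₂ v₀ , 1)) tt e λ { (_ , l) → out (proj₂ (l refl) refl (refl , refl)) })

      shrink : ∀ {a b} → A₀ a → A₀ b → a ≢ b →
               ◇ (∃ λ A′ → AAS A′ × (∀ x a → V x → A′ x a ≡ true → ◇ (A x a ≡ true)) × (∃ λ a → A₀ a × (A′ x₀ a ≡ true → Ans)))
      shrink ha hb a≢b = do
        (k , C , ss , k<n , maximal) ← strongest n 1 (ℕ.+-comm n 1) _ (sing-SS ha hb a≢b)
        (C₀ , (ss₀ , _) , sink) ← climb (allVecs d) C ss
        let open Sink k C₀ ss₀ k<n maximal (λ D → sink D (∈-allVecs D))
        (z , Cz , push) ← push-all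
        smaller z Cz push

  -- Shrinking the domains to singletons

  module Solve (V? : ∀ x → Dec (V x)) where

    weight : Domains → ℕ
    weight A = sumF λ x → if does (V? x) then count (A x) else 0

    Singletons : Domains → Set
    Singletons A = ∀ x a b → V x → A x a ≡ true → A x b ≡ true → a ≡ b

    -- Comparing weights requires the inclusion without the modality below its quantifiers. These
    -- are finite, `V` is decidable and membership is a bit, so the modality can be moved outside.
    pure-⊆ : ∀ (A A′ : Domains) → (∀ x a → V x → A′ x a ≡ true → ◇ (A x a ≡ true)) →
             ◇ (∀ x a → V x → A′ x a ≡ true → A x a ≡ true)
    pure-⊆ A A′ h = all-◇ λ x → all-◇ λ a → point x a
      where
      point : ∀ x a → ◇ (V x → A′ x a ≡ true → A x a ≡ true)
      point x a with V? x | A′ x a in eq′ | A x a in eq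
      ... | no ¬v | _     | _     = return λ v → ⊥-elim (¬v v)
      ... | yes v | false | _     = return λ _ ()
      ... | yes v | true  | true  = return λ _ _ → refl
      ... | yes v | true  | false = do
        r ← h x a v eq′
        ⊥-elim (true≢false (trans (sym r) eq))
        where
        true≢false : true ≢ false
        true≢false ()

    lighter : ∀ (A A′ : Domains) → (∀ x a → V x → A′ x a ≡ true → A x a ≡ true) →
              ∀ {x₀ a} → V x₀ → A x₀ a ≡ true → A′ x₀ a ≡ false → weight A′ < weight A
    lighter A A′ h {x₀} {a} v₀ p q = sumF-strict _ _ le x₀ lt
      where
      le : ∀ x → (if does (V? x) then count (A′ x) else 0) ≤ (if does (V? x) then count (A x) else 0)
      le x with V? x
      ... | yes v = count-mono _ _ (λ a → h x a v)
      ... | no _  = z≤n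
      lt : (if does (V? x₀) then count (A′ x₀) else 0) < (if does (V? x₀) then count (A x₀) else 0)
      lt with V? x₀
      ... | yes v = count-strict _ _ (λ a → h x₀ a v) a q p
      ... | no ¬v = ⊥-elim (¬v v₀)

    Splits : Domains → Var → Set
    Splits A x = Σ (V x) λ _ → ∃ λ a → ∃ λ b → A x a ≡ true × A x b ≡ true × a ≢ b

    pure-single : ∀ A → (∃ (Splits A) → Ans) → ◇ (Singletons A)
    pure-single A none = all-◇ λ x → all-◇ λ a → all-◇ λ b → point x a b
      where
      point : ∀ x a b → ◇ (V x → A x a ≡ true → A x b ≡ true → a ≡ b)
      point x a b with a ≟ b | V? x | A x a in p | A x b in q
      ... | yes e | _     | _     | _     = return λ _ _ _ → e
      ... | no _  | no ¬v | _     | _     = return λ v → ⊥-elim (¬v v)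
      ... | no _  | yes _ | false | _     = return λ _ ()
      ... | no _  | yes _ | true  | false = return λ _ _ ()
      ... | no ne | yes v | true  | true  = exfalso (none (x , v , a , b , p , q , ne))

    singletons : ∀ k A → AAS A → weight A ≤ k → ◇ (∃ λ A → AAS A × Singletons A)
    singletons k A aas l = em (∃ (Splits A)) >>= λ
      { (inj₂ none) → do
          sg ← pure-single A none
          return (A , aas , sg)
      ; (inj₁ (x , v , a , b , p , q , ne)) → do
          (A′ , aas′ , sub , c , hc , out) ← Walks.Shrink.shrink A aas v p q ne
          sub′ ← pure-⊆ A A′ sub
          continue k A′ aas′ l (λ e → lighter A A′ sub′ v hc e) (A′ x c) refl out }
      where
      -- `out` refutes the removed value only into `Ans`, so the bit itself is inspected: if it is
      -- `true`, the answer is at hand, and if `false`, the weight has dropped.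
      continue : ∀ k A′ → AAS A′ → weight A ≤ k → ∀ {x c} → (A′ x c ≡ false → weight A′ < weight A) →
                 ∀ b → A′ x c ≡ b → (A′ x c ≡ true → Ans) → ◇ (∃ λ A → AAS A × Singletons A)
      continue k A′ aas′ l less true  eq out = exfalso (out eq)
      continue zero A′ aas′ l less false eq out with () ← ℕ.<-≤-trans (less eq) l
      continue (suc k) A′ aas′ l less false eq out = singletons k A′ aas′ (ℕ.≤-pred (ℕ.<-≤-trans (less eq) l))

    -- Extending the assignment and the invariant

    P′ : Var → Set
    P′ x = P x ⊎ V x

    PTree′ : Var → Set
    PTree′ = Tree P′ (λ _ → ⊥)

    prescribed′ : (Var → Fin d) → Sem P′ (λ _ → ⊥)
    prescribed′ s′ = record { In = Du ; Lf = λ {x} _ a → a ≡ s′ x ; Jn = λ () }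

    toCT : ∀ {x} → PTree′ x → CT x
    toCT (leaf l)     = leaf (l , 0)
    toCT (edge e t)   = edge e (toCT t)
    toCT (join t₁ t₂) = join (toCT t₁) (toCT t₂)

    ok-toCT : ∀ {x} (t : PTree′ x) → ok (toCT t)
    ok-toCT (leaf _)     = tt
    ok-toCT (edge e t)   = ok-toCT t
    ok-toCT (join t₁ t₂) = ok-toCT t₁ , ok-toCT t₂

    lv-toCT : ∀ {x} (t : PTree′ x) → lv (toCT t) ≡ lv t
    lv-toCT (leaf _)     = refl
    lv-toCT (edge e t)   = lv-toCT t
    lv-toCT (join t₁ t₂) = cong₂ _+_ (lv-toCT t₁) (lv-toCT t₂)

    -- Succeeds only if no leaf is at `V`; otherwise some leaf at `V` can be made the root.
    oldTree : ∀ {x} → PTree′ x → Maybe (PTree x)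
    oldTree (leaf (inj₁ p)) = just (leaf p)
    oldTree (leaf (inj₂ _)) = nothing
    oldTree (edge e t) with oldTree t
    ... | just r  = just (edge e r)
    ... | nothing = nothing
    oldTree (join t₁ t₂) with oldTree t₁ | oldTree t₂
    ... | just r₁ | just r₂ = just (join r₁ r₂)
    ... | _       | _       = nothing

    lv-old : ∀ {x} (t : PTree′ x) {r} → oldTree t ≡ just r → lv r ≡ lv t
    lv-old (leaf (inj₁ p)) refl = refl
    lv-old (edge e t) eq with oldTree t in eq′
    lv-old (edge e t) refl | just r = lv-old t eq′
    lv-old (join t₁ t₂) eq with oldTree t₁ in eq₁ | oldTree t₂ in eq₂
    lv-old (join t₁ t₂) refl | just r₁ | just r₂ = cong₂ _+_ (lv-old t₁ eq₁) (lv-old t₂ eq₂)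

    record Rooted {x} (A : Domains) (t c : CT x) : Set where
      field
        {var} : Var
        isV   : V var
        tree  : CT var
        fine  : okJ tree
        back⁻ : ∀ {b} → A var b ≡ true → Rz (base A false) tree b →
                ∃ λ a → Rz (base A false) t a × Rz (base A false) c a
    open Rooted

    -- A leaf at `V` becomes the root, where arc-consistency realises the rest of the tree for every
    -- value in its domain.
    root : ∀ A {x} (t : PTree′ x) (c : CT x) → Pair (toCT t) c → oldTree t ≡ nothing → Rooted A (toCT t) c
    root A (leaf (inj₂ v)) c π eq = record
      { isV = v ; tree = c ; fine = proj₂ (pair-okJ π) ; back⁻ = λ h r → _ , (Rz-In c r , λ _ → h) , r }
    root A (edge e t) c π eq with oldTree t in eq′
    ... | nothing = record
        { isV = isV R ; tree = tree R ; fine = fine R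
        ; back⁻ = λ h r → let (_ , r₁ , r₂) = back⁻ R h r in upE e π {S = base A false} r₁ r₂ }
      where R = root A t (downE e π) (pair-downE e π) eq′
    root A (join t₁ t₂) c π eq with oldTree t₁ in eq₁ | oldTree t₂ in eq₂
    ... | nothing | _ = record
        { isV = isV R ; tree = tree R ; fine = fine R
        ; back⁻ = λ h r → let (a , r₁ , r₂ , r₃) = back⁻ R h r in a , (r₁ , r₂) , r₃ }
      where R = root A t₁ (join (toCT t₂) c) (pair-joinˡ π) eq₁
    ... | just _ | nothing = record
        { isV = isV R ; tree = tree R ; fine = fine R
        ; back⁻ = λ h r → let (a , r₂ , r₁ , r₃) = back⁻ R h r in a , (r₁ , r₂) , r₃ }
      where R = root A t₂ (join (toCT t₁) c) (pair-joinˡ (pair-swap π)) eq₂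

    module Next (disjoint : ∀ {x} → P x → V x → ⊥)
      (Dl-inhabited : ∀ x → ∃ (Dl x))
      (Hleaf : ∀ {x} → P x → Dl x (s x))
      (Hjoin : ∀ {x} (r₁ r₂ : PTree x) → lv r₁ + lv r₂ ≤ n → ◇ (∃ λ a → Rz prescribed r₁ a × Rz prescribed r₂ a))
      where

      Hypothesis : (Var → Fin d) → Set
      Hypothesis s′ = (∀ {x} → P′ x → Du x (s′ x)) ×
        (∀ {x} (r₁ r₂ : PTree′ x) → lv r₁ + lv r₂ ≤ n → ◇ (∃ λ a → Rz (prescribed′ s′) r₁ a × Rz (prescribed′ s′) r₂ a))

      module _ (A : Domains) (aas : AAS A) (sg : Singletons A)
               (pick : ∀ x → V x → ∃ λ a → A x a ≡ true × Du x a) where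
        open AAS aas

        value : ∀ x → Dec (V x) → Fin d
        value x (yes v) = proj₁ (pick x v)
        value x (no _)  = s x

        s′ : Var → Fin d
        s′ x = value x (V? x)

        s′-old : ∀ {x} → P x → s′ x ≡ s x
        s′-old {x} p with V? x
        ... | yes v = ⊥-elim (disjoint p v)
        ... | no _  = refl

        s′-new : ∀ {x} → V x → A x (s′ x) ≡ true × Du x (s′ x)
        s′-new {x} v with V? x
        ... | yes v′ = proj₂ (pick x v′)
        ... | no ¬v  = ⊥-elim (¬v v)

        old⇒ : ∀ {x} (t : PTree′ x) {r} → oldTree t ≡ just r → ∀ {a} → Rz prescribed r a → Rz (prescribed′ s′) t a
        old⇒ (leaf (inj₁ p)) refl (i , e) = Dl⊆Du i , trans e (sym (s′-old p))
        old⇒ (edge e t) eq h with oldTree t in eq′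
        old⇒ (edge e t) refl (i , b , ab , h) | just r = Dl⊆Du i , b , ab , old⇒ t eq′ h
        old⇒ (join t₁ t₂) eq h with oldTree t₁ in eq₁ | oldTree t₂ in eq₂
        old⇒ (join t₁ t₂) refl (h₁ , h₂) | just r₁ | just r₂ = old⇒ t₁ eq₁ h₁ , old⇒ t₂ eq₂ h₂

        new⇒ : ∀ {x} (t : PTree′ x) {a} → Rz (base A false) (toCT t) a → Rz (prescribed′ s′) t a
        new⇒ (leaf (inj₁ p)) (i , h) = i , trans (h refl) (sym (s′-old p))
        new⇒ (leaf (inj₂ v)) (i , h) = i , sg _ _ _ v (h refl) (proj₁ (s′-new v))
        new⇒ (edge e t) (i , b , ab , r) = i , b , ab , new⇒ t r
        new⇒ (join t₁ t₂) (r₁ , r₂) = new⇒ t₁ r₁ , new⇒ t₂ r₂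

        -- If both branches have only old leaves, the former invariant applies. Otherwise the tree
        -- is re-rooted at a new leaf, and singleton domains force the chosen value at every new
        -- leaf.
        advanced : Hypothesis s′
        advanced = (λ { {x} (inj₁ p) → subst (Du x) (sym (s′-old p)) (Dl⊆Du (Hleaf p)) ; (inj₂ v) → proj₂ (s′-new v) }) , joins
          where
          pair : ∀ {x} (r₁ r₂ : PTree′ x) → lv r₁ + lv r₂ ≤ n → Pair (toCT r₁) (toCT r₂)
          pair r₁ r₂ l = inner (ok-toCT r₁) (ok-toCT r₂) (subst₂ (λ i j → i + j ≤ n) (sym (lv-toCT r₁)) (sym (lv-toCT r₂)) l)
          fresh : ∀ {x} (r₁ r₂ : PTree′ x) → lv r₁ + lv r₂ ≤ n → oldTree r₁ ≡ nothing →
                  ◇ (∃ λ a → Rz (prescribed′ s′) r₁ a × Rz (prescribed′ s′) r₂ a)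
          fresh r₁ r₂ l eq = do
            let R = root A r₁ (toCT r₂) (pair r₁ r₂ l) eq
            r ← arc (isV R) (tree R) (fine R) (proj₁ (s′-new (isV R)))
            return (let (a , z₁ , z₂) = back⁻ R (proj₁ (s′-new (isV R))) r in a , new⇒ r₁ z₁ , new⇒ r₂ z₂)
          joins : ∀ {x} (r₁ r₂ : PTree′ x) → lv r₁ + lv r₂ ≤ n →
                  ◇ (∃ λ a → Rz (prescribed′ s′) r₁ a × Rz (prescribed′ s′) r₂ a)
          joins r₁ r₂ l with oldTree r₁ in eq₁ | oldTree r₂ in eq₂
          ... | just q₁ | just q₂ = do
            (a , h₁ , h₂) ← Hjoin q₁ q₂ (subst₂ (λ i j → i + j ≤ n) (sym (lv-old r₁ eq₁)) (sym (lv-old r₂ eq₂)) l)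
            return (a , old⇒ r₁ eq₁ h₁ , old⇒ r₂ eq₂ h₂)
          ... | nothing | _ = fresh r₁ r₂ l eq₁
          ... | just _ | nothing = do
            (a , h₂ , h₁) ← fresh r₂ r₁ (subst (_≤ n) (ℕ.+-comm (lv r₁) (lv r₂)) l) eq₂
            return (a , h₁ , h₂)

      advance : ◇ (∃ Hypothesis)
      advance = do
          (A₀ , aas₀) ← Prescribe.initial Dl-inhabited Hleaf Hjoin
          (A , aas , sg) ← singletons _ A₀ aas₀ ℕ.≤-refl
          pick ← all-◇ λ x → choose A aas x (V? x)
          return (_ , advanced A aas sg pick)
        where
        choose : ∀ A → AAS A → ∀ x → Dec (V x) → ◇ (V x → ∃ λ a → A x a ≡ true × Du x a)
        choose A aas x (no ¬v) = return λ v → ⊥-elim (¬v v)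
        choose A aas x (yes v) = do
          (a , h) ← AAS.nonempty aas v
          i ← AAS.inside aas v h
          return λ _ → a , h , i

-- Chains of subsets

⊆⇒≡⊎< : ∀ {k} (p q : Subset k) → p ⊆ˢ q → p ≡ q ⊎ ∣ p ∣ < ∣ q ∣
⊆⇒≡⊎< [] [] h = inj₁ refl
⊆⇒≡⊎< (true  ∷ p) (false ∷ q) h with () ← h here
⊆⇒≡⊎< (true  ∷ p) (true  ∷ q) h = Sum.map (cong (true ∷_)) s≤s (⊆⇒≡⊎< p q (drop-∷-⊆ h))
⊆⇒≡⊎< (false ∷ p) (false ∷ q) h = Sum.map (cong (false ∷_)) id (⊆⇒≡⊎< p q (drop-∷-⊆ h))
⊆⇒≡⊎< (false ∷ p) (true  ∷ q) h = inj₂ (s≤s (p⊆q⇒∣p∣≤∣q∣ (drop-∷-⊆ h)))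

-- Strict growth at every step, starting from a non-empty set, would give the last set more than `d`
-- elements.
repeats : ∀ {d} (D : Fin (suc d) → Subset d) → (∀ k → Nonempty (D k)) → (∀ i → D (inject₁ i) ⊆ˢ D (suc i)) →
          ∃ λ i → D (inject₁ i) ≡ D (suc i)
repeats {d} D ne mono with any? (λ i → ≡-dec Bool._≟_ (D (inject₁ i)) (D (suc i)))
... | yes e   = e
... | no none = ⊥-elim (ℕ.<-irrefl refl (ℕ.≤-trans (subst (_< ∣ D (fromℕ d) ∣) (toℕ-fromℕ d) (large (fromℕ d))) (∣p∣≤n (D (fromℕ d)))))
  where
  large : ∀ k → toℕ k < ∣ D k ∣
  large = <-weakInduction _ base step
    where
    base : 0 < ∣ D zero ∣
    base with ne zero
    ... | x , x∈ = subst (_≤ ∣ D zero ∣) (∣⁅x⁆∣≡1 x) (p⊆q⇒∣p∣≤∣q∣ λ y∈ → subst (_∈ D zero) (sym (x∈⁅y⁆⇒x≡y x y∈)) x∈)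
    step : ∀ i → toℕ (inject₁ i) < ∣ D (inject₁ i) ∣ → toℕ (suc i) < ∣ D (suc i) ∣
    step i h with ⊆⇒≡⊎< (D (inject₁ i)) (D (suc i)) (mono i)
    ... | inj₁ e  = ⊥-elim (none (i , e))
    ... | inj₂ lt = ℕ.≤-trans (s≤s (subst (_< ∣ D (inject₁ i) ∣) (toℕ-inject₁ i) h)) lt

-- Induction on the levels

module Main {d m : ℕ} {ι : Set} (Γ : ι → BinRel d) {n : ℕ} (2≤n : 2 ≤ n)
  (f : (Fin (suc n) → Fin d) → Fin d)
  (ext : ∀ a b → (∀ k → a k ≡ b k) → f a ≡ f b)
  (nu : ∀ a i x → (∀ k → k ≢ i → a k ≡ x) → f a ≡ x)
  (pol : IsPolymorphism n Γ f) (I : Instance m ι) (Ds : Family m d)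
  (ne : ∀ y ℓ → Nonempty (Ds y ℓ)) (mono : ∀ y i → Ds y (inject₁ i) ⊆ˢ Ds y (suc i))
  (ipq : (x : Fin m) (i : Fin d) (a : Fin d) → a ∈ Ds x (inject₁ i) →
     (p q : RawPattern m (nc I)) →
     PathOfNTrees I n p → lab p (beg p) ≡ x → lab p (end p) ≡ x →
     PathOfNTrees I n q → lab q (beg q) ≡ x → lab q (end q) ≡ x →
     ∃ λ (j : ℕ) → InSingletonPlus Γ I Ds i a (iterPQ j p q) a) where

  Ans : Set
  Ans = Satisfiable Γ I

  open TreeLogic Γ I Ans

  pres : ∀ c a b → (∀ k → Γ (crel I c) (a k) (b k)) → Γ (crel I c) (f a) (f b)
  pres c = pol (crel I c)

  Dom : Fin (suc d) → Var → Fin d → Set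
  Dom k x = Sg f (_∈ Ds x k)

  lev : Var → Fin d
  lev x = proj₁ (repeats (Ds x) (ne x) (mono x))

  Below : Fin (suc d) → Var → Set
  Below k x = toℕ (lev x) < toℕ k

  Sem-of : ∀ k → (Var → Fin d) → Sem (Below k) (λ _ → ⊥)
  Sem-of k s = record { In = Dom k ; Lf = λ {x} _ a → a ≡ s x ; Jn = λ () }

  -- The invariant. A tree is given by two branches at a common vertex, which may also be one of its
  -- leaves; all leaves are at variables of level below `k`.
  Solves : Fin (suc d) → (Var → Fin d) → Set
  Solves k s = (∀ {x} → Below k x → Dom k x (s x)) ×
    (∀ {x} (r₁ r₂ : Tree (Below k) (λ _ → ⊥) x) → lv r₁ + lv r₂ ≤ n → ◇ (∃ λ a → Rz (Sem-of k s) r₁ a × Rz (Sem-of k s) r₂ a))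

  no-leaf : ∀ {x} → Tree (Below zero) (λ _ → ⊥) x → ⊥
  no-leaf (edge e t) = no-leaf t
  no-leaf (join t _) = no-leaf t

  start : Solves zero (λ x → proj₁ (ne x zero))
  start = (λ ()) , λ r₁ _ _ → ⊥-elim (no-leaf r₁)

  module Step (i : Fin d) where

    In₁ : Var → Fin d → Set
    In₁ x a = a ∈ Ds x (suc i)

    returns : Returning n (Dom (inject₁ i)) (Dom (suc i))
    returns = Iterate.returns f ext pres (λ x a → a ∈ Ds x (inject₁ i)) In₁ base
      where
      open Realise In₁
      base : ∀ {x a} → a ∈ Ds x (inject₁ i) → ∀ (p q : PWord n x x) → ∃ λ j → ((PR p ⨾ PR q) ^^ j ⨾ PR p) a a
      base {x} {a} a∈ p q =
        let (j , run) = ipq x i a a∈ (wordRaw 2≤n p) (wordRaw 2≤n q)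
                          (wordPath 2≤n p) (lab-beg 2≤n p) (lab-end 2≤n p) (wordPath 2≤n q) (lab-beg 2≤n q) (lab-end 2≤n q)
        in j , iterRuns 2≤n p q j run

    -- For a generator, `(IPQ)_n` is applied to the pattern of `edge e t` whose beginning and end
    -- are both the root. Generated elements follow by applying `f` to realisations.
    extends : Extending n (Dom (inject₁ i)) (Dom (suc i))
    extends {x} {a = a} e t l (gen a∈) =
        let (j , run) = ipq x i a a∈ (stemRaw e t) (stemRaw e t) path (stem-lab e t) (stem-lab e t) path (stem-lab e t) (stem-lab e t)
            (_ , run′) = first (stemRaw e t) refl j run
        in return (Rz-map gen (λ _ _ → tt) (λ ()) (edge e t) (stemRuns e t run′))
      where
      open Realise In₁
      path = single (stem-nTree n e t l)
    extends e t l (app a hs) = do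
      rs ← all-◇ λ k → extends e t l (hs k)
      Rz-op f pres (record { In-c = λ _ a h → return (app a h) ; Lf-c = λ _ _ _ _ → return tt ; Jn-c = λ () }) (edge e t) a rs

    Here : Var → Set
    Here x = lev x ≡ i

    down : ∀ {x a} → Here x → Dom (suc i) x a → Dom (inject₁ i) x a
    down {x} refl = subst (λ D → Sg f (_∈ D) _) (sym (proj₂ (repeats (Ds x) (ne x) (mono x))))

    split : ∀ {x} → Below (suc i) x → Below (inject₁ i) x ⊎ Here x
    split {x} lt with ℕ.m<1+n⇒m<n∨m≡n lt
    ... | inj₁ lt′ = inj₁ (subst (toℕ (lev x) <_) (sym (toℕ-inject₁ i)) lt′)
    ... | inj₂ eq  = inj₂ (toℕ-injective eq)

    disjoint : ∀ {x} → Below (inject₁ i) x → Here x → ⊥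
    disjoint lt refl = ℕ.<-irrefl (sym (toℕ-inject₁ i)) lt

    inhabited : ∀ x → ∃ (Dom (inject₁ i) x)
    inhabited x = let (a , a∈) = ne x (inject₁ i) in a , gen a∈

    module _ (s : Var → Fin d) (h : Solves (inject₁ i) s) where

      open Level Γ I Ans f ext nu pres (Below (inject₁ i)) Here (Dom (inject₁ i)) (Dom (suc i))
        (Sg-mono (mono _ i)) down app extends returns s
      open Solve (λ x → lev x ≟ i)
      open Next disjoint inhabited (proj₁ h) (proj₂ h)

      convert : ∀ {x} → Tree (Below (suc i)) (λ _ → ⊥) x → PTree′ x
      convert (leaf l)     = leaf (split l)
      convert (edge e t)   = edge e (convert t)
      convert (join t₁ t₂) = join (convert t₁) (convert t₂)

      lv-convert : ∀ {x} (t : Tree (Below (suc i)) (λ _ → ⊥) x) → lv (convert t) ≡ lv t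
      lv-convert (leaf l)     = refl
      lv-convert (edge e t)   = lv-convert t
      lv-convert (join t₁ t₂) = cong₂ _+_ (lv-convert t₁) (lv-convert t₂)

      unconvert : ∀ {s′ x} (t : Tree (Below (suc i)) (λ _ → ⊥) x) {a} → Rz (prescribed′ s′) (convert t) a → Rz (Sem-of (suc i) s′) t a
      unconvert (leaf l)     r = r
      unconvert (edge e t)   (d , b , ab , r) = d , b , ab , unconvert t r
      unconvert (join t₁ t₂) (r₁ , r₂) = unconvert t₁ r₁ , unconvert t₂ r₂

      carry : ∃ Hypothesis → ∃ (Solves (suc i))
      carry (s′ , hl , hj) = s′ , (λ {x} lt → hl (split {x} lt)) , λ r₁ r₂ l → do
        (a , z₁ , z₂) ← hj (convert r₁) (convert r₂) (subst₂ (λ j k → j + k ≤ n) (sym (lv-convert r₁)) (sym (lv-convert r₂)) l)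
        return (a , unconvert r₁ z₁ , unconvert r₂ z₂)

      solves-suc : ◇ (∃ (Solves (suc i)))
      solves-suc = do
        h′ ← advance
        return (carry h′)

  solves : ∀ k → ◇ (∃ (Solves k))
  solves = <-weakInduction _ (return (_ , start)) λ i m → m >>= λ { (s , h) → Step.solves-suc i s h }

  satisfiable : Satisfiable Γ I
  satisfiable = (do
    (s , _ , h) ← solves (fromℕ d)
    let below : ∀ x → Below (fromℕ d) x
        below x = subst (toℕ (lev x) <_) (sym (toℕ-fromℕ d)) (toℕ<n (lev x))
    sat ← all-◇ λ c → do
      -- A constraint is a tree with two leaves, given here as a leaf joined to an edge at the same
      -- vertex.
      (a , (_ , p) , _ , b , r , _ , q) ← h (leaf (below (cx I c))) (edge (fw c refl refl) (leaf (below (cy I c)))) 2≤n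
      return (subst₂ (Γ (crel I c)) p q r)
    -- `Ans` is the goal itself, so the identity is a valid continuation.
    return (s , sat)) id

theorem3 : {d m : ℕ} {ι : Set} (Γ : ι → BinRel d) (n : ℕ) → 2 ≤ n →
    (f : (Fin (suc n) → Fin d) → Fin d) →
    IsPolymorphism n Γ f → IsNearUnanimity n f →
    (I : Instance m ι) → IPQ n Γ I → Satisfiable Γ I
theorem3 Γ n 2≤n f pol nu I (Ds , ne , mono , _ , ipq) =
  Main.satisfiable Γ 2≤n g g-ext g-nu (g-pol {Γ = Γ} pol) I Ds ne mono ipq
  where open Normalise 2≤n f nu
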